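{- The set of functions computed by strongly terminating and safe sequential programs whose operators compute polynomial time functions is exactly $\mathrm{FPtime}$, the set of polynomial time computable functions over words.
   Context: Words: $\mathcal{W}$ is the set of finite words over a finite alphabet $\Sigma$, containing distinguished words $\texttt{tt},\texttt{ff}$; $\epsilon$ is the empty word. Operators $op$ have fixed arity $n\ge0$, interpreted as total functions $[\![op]\!]:\mathcal{W}^n\to\mathcal{W}$. Expressions: $E ::= X \mid op(E_1,\dots,E_n)$. Commands: $C ::= X:=E \mid C;C' \mid \texttt{skip}\mid \texttt{if } E\texttt{ then } C\texttt{ else } C'\mid\texttt{while}(E)\{C\}$. A multi-threaded program is a finite map from thread identifiers to commands; a sequential program $M$ is one with a single thread, together with a designated output variable $Y$ and input variables $X_1,\dots,X_n$. A store maps variables to words; $\mu_0$ maps every variable to $\epsilon$. Expression evaluation: $X\mapsto\mu(X)$, $op(E_1,\dots,E_n)\mapsto[\![op]\!](d_1,\dots,d_n)$. Small-step relation $\to_s$: $\mu\vDash\texttt{skip}\to_s\mu$; $\mu\vDash X:=E\to_s\mu[X\leftarrow d]$ where $E$ evaluates to $d$; if $\mu\vDash C_1\to_s\mu_1$ then $\mu\vDash C_1;C_2\to_s\mu_1\vDash C_2$; if $\mu\vDash C_1\to_s\mu_1\vDash C_1'$ then $\mu\vDash C_1;C_2\to_s\mu_1\vDash C_1';C_2$; if $E$ evaluates to $w\in\{\texttt{tt},\texttt{ff}\}$ then $\mu\vDash\texttt{if }E\texttt{ then }C_{\texttt{tt}}\texttt{ else }C_{\texttt{ff}}\to_s\mu\vDash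 C_w$; while with guard $\texttt{ff}$ steps to $\mu$; while with guard $\texttt{tt}$ steps to $\mu\vDash C;\texttt{while}(E)\{C\}$. Global relation $\to_g$: if $M(x)=C$ and $\mu\vDash C\to_s\mu_1$ then $\mu\vDash M\to_g\mu_1\vDash\emptyset$ (thread removed); if $\mu\vDash C\to_s\mu_1\vDash C_1$ then $\mu\vDash M\to_g\mu_1\vDash M[x:=C_1]$. The function computed is $[\![M]\!](d_1,\dots,d_n)=w$ iff $\mu_0[X_1\leftarrow d_1,\dots,X_n\leftarrow d_n]\vDash M\to_g^*\mu\vDash\emptyset$ and $\mu(Y)=w$. $M$ is strongly terminating if from every store every reduction sequence is finite. Tiers $\mathbf{0}\preceq\mathbf{1}$ with $\vee,\wedge$. $\Gamma$ maps variables to tiers; $\Delta$ maps each operator of arity $n$ to a set of types $\alpha_1\to\cdots\to\alpha_n\to\alpha$. Typing: $\Gamma,\Delta\vdash X:\Gamma(X)$; $op(E_1,\dots,E_n):\alpha$ if $E_i:\alpha_i$ and $\alpha_1\to\cdots\to\alpha_n\to\alpha\in\Delta(op)$; $X:=E:\beta$ if $X:\beta$, $E:\alpha$, $\beta\preceq\alpha$; $C;C':\alpha\vee\beta$ if $C:\alpha$, $C':\beta$; $\texttt{skip}:\alpha$ for any $\alpha$; $\texttt{if }E\texttt{ then }C\texttt{ else }C':\alpha$ if $E,C,C'$ all have type $\alpha$; $\texttt{while}(E)\{C\}:\mathbf{1}$ if $E:\mathbf{1}$ and $C:\alpha$ for some $\alpha$. Neutral operator: $[\![op]\!]$ takes only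 values $\texttt{tt},\texttt{ff}$, or for all arguments the result is a sub-word (factor $w=uvu'$) of some argument. Positive operator: $|[\![op]\!](d_1,\dots,d_n)|\le\max_i|d_i|+c$ for a constant $c$. Standing assumption: every operator is neutral or positive. $\Delta$ is safe if every type $\alpha_1\to\cdots\to\alpha_n\to\alpha\in\Delta(op)$ satisfies $\alpha\preceq\bigwedge_i\alpha_i$, and $\alpha=\mathbf{0}$ if $op$ is positive but not neutral. A program is safe if its commands are typable under some $\Gamma$ and some safe $\Delta$. -}

module Defs where

open import Data.Nat using (ℕ; zero; suc; _+_; _*_; _^_; _≤_; _⊔_)
open import Data.Fin using (Fin)
open import Data.List using (List; []; _∷_; _++_; length)
open import Data.Vec using (Vec; []; _∷_; lookup; foldr)
open import Data.Maybe using (Maybe; just; nothing)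
open import Data.Product using (Σ; ∃; ∃-syntax; _×_; _,_)
open import Data.Sum using (_⊎_)
open import Relation.Binary.PropositionalEquality using (_≡_)
open import Relation.Nullary using (¬_)
open import Induction.WellFounded using (Acc)

Word : ℕ → Set
Word k = List (Fin k)

Factor : ∀ {k} → Word k → Word k → Set
Factor {k} w d = Σ (Word k) λ u → Σ (Word k) λ u' → d ≡ u ++ w ++ u'

maxLen : ∀ {k n} → Vec (Word k) n → ℕ
maxLen = foldr _ (λ d m → length d ⊔ m) 0

record Signature (k : ℕ) : Set₁ where
  field
    Op     : Set
    arity  : Op → ℕ
    ⟦_⟧    : (o : Op) → Vec (Word k) (arity o) → Word k

module TM (k : ℕ) where

  data Sym (e : ℕ) : Set where
    letter : Fin k → Sym e
    blank  : Sym e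
    sep    : Sym e
    extra  : Fin e → Sym e

  data Move : Set where
    L R S : Move

  record Machine : Set where
    field
      states : ℕ                 -- states are Fin (suc states); start state is Fin.zero
      extras : ℕ
      δ      : Fin (suc states) → Sym extras →
               Maybe (Fin (suc states) × Sym extras × Move)   -- nothing = halt

  module _ (M : Machine) where
    open Machine M

    -- configuration: state, cells left of head (nearest first), head cell, cells to the right
    record Config : Set where
      constructor conf
      field
        st    : Fin (suc states)
        left  : List (Sym extras)
        cur   : Sym extras
        right : List (Sym extras)

    moveHead : Move → List (Sym extras) → Sym extras → List (Sym extras) →
               List (Sym extras) × Sym extras × List (Sym extras)
    moveHead L []       c r        = [] , blank , c ∷ r
    moveHead L (x ∷ l)  c r        = l , x , c ∷ r
    moveHead R l        c []       = c ∷ l , blank , []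
    moveHead R l        c (x ∷ r)  = c ∷ l , x , r
    moveHead S l        c r        = l , c , r

    step : Config → Config
    step (conf q l c r) with δ q c
    ... | nothing = conf q l c r
    ... | just (q' , c' , m) with moveHead m l c' r
    ...   | (l' , c'' , r') = conf q' l' c'' r'

    run : ℕ → Config → Config
    run zero    γ = γ
    run (suc t) γ = run t (step γ)

    Halted : Config → Set
    Halted (conf q l c r) = δ q c ≡ nothing

    encode : ∀ {n} → Vec (Word k) n → List (Sym extras)
    encode []           = []
    encode (d ∷ [])     = Data.List.map letter d
    encode (d ∷ e ∷ ds) = Data.List.map letter d ++ (sep ∷ encode (e ∷ ds))

    initial : List (Sym extras) → Config
    initial []      = conf Fin.zero [] blank []
    initial (x ∷ r) = conf Fin.zero [] x r

    readWord : List (Sym extras) → Word k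
    readWord []               = []
    readWord (letter a ∷ xs)  = a ∷ readWord xs
    readWord (blank ∷ xs)     = []
    readWord (sep ∷ xs)       = []
    readWord (extra _ ∷ xs)   = []

    output : Config → Word k
    output (conf q l c r) = readWord (c ∷ r)

  inputSize : ∀ {n} → Vec (Word k) n → ℕ
  inputSize = foldr _ (λ d s → length d + s) 0

  -- f is computed by some machine in time bounded by a polynomial
  -- (every polynomial is bounded by (N + c)^c for some c)
  FPtime : ∀ {n} → (Vec (Word k) n → Word k) → Set
  FPtime {n} f = Σ Machine λ M → Σ ℕ λ c → ∀ (ds : Vec (Word k) n) →
    Σ ℕ λ t → t ≤ (inputSize ds + c) ^ c ×
      Halted M (run M t (initial M (encode M ds))) ×
      output M (run M t (initial M (encode M ds))) ≡ f ds

data Tier : Set where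
  𝟘 𝟙 : Tier

data _⪯_ : Tier → Tier → Set where
  𝟘⪯ : ∀ {α} → 𝟘 ⪯ α
  𝟙⪯𝟙 : 𝟙 ⪯ 𝟙

_∨ᵗ_ : Tier → Tier → Tier
𝟘 ∨ᵗ β = β
𝟙 ∨ᵗ β = 𝟙

_∧ᵗ_ : Tier → Tier → Tier
𝟘 ∧ᵗ β = 𝟘
𝟙 ∧ᵗ β = β

⋀ : ∀ {n} → Vec Tier n → Tier
⋀ = foldr _ _∧ᵗ_ 𝟙

module Lang (k : ℕ) (tt ff : Word k) (S : Signature k) where
  open Signature S

  data Exp : Set where
    var : ℕ → Exp
    op  : (o : Op) → Vec Exp (arity o) → Exp

  data Cmd : Set where
    _≔_      : ℕ → Exp → Cmd
    _⨾_      : Cmd → Cmd → Cmd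
    skip     : Cmd
    if_then_else_ : Exp → Cmd → Cmd → Cmd
    while    : Exp → Cmd → Cmd

  Store : Set
  Store = ℕ → Word k

  μ₀ : Store
  μ₀ _ = []

  _[_←_] : Store → ℕ → Word k → Store
  (μ [ X ← d ]) Y with Data.Nat._≟_ X Y
  ... | Relation.Nullary.yes _ = d
  ... | Relation.Nullary.no  _ = μ Y

  mutual
    eval : Store → Exp → Word k
    eval μ (var X)   = μ X
    eval μ (op o es) = ⟦ o ⟧ (evals μ es)

    evals : ∀ {n} → Store → Vec Exp n → Vec (Word k) n
    evals μ []       = []
    evals μ (e ∷ es) = eval μ e ∷ evals μ es

  data Conf : Set where
    done : Store → Conf
    _⊨_  : Store → Cmd → Conf

  data _⊨_→s_ : Store → Cmd → Conf → Set where
    skip→   : ∀ {μ} → μ ⊨ skip →s done μ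
    assign→ : ∀ {μ X E} → μ ⊨ (X ≔ E) →s done (μ [ X ← eval μ E ])
    seq-done : ∀ {μ μ₁ C₁ C₂} → μ ⊨ C₁ →s done μ₁ → μ ⊨ (C₁ ⨾ C₂) →s (μ₁ ⊨ C₂)
    seq-cont : ∀ {μ μ₁ C₁ C₁' C₂} → μ ⊨ C₁ →s (μ₁ ⊨ C₁') →
               μ ⊨ (C₁ ⨾ C₂) →s (μ₁ ⊨ (C₁' ⨾ C₂))
    if-tt    : ∀ {μ E C C'} → eval μ E ≡ tt → μ ⊨ (if E then C else C') →s (μ ⊨ C)
    if-ff    : ∀ {μ E C C'} → eval μ E ≡ ff → μ ⊨ (if E then C else C') →s (μ ⊨ C')
    while-ff : ∀ {μ E C} → eval μ E ≡ ff → μ ⊨ while E C →s done μ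
    while-tt : ∀ {μ E C} → eval μ E ≡ tt → μ ⊨ while E C →s (μ ⊨ (C ⨾ while E C))

  -- For a single-thread program, →g* reaching the empty program means
  -- a sequence of small steps ending in a terminated configuration.
  data _⊨_⇓_ : Store → Cmd → Store → Set where
    last : ∀ {μ C μ'} → μ ⊨ C →s done μ' → μ ⊨ C ⇓ μ'
    more : ∀ {μ C μ₁ C₁ μ'} → μ ⊨ C →s (μ₁ ⊨ C₁) → μ₁ ⊨ C₁ ⇓ μ' → μ ⊨ C ⇓ μ'

  Succ : Store × Cmd → Store × Cmd → Set
  Succ (μ' , C') (μ , C) = μ ⊨ C →s (μ' ⊨ C')

  StronglyTerminating : Cmd → Set
  StronglyTerminating C = ∀ (μ : Store) → Acc Succ (μ , C)

  record SeqProgram (n : ℕ) : Set where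
    field
      body   : Cmd
      output : ℕ
      inputs : Vec ℕ n

  initStore : ∀ {n} → Vec ℕ n → Vec (Word k) n → Store
  initStore []       []       = μ₀
  initStore (X ∷ Xs) (d ∷ ds) = (initStore Xs ds) [ X ← d ]

  Computes : ∀ {n} → SeqProgram n → Vec (Word k) n → Word k → Set
  Computes M ds w = Σ Store λ μ →
    (initStore (SeqProgram.inputs M) ds ⊨ SeqProgram.body M ⇓ μ) ×
    μ (SeqProgram.output M) ≡ w

  Neutral : Op → Set
  Neutral o = (∀ ds → ⟦ o ⟧ ds ≡ tt ⊎ ⟦ o ⟧ ds ≡ ff)
            ⊎ (∀ ds → Σ (Fin (arity o)) λ i → Factor (⟦ o ⟧ ds) (lookup ds i))

  Positive : Op → Set
  Positive o = Σ ℕ λ c → ∀ ds → length (⟦ o ⟧ ds) ≤ maxLen ds + c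

  -- typing: Γ : variables → tiers, Δ o αs α : "αs → α ∈ Δ(o)"
  OpTyping : Set₁
  OpTyping = (o : Op) → Vec Tier (arity o) → Tier → Set

  SafeΔ : OpTyping → Set
  SafeΔ Δ = ∀ o αs α → Δ o αs α →
    (α ⪯ ⋀ αs) × (Positive o → ¬ Neutral o → α ≡ 𝟘)

  module Typing (Γ : ℕ → Tier) (Δ : OpTyping) where
    mutual
      data ⊢E_∶_ : Exp → Tier → Set where
        tvar : ∀ {X} → ⊢E var X ∶ Γ X
        top  : ∀ {o es αs α} → ⊢Es es ∶ αs → Δ o αs α → ⊢E op o es ∶ α

      data ⊢Es_∶_ : ∀ {n} → Vec Exp n → Vec Tier n → Set where
        []  : ⊢Es [] ∶ []
        _∷_ : ∀ {n e α} {es : Vec Exp n} {αs} →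
              ⊢E e ∶ α → ⊢Es es ∶ αs → ⊢Es (e ∷ es) ∶ (α ∷ αs)

    data ⊢C_∶_ : Cmd → Tier → Set where
      tassign : ∀ {X E α} → ⊢E E ∶ α → Γ X ⪯ α → ⊢C (X ≔ E) ∶ Γ X
      tseq    : ∀ {C C' α β} → ⊢C C ∶ α → ⊢C C' ∶ β → ⊢C (C ⨾ C') ∶ (α ∨ᵗ β)
      tskip   : ∀ {α} → ⊢C skip ∶ α
      tif     : ∀ {E C C' α} → ⊢E E ∶ α → ⊢C C ∶ α → ⊢C C' ∶ α →
                ⊢C (if E then C else C') ∶ α
      twhile  : ∀ {E C α} → ⊢E E ∶ 𝟙 → ⊢C C ∶ α → ⊢C while E C ∶ 𝟙

  Safe : Cmd → Set₁
  Safe C = Σ (ℕ → Tier) λ Γ → Σ OpTyping λ Δ →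
    SafeΔ Δ × Σ Tier λ α → Typing.⊢C_∶_ Γ Δ C α

-- The class of functions of arity n computed by strongly terminating, safe
-- sequential programs whose operators are polynomial-time computable
-- (and, by the standing assumption, each neutral or positive).

ComputedBySafeProgram : (k : ℕ) (tt ff : Word k) (n : ℕ) →
                        (Vec (Word k) n → Word k) → Set₁
ComputedBySafeProgram k tt ff n f =
  Σ (Signature k) λ S → let open Signature S; open Lang k tt ff S in
    (∀ o → TM.FPtime k (⟦ o ⟧)) ×
    (∀ o → Neutral o ⊎ Positive o) ×
    Σ (SeqProgram n) λ M →
      StronglyTerminating (SeqProgram.body M) ×
      Safe (SeqProgram.body M) ×
      (∀ ds → Computes M ds (f ds))

{-# OPTIONS --safe #-}
-- From programs to FPtime: a terminating run of a safe program is simulated by a Turing machine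
-- that keeps its variables on the stacks of a multi-stack machine.  Tier-1 values are produced by
-- neutral operators only, so they are factors of tt, ff or an input, and polynomially many tier-1
-- stores are possible.  Tier 1 determines the control flow of loops, hence a terminating loop meets
-- no tier-1 store twice, and the run has polynomially many steps.  Each step lengthens a word by at
-- most a constant, so every operator is applied to words of polynomial size.
--
-- From FPtime to programs: the operator sending (y , ds) to the prefix of f ds of length |y| + 1 is
-- positive and polynomial-time computable, and iterating it from the empty word reaches f ds as soon
-- as the number of iterations, supplied by nested loops over the inputs, exceeds the length of f ds.

module Submission where

open import Defs
open import Data.Bool using (Bool; true; false)
open import Data.Empty using (⊥-elim)
open import Data.Fin using (Fin; toℕ; fromℕ<)
import Data.Fin as Fin
import Data.Fin.Properties as Finₚ
open import Data.List using (List; []; _∷_; _++_; _ʳ++_; length)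
import Data.List as List
import Data.List.Properties as Listₚ
open import Data.List.Relation.Unary.All using (All; []; _∷_)
import Data.List.Relation.Unary.All as All
import Data.List.Relation.Unary.All.Properties as Allₚ
open import Data.Maybe using (Maybe; just; nothing)
import Data.Maybe as Maybe
open import Data.Nat using (ℕ; zero; suc; _+_; _*_; _^_; _∸_; _⊔_; _≤_; _<_; z≤n; s≤s; _≤?_; _<?_)
open import Data.Nat.Properties
open import Data.Nat.Tactic.RingSolver using (solve-∀)
open import Data.Product using (Σ; _×_; _,_; proj₁; proj₂)
open import Data.Sum using (_⊎_; inj₁; inj₂)
open import Data.Unit using (⊤; tt)
open import Data.Vec using (Vec; []; _∷_; lookup; _[_]≔_)
import Data.Vec as Vec
import Data.Vec.Properties as Vecₚ
open import Function using (_∘_; id; it)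
open import Induction.WellFounded using (Acc; acc)
open import Relation.Binary.PropositionalEquality
open import Relation.Nullary using (Dec; yes; no)
open import Relation.Nullary.Decidable using (decidable-stable; map′; _⊎-dec_)

-- The order of the estimates avoids a circle. The number of steps is bounded from tier-1 data
-- alone, before anything is known about tier-0 words; lengths follow from the number of steps, and
-- the costs of operator calls from the lengths. A conditional whose guard has tier `𝟘` may branch
-- on data that cannot be counted, but then its branches have tier `𝟘` too: they contain no loop and
-- assign no tier-1 variable. So the tier-1 part of the store at a loop head determines how many
-- iterations remain, and as this number drops with every iteration, no such part recurs. Costs are
-- counted on three levels (steps of the program, stack operations, moves on the tape), with a
-- uniform price per unit on each level. In the converse direction `f` itself cannot serve as an
-- operator, since it may be neither neutral nor positive; `grow` spreads its value over many calls,
-- each of which computes `f` anew and shows only one more letter of it.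

-- Finite types, for the states and symbols of machines

record Finite (A : Set) : Set where
  field
    size    : ℕ
    enc     : A → Fin size
    dec     : Fin size → A
    dec-enc : ∀ a → dec (enc a) ≡ a

open Finite ⦃ ... ⦄ using (enc; dec; dec-enc)

-- Only decoding after encoding has to be the identity. Finiteness therefore passes along every map
-- with a left inverse, and codes that encode nothing do no harm in a machine.
retract : ∀ {A B : Set} → Finite B → (f : A → B) (g : B → A) → (∀ a → g (f a) ≡ a) → Finite A
retract FB f g gf = record
  { size    = Finite.size FB
  ; enc     = Finite.enc FB ∘ f
  ; dec     = g ∘ Finite.dec FB
  ; dec-enc = λ a → trans (cong g (Finite.dec-enc FB (f a))) (gf a)
  }

instance
  finite-⊤ : Finite ⊤
  finite-⊤ = record { size = 1 ; enc = λ _ → Fin.zero ; dec = λ _ → tt ; dec-enc = λ _ → refl }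

  finite-Fin : ∀ {n} → Finite (Fin n)
  finite-Fin {n} = record { size = n ; enc = id ; dec = id ; dec-enc = λ _ → refl }

  finite-⊎ : ∀ {A B : Set} ⦃ _ : Finite A ⦄ ⦃ _ : Finite B ⦄ → Finite (A ⊎ B)
  finite-⊎ {A} {B} ⦃ FA ⦄ ⦃ FB ⦄ = record
    { size    = Finite.size FA + Finite.size FB
    ; enc     = λ ab → Fin.join _ _ (Data.Sum.map enc enc ab)
    ; dec     = λ i → Data.Sum.map dec dec (Fin.splitAt (Finite.size FA) i)
    ; dec-enc = λ ab → trans (cong (Data.Sum.map dec dec) (Finₚ.splitAt-join (Finite.size FA) _ (Data.Sum.map enc enc ab))) (undo ab)
    }
    where
    undo : (ab : A ⊎ B) → Data.Sum.map dec dec (Data.Sum.map enc enc ab) ≡ ab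
    undo (inj₁ a) = cong inj₁ (dec-enc a)
    undo (inj₂ b) = cong inj₂ (dec-enc b)

  finite-× : ∀ {A B : Set} ⦃ _ : Finite A ⦄ ⦃ _ : Finite B ⦄ → Finite (A × B)
  finite-× {A} {B} ⦃ FA ⦄ ⦃ FB ⦄ = record
    { size    = Finite.size FA * Finite.size FB
    ; enc     = λ (a , b) → Fin.combine (enc a) (enc b)
    ; dec     = λ i → Data.Product.map dec dec (Fin.remQuot (Finite.size FB) i)
    ; dec-enc = λ (a , b) → trans (cong (Data.Product.map dec dec) (Finₚ.remQuot-combine (enc a) (enc b)))
                                  (cong₂ _,_ (dec-enc a) (dec-enc b))
    }

  finite-Maybe : ∀ {A : Set} ⦃ _ : Finite A ⦄ → Finite (Maybe A)
  finite-Maybe {A} = retract {B = ⊤ ⊎ A} finite-⊎ (Maybe.maybe inj₂ (inj₁ tt)) (Data.Sum.[ (λ _ → nothing) , just ])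
                       λ { (just _) → refl ; nothing → refl }

  finite-Vec : ∀ {A : Set} {n} ⦃ _ : Finite A ⦄ → Finite (Vec A n)
  finite-Vec {A} {zero}  = retract {B = ⊤} finite-⊤ (λ _ → tt) (λ _ → []) λ { [] → refl }
  finite-Vec {A} {suc n} = retract {B = A × Vec A n} (finite-× ⦃ it ⦄ ⦃ finite-Vec ⦄) (λ { (x ∷ xs) → x , xs }) (λ (x , xs) → x ∷ xs)
                             λ { (_ ∷ _) → refl }

  finite-Sym : ∀ {k e} → Finite (TM.Sym k e)
  finite-Sym {k} {e} = retract {B = Maybe (Maybe (Fin k ⊎ Fin e))} finite-Maybe to from λ
    { (letter _) → refl ; blank → refl ; sep → refl ; (extra _) → refl }
    where
    open TM k
    to : Sym e → Maybe (Maybe (Fin k ⊎ Fin e))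
    to (letter a) = just (just (inj₁ a))
    to blank      = nothing
    to sep        = just nothing
    to (extra z)  = just (just (inj₂ z))
    from : Maybe (Maybe (Fin k ⊎ Fin e)) → Sym e
    from (just (just (inj₁ a))) = letter a
    from (just (just (inj₂ z))) = extra z
    from (just nothing)         = sep
    from nothing                = blank

-- Polynomial bounds

infixl 6 _⊕_
infixl 7 _⊗_
infixl 8 _⊙_

-- Bounds are kept as syntax, closed under composition, so that monotonicity and the passage to the
-- form required by `FPtime` are proved once for all of them.
data Poly : Set where
  con         : ℕ → Poly
  𝕏           : Poly
  _⊕_ _⊗_ _⊙_ : Poly → Poly → Poly
  pow         : Poly → ℕ → Poly

⟪_⟫ : Poly → ℕ → ℕ
⟪ con c ⟫   N = c
⟪ 𝕏 ⟫       N = N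
⟪ p ⊕ q ⟫   N = ⟪ p ⟫ N + ⟪ q ⟫ N
⟪ p ⊗ q ⟫   N = ⟪ p ⟫ N * ⟪ q ⟫ N
⟪ p ⊙ q ⟫   N = ⟪ p ⟫ (⟪ q ⟫ N)
⟪ pow p e ⟫ N = ⟪ p ⟫ N ^ e

Poly-mono : ∀ p {M N} → M ≤ N → ⟪ p ⟫ M ≤ ⟪ p ⟫ N
Poly-mono (con c)   h = ≤-refl
Poly-mono 𝕏         h = h
Poly-mono (p ⊕ q)   h = +-mono-≤ (Poly-mono p h) (Poly-mono q h)
Poly-mono (p ⊗ q)   h = *-mono-≤ (Poly-mono p h) (Poly-mono q h)
Poly-mono (p ⊙ q)   h = Poly-mono p (Poly-mono q h)
Poly-mono (pow p e) h = ^-monoˡ-≤ e (Poly-mono p h)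

-- With a base of at least 2, one more factor pays for doubling; this is why all powers have base
-- `2 + N`.
sum-≤-2+^ : ∀ N a b → (2 + N) ^ a + (2 + N) ^ b ≤ (2 + N) ^ suc (a + b)
sum-≤-2+^ N a b = begin
  (2 + N) ^ a + (2 + N) ^ b              ≤⟨ +-mono-≤ (^-monoʳ-≤ (2 + N) (m≤m+n a b)) (^-monoʳ-≤ (2 + N) (m≤n+m b a)) ⟩
  (2 + N) ^ (a + b) + (2 + N) ^ (a + b)  ≡⟨ cong ((2 + N) ^ (a + b) +_) (+-identityʳ _) ⟨
  2 * (2 + N) ^ (a + b)                  ≤⟨ *-monoˡ-≤ ((2 + N) ^ (a + b)) (m≤m+n 2 N) ⟩
  (2 + N) ^ suc (a + b)                  ∎
  where open ≤-Reasoning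

n≤2+^ : ∀ N n → n ≤ (2 + N) ^ n
n≤2+^ N zero    = z≤n
n≤2+^ N (suc n) = begin
  1 + n                    ≤⟨ +-mono-≤ (m^n>0 (2 + N) n) (n≤2+^ N n) ⟩
  (2 + N) ^ n + (2 + N) ^ n  ≡⟨ cong ((2 + N) ^ n +_) (+-identityʳ _) ⟨
  2 * (2 + N) ^ n            ≤⟨ *-monoˡ-≤ ((2 + N) ^ n) (m≤m+n 2 N) ⟩
  (2 + N) ^ suc n            ∎
  where open ≤-Reasoning

-- Not the algebraic degree but an exponent that works over the base `2 + N` without a leading
-- coefficient. Hence a constant `c` counts as `c`, and a sum costs one extra.
degree : Poly → ℕ
degree (con c)   = c
degree 𝕏         = 1
degree (p ⊕ q)   = suc (degree p + degree q)
degree (p ⊗ q)   = degree p + degree q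
degree (p ⊙ q)   = suc (1 + degree q) * degree p
degree (pow p e) = degree p * e

Poly-≤ : ∀ p N → ⟪ p ⟫ N ≤ (2 + N) ^ degree p
Poly-≤ (con c) N = n≤2+^ N c
Poly-≤ 𝕏 N = ≤-trans (m≤n+m N 2) (≤-reflexive (sym (*-identityʳ (2 + N))))
Poly-≤ (p ⊕ q) N = ≤-trans (+-mono-≤ (Poly-≤ p N) (Poly-≤ q N)) (sum-≤-2+^ N (degree p) (degree q))
Poly-≤ (p ⊗ q) N = ≤-trans (*-mono-≤ (Poly-≤ p N) (Poly-≤ q N)) (≤-reflexive (sym (^-distribˡ-+-* (2 + N) (degree p) (degree q))))
Poly-≤ (p ⊙ q) N = begin
  ⟪ p ⟫ (⟪ q ⟫ N)                              ≤⟨ Poly-≤ p (⟪ q ⟫ N) ⟩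
  (2 + ⟪ q ⟫ N) ^ degree p                     ≤⟨ ^-monoˡ-≤ (degree p) (+-mono-≤ (≤-trans (m≤m+n 2 N) (≤-reflexive (sym (*-identityʳ (2 + N))))) (Poly-≤ q N)) ⟩
  ((2 + N) ^ 1 + (2 + N) ^ degree q) ^ degree p ≤⟨ ^-monoˡ-≤ (degree p) (sum-≤-2+^ N 1 (degree q)) ⟩
  ((2 + N) ^ suc (1 + degree q)) ^ degree p    ≡⟨ ^-*-assoc (2 + N) (suc (1 + degree q)) (degree p) ⟩
  (2 + N) ^ (suc (1 + degree q) * degree p)    ∎
  where open ≤-Reasoning
Poly-≤ (pow p e) N = ≤-trans (^-monoˡ-≤ e (Poly-≤ p N)) (≤-reflexive (^-*-assoc (2 + N) (degree p) e))

-- `FPtime` has a single constant as both summand and exponent; `2 + degree p` is at least 2 as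
-- summand and at least `degree p` as exponent.
Poly-≤-diagonal : ∀ p N → ⟪ p ⟫ N ≤ (N + (2 + degree p)) ^ (2 + degree p)
Poly-≤-diagonal p N = begin
  ⟪ p ⟫ N                              ≤⟨ Poly-≤ p N ⟩
  (2 + N) ^ degree p                   ≤⟨ ^-monoʳ-≤ (2 + N) (m≤n+m (degree p) 2) ⟩
  (2 + N) ^ (2 + degree p)             ≤⟨ ^-monoˡ-≤ (2 + degree p) (≤-trans (≤-reflexive (+-comm 2 N)) (+-monoʳ-≤ N (m≤m+n 2 (degree p)))) ⟩
  (N + (2 + degree p)) ^ (2 + degree p) ∎
  where open ≤-Reasoning

-- Flow charts and their compilation to Turing machines

infixr 5 _⨟_

-- The types `A` and `B` are the finite control at entry and exit; `iter` feeds `inj₁` back to its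
-- entry and leaves with `inj₂`.
data Flow (Op : Set → Set) : Set → Set → Set₁ where
  prim   : ∀ {A B} ⦃ _ : Finite A ⦄ → (A → Op B) → Flow Op A B
  _⨟_    : ∀ {A B C} → Flow Op A B → Flow Op B C → Flow Op A C
  iter   : ∀ {A B} → Flow Op A (A ⊎ B) → Flow Op A B
  branch : ∀ {A B C} → Flow Op A C → Flow Op B C → Flow Op (A ⊎ B) C

-- t bounds the number of primitive operations from above.
module Semantics (Op : Set → Set) (S : Set) (exec : ∀ {B} → Op B → S → B × S) where

  data Run : ∀ {A B} → Flow Op A B → A → S → B → S → ℕ → Set₁ where
    prim    : ∀ {A B} ⦃ _ : Finite A ⦄ {p : A → Op B} {a s b s′} → exec (p a) s ≡ (b , s′) → Run (prim p) a s b s′ 1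
    _⨟_     : ∀ {A B C} {P : Flow Op A B} {Q : Flow Op B C} {a s b s₁ c s₂ t₁ t₂} →
              Run P a s b s₁ t₁ → Run Q b s₁ c s₂ t₂ → Run (P ⨟ Q) a s c s₂ (t₁ + t₂)
    again   : ∀ {A B} {P : Flow Op A (A ⊎ B)} {a s a′ s₁ b s₂ t₁ t₂} →
              Run P a s (inj₁ a′) s₁ t₁ → Run (iter P) a′ s₁ b s₂ t₂ → Run (iter P) a s b s₂ (t₁ + t₂)
    stop    : ∀ {A B} {P : Flow Op A (A ⊎ B)} {a s b s₁ t} →
              Run P a s (inj₂ b) s₁ t → Run (iter P) a s b s₁ t
    branch₁ : ∀ {A B C} {P : Flow Op A C} {Q : Flow Op B C} {a s c s₁ t} →
              Run P a s c s₁ t → Run (branch P Q) (inj₁ a) s c s₁ t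
    branch₂ : ∀ {A B C} {P : Flow Op A C} {Q : Flow Op B C} {b s c s₁ t} →
              Run Q b s c s₁ t → Run (branch P Q) (inj₂ b) s c s₁ t
    weaken  : ∀ {A B} {P : Flow Op A B} {a s b s₁ t t′} → t ≤ t′ → Run P a s b s₁ t → Run P a s b s₁ t′

module Tape (k e : ℕ) where
  open TM k

  Tape : Set
  Tape = List (Sym e) × Sym e × List (Sym e)

  -- A copy of `moveHead` that depends on the number of extra symbols only, so that runs on tapes
  -- can be stated before a machine is built.
  move : Move → List (Sym e) → Sym e → List (Sym e) → Tape
  move L []      c r       = [] , blank , c ∷ r
  move L (x ∷ l) c r       = l , x , c ∷ r
  move R l       c []      = c ∷ l , blank , []
  move R l       c (x ∷ r) = c ∷ l , x , r
  move S l       c r       = l , c , r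

  TapeOp : Set → Set
  TapeOp B = Sym e → Sym e × Move × B

  exec : ∀ {B} → TapeOp B → Tape → B × Tape
  exec o (l , c , r) = let (y , m , b) = o c in b , move m l y r

  open Semantics TapeOp Tape exec public

  State : ∀ {A B} → Flow TapeOp A B → Set
  State (prim {A} _)  = A
  State (P ⨟ Q)       = State P ⊎ State Q
  State (iter P)      = State P
  State (branch P Q)  = State P ⊎ State Q

  finite-State : ∀ {A B} (P : Flow TapeOp A B) → Finite (State P)
  finite-State (prim _)     = it
  finite-State (P ⨟ Q)      = finite-⊎ ⦃ finite-State P ⦄ ⦃ finite-State Q ⦄
  finite-State (iter P)     = finite-State P
  finite-State (branch P Q) = finite-⊎ ⦃ finite-State P ⦄ ⦃ finite-State Q ⦄

  enter : ∀ {A B} (P : Flow TapeOp A B) → A → State P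
  enter (prim _)     a        = a
  enter (P ⨟ Q)      a        = inj₁ (enter P a)
  enter (iter P)     a        = enter P a
  enter (branch P Q) (inj₁ a) = inj₁ (enter P a)
  enter (branch P Q) (inj₂ b) = inj₂ (enter Q b)

  onTarget : ∀ {X Y : Set} → (X → Y) → Sym e × Move × X → Sym e × Move × Y
  onTarget f (y , m , x) = y , m , f x

  seq₁ : ∀ {A B C} (P : Flow TapeOp A B) (Q : Flow TapeOp B C) → State P ⊎ B → State (P ⨟ Q) ⊎ C
  seq₁ P Q (inj₁ q) = inj₁ (inj₁ q)
  seq₁ P Q (inj₂ b) = inj₁ (inj₂ (enter Q b))

  loop : ∀ {A B} (P : Flow TapeOp A (A ⊎ B)) → State P ⊎ (A ⊎ B) → State P ⊎ B
  loop P (inj₁ q)        = inj₁ q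
  loop P (inj₂ (inj₁ a)) = inj₁ (enter P a)
  loop P (inj₂ (inj₂ b)) = inj₂ b

  -- Leaving one component and entering the next is a single transition (`seq₁`, `loop`). Joining
  -- flows thus costs no step, and times simply add.
  trans₁ : ∀ {A B} (P : Flow TapeOp A B) → State P → Sym e → Sym e × Move × (State P ⊎ B)
  trans₁ (prim p)     a        c = onTarget inj₂ (p a c)
  trans₁ (P ⨟ Q)      (inj₁ q) c = onTarget (seq₁ P Q) (trans₁ P q c)
  trans₁ (P ⨟ Q)      (inj₂ q) c = onTarget (Data.Sum.map₁ inj₂) (trans₁ Q q c)
  trans₁ (iter P)     q        c = onTarget (loop P) (trans₁ P q c)
  trans₁ (branch P Q) (inj₁ q) c = onTarget (Data.Sum.map₁ inj₁) (trans₁ P q c)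
  trans₁ (branch P Q) (inj₂ q) c = onTarget (Data.Sum.map₁ inj₂) (trans₁ Q q c)

  data Steps {A B} (P : Flow TapeOp A B) : State P → Tape → B → Tape → ℕ → Set where
    exit : ∀ {q l c r y m b} → trans₁ P q c ≡ (y , m , inj₂ b) → Steps P q (l , c , r) b (move m l y r) 1
    go   : ∀ {q l c r y m q′ b tp t} → trans₁ P q c ≡ (y , m , inj₁ q′) →
           Steps P q′ (move m l y r) b tp t → Steps P q (l , c , r) b tp (suc t)

  Steps-⨟₂ : ∀ {A B C} {P : Flow TapeOp A B} {Q : Flow TapeOp B C} {q tp c tp′ t} →
             Steps Q q tp c tp′ t → Steps (P ⨟ Q) (inj₂ q) tp c tp′ t
  Steps-⨟₂ (exit eq) = exit (cong (onTarget (Data.Sum.map₁ inj₂)) eq)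
  Steps-⨟₂ (go eq σ) = go (cong (onTarget (Data.Sum.map₁ inj₂)) eq) (Steps-⨟₂ σ)

  Steps-⨟ : ∀ {A B C} {P : Flow TapeOp A B} {Q : Flow TapeOp B C} {q tp b tp₁ c tp₂ t₁ t₂} →
            Steps P q tp b tp₁ t₁ → Steps Q (enter Q b) tp₁ c tp₂ t₂ → Steps (P ⨟ Q) (inj₁ q) tp c tp₂ (t₁ + t₂)
  Steps-⨟ {P = P} {Q} (exit eq) τ = go (cong (onTarget (seq₁ P Q)) eq) (Steps-⨟₂ τ)
  Steps-⨟ {P = P} {Q} (go eq σ) τ = go (cong (onTarget (seq₁ P Q)) eq) (Steps-⨟ σ τ)

  Steps-again : ∀ {A B} {P : Flow TapeOp A (A ⊎ B)} {q tp a tp₁ b tp₂ t₁ t₂} →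
                Steps P q tp (inj₁ a) tp₁ t₁ → Steps (iter P) (enter P a) tp₁ b tp₂ t₂ → Steps (iter P) q tp b tp₂ (t₁ + t₂)
  Steps-again {P = P} (exit eq) τ = go (cong (onTarget (loop P)) eq) τ
  Steps-again {P = P} (go eq σ) τ = go (cong (onTarget (loop P)) eq) (Steps-again σ τ)

  Steps-stop : ∀ {A B} {P : Flow TapeOp A (A ⊎ B)} {q tp b tp₁ t} →
               Steps P q tp (inj₂ b) tp₁ t → Steps (iter P) q tp b tp₁ t
  Steps-stop {P = P} (exit eq) = exit (cong (onTarget (loop P)) eq)
  Steps-stop {P = P} (go eq σ) = go (cong (onTarget (loop P)) eq) (Steps-stop σ)

  Steps-branch₁ : ∀ {A B C} {P : Flow TapeOp A C} {Q : Flow TapeOp B C} {q tp c tp′ t} →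
                  Steps P q tp c tp′ t → Steps (branch P Q) (inj₁ q) tp c tp′ t
  Steps-branch₁ (exit eq) = exit (cong (onTarget (Data.Sum.map₁ inj₁)) eq)
  Steps-branch₁ (go eq σ) = go (cong (onTarget (Data.Sum.map₁ inj₁)) eq) (Steps-branch₁ σ)

  Steps-branch₂ : ∀ {A B C} {P : Flow TapeOp A C} {Q : Flow TapeOp B C} {q tp c tp′ t} →
                  Steps Q q tp c tp′ t → Steps (branch P Q) (inj₂ q) tp c tp′ t
  Steps-branch₂ (exit eq) = exit (cong (onTarget (Data.Sum.map₁ inj₂)) eq)
  Steps-branch₂ (go eq σ) = go (cong (onTarget (Data.Sum.map₁ inj₂)) eq) (Steps-branch₂ σ)

  -- The inequality comes from `weaken` alone; every other rule is matched by exactly as many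
  -- transitions.
  Run⇒Steps : ∀ {A B} {P : Flow TapeOp A B} {a tp b tp′ t} → Run P a tp b tp′ t →
              Σ ℕ λ t′ → t′ ≤ t × Steps P (enter P a) tp b tp′ t′
  Run⇒Steps (prim {p = p} refl) = 1 , ≤-refl , exit refl
  Run⇒Steps (ρ ⨟ σ) =
    let t₁ , h₁ , σ₁ = Run⇒Steps ρ
        t₂ , h₂ , σ₂ = Run⇒Steps σ
    in t₁ + t₂ , +-mono-≤ h₁ h₂ , Steps-⨟ σ₁ σ₂
  Run⇒Steps (again ρ σ) =
    let t₁ , h₁ , σ₁ = Run⇒Steps ρ
        t₂ , h₂ , σ₂ = Run⇒Steps σ
    in t₁ + t₂ , +-mono-≤ h₁ h₂ , Steps-again σ₁ σ₂
  Run⇒Steps (stop ρ)    = let t , h , σ = Run⇒Steps ρ in t , h , Steps-stop σ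
  Run⇒Steps (branch₁ ρ) = let t , h , σ = Run⇒Steps ρ in t , h , Steps-branch₁ σ
  Run⇒Steps (branch₂ ρ) = let t , h , σ = Run⇒Steps ρ in t , h , Steps-branch₂ σ
  Run⇒Steps (weaken h ρ) = let t , h′ , σ = Run⇒Steps ρ in t , ≤-trans h′ h , σ

  -- States: the start state 0, the halting state 1, then those of the flow.
  module Compile (P : Flow TapeOp ⊤ ⊤) where

    states : ℕ
    states = suc (Finite.size (finite-State P))

    decState : Fin (suc states) → Maybe (State P)
    decState Fin.zero              = just (enter P tt)
    decState (Fin.suc Fin.zero)    = nothing
    decState (Fin.suc (Fin.suc i)) = just (Finite.dec (finite-State P) i)

    encState : State P ⊎ ⊤ → Fin (suc states)
    encState (inj₁ q) = Fin.suc (Fin.suc (Finite.enc (finite-State P) q))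
    encState (inj₂ _) = Fin.suc Fin.zero

    encTarget : Sym e × Move × (State P ⊎ ⊤) → Fin (suc states) × Sym e × Move
    encTarget (y , m , q) = encState q , y , m

    machine : Machine
    machine = record
      { states = states
      ; extras = e
      ; δ      = λ i c → Maybe.map (λ q → encTarget (trans₁ P q c)) (decState i)
      }

    fromTape : Fin (suc states) → Tape → Config machine
    fromTape i (l , c , r) = conf i l c r

    step-δ : ∀ {i c i′ y m l r} → Machine.δ machine i c ≡ just (i′ , y , m) →
             step machine (conf i l c r) ≡ fromTape i′ (move m l y r)
    step-δ {m = L} {l = []}     eq rewrite eq = refl
    step-δ {m = L} {l = _ ∷ _}  eq rewrite eq = refl
    step-δ {m = R} {r = []}     eq rewrite eq = refl
    step-δ {m = R} {r = _ ∷ _}  eq rewrite eq = refl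
    step-δ {m = S}              eq rewrite eq = refl

    Steps⇒run : ∀ {q tp tp′ t i} → decState i ≡ just q → Steps P q tp tt tp′ t →
                run machine t (fromTape i tp) ≡ fromTape (Fin.suc Fin.zero) tp′
    Steps⇒run {i = i} eqᵢ (exit {c = c} eq) =
      step-δ {i = i} (trans (cong (Maybe.map (λ q → encTarget (trans₁ P q c))) eqᵢ) (cong (just ∘ encTarget) eq))
    Steps⇒run {i = i} eqᵢ (go {c = c} {q′ = q′} {t = t} eq σ) =
      trans (cong (run machine t) (step-δ {i = i} (trans (cong (Maybe.map (λ q → encTarget (trans₁ P q c))) eqᵢ) (cong (just ∘ encTarget) eq))))
            (Steps⇒run (cong just (Finite.dec-enc (finite-State P) q′)) σ)

    Run⇒run : ∀ {tp tp′ t} → Run P tt tp tt tp′ t →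
              Σ ℕ λ t′ → t′ ≤ t × run machine t′ (fromTape Fin.zero tp) ≡ fromTape (Fin.suc Fin.zero) tp′
    Run⇒run ρ = let t′ , h , σ = Run⇒Steps ρ in t′ , h , Steps⇒run refl σ

-- Multi-stack machines on one tape

-- Like `move`, freed from the machine: the same input has to be compared over the alphabets of
-- different machines.
encode : ∀ {k n} e → Vec (Word k) n → List (TM.Sym k e)
encode e []           = []
encode e (d ∷ [])     = List.map TM.letter d
encode e (d ∷ d′ ∷ ds) = List.map TM.letter d ++ TM.sep ∷ encode e (d′ ∷ ds)

encode≡ : ∀ {k n} (M : TM.Machine k) (ds : Vec (Word k) n) → TM.encode k M ds ≡ encode (TM.Machine.extras M) ds
encode≡ M []            = refl
encode≡ M (d ∷ [])      = refl
encode≡ M (d ∷ d′ ∷ ds) = cong (λ xs → List.map TM.letter d ++ TM.sep ∷ xs) (encode≡ M (d′ ∷ ds))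

length-encode : ∀ {k n} e (ds : Vec (Word k) n) → length (encode e ds) ≤ TM.inputSize k ds + n
length-encode e []       = z≤n
length-encode e (d ∷ []) = begin
  length (List.map TM.letter d) ≡⟨ Listₚ.length-map TM.letter d ⟩
  length d                      ≤⟨ m≤m+n (length d) 0 ⟩
  length d + 0                  ≤⟨ m≤m+n (length d + 0) 1 ⟩
  length d + 0 + 1              ∎
  where open ≤-Reasoning
length-encode {k} {n} e (d ∷ d′ ∷ ds) = begin
  length (List.map TM.letter d ++ TM.sep ∷ encode e (d′ ∷ ds))    ≡⟨ Listₚ.length-++ (List.map TM.letter d) ⟩
  length (List.map (TM.letter {e = e}) d) + suc (length (encode e (d′ ∷ ds)))
    ≡⟨ cong (_+ suc (length (encode e (d′ ∷ ds)))) (Listₚ.length-map TM.letter d) ⟩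
  length d + suc (length (encode e (d′ ∷ ds)))                    ≤⟨ +-monoʳ-≤ (length d) (s≤s (length-encode e (d′ ∷ ds))) ⟩
  length d + suc (TM.inputSize k (d′ ∷ ds) + _)                   ≡⟨ cong (length d +_) (sym (+-suc _ _)) ⟩
  length d + (TM.inputSize k (d′ ∷ ds) + n)                       ≡⟨ sym (+-assoc (length d) _ n) ⟩
  length d + TM.inputSize k (d′ ∷ ds) + n                         ∎
  where open ≤-Reasoning

All-ʳ++ : ∀ {A : Set} {P : A → Set} {xs ys} → All P xs → All P ys → All P (xs ʳ++ ys)
All-ʳ++ []       qs = qs
All-ʳ++ (p ∷ ps) qs = All-ʳ++ ps (p ∷ qs)

-- Machines with m stacks over Sym E.  On the tape, every cell holds one entry
-- of each stack; the tops are in the leftmost cell, and between two operations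
-- the head rests on the blank to the left of it.
module Stacks (k E m : ℕ) where
  open TM k hiding (encode)

  Γ : Set
  Γ = Sym E

  Stacks : Set
  Stacks = Vec (List Γ) m

  data StackOp (B : Set) : Set where
    ret  : B → StackOp B
    push : Fin m → Γ → B → StackOp B
    pop  : Fin m → (Maybe Γ → B) → StackOp B

  execˢ : ∀ {B} → StackOp B → Stacks → B × Stacks
  execˢ (ret b)      s = b , s
  execˢ (push i x b) s = b , Vec.updateAt s i (x ∷_)
  execˢ (pop i f)    s = f (List.head (lookup s i)) , Vec.updateAt s i (List.drop 1)

  module Run₂ = Semantics StackOp Stacks execˢ

  Cell : Set
  Cell = Vec (Maybe Γ) m

  cells : ℕ
  cells = Finite.size (finite-Vec {Maybe Γ} {m})

  open Tape k cells

  -- Ordinary symbols read as empty on every track, so the untouched blank part of the tape extends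
  -- every stack by `nothing`.
  cell : Sym cells → Cell
  cell (extra z) = dec z
  cell _         = Vec.replicate m nothing

  get : Fin m → Sym cells → Maybe Γ
  get i c = lookup (cell c) i

  set : Fin m → Maybe Γ → Sym cells → Sym cells
  set i x c = extra (enc (cell c [ i ]≔ x))

  get-blank : ∀ i → get i blank ≡ nothing
  get-blank i = Vecₚ.lookup-replicate i nothing

  get∘set : ∀ i x c → get i (set i x c) ≡ x
  get∘set i x c = trans (cong (λ v → lookup v i) (dec-enc (cell c [ i ]≔ x))) (Vecₚ.lookup∘updateAt i (cell c))

  get∘set′ : ∀ {i j} → j ≢ i → ∀ x c → get j (set i x c) ≡ get j c
  get∘set′ {i} {j} j≢i x c = trans (cong (λ v → lookup v j) (dec-enc (cell c [ i ]≔ x))) (Vecₚ.lookup∘updateAt′ j i j≢i (cell c))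

  track : Fin m → List (Sym cells) → List (Maybe Γ)
  track i = List.map (get i)

  -- All stacks share the cells, so a track may be longer than its stack. It is filled up with
  -- `nothing` and has no gaps; the first `nothing` is where a sweep turns.
  data Holds : List (Maybe Γ) → List Γ → Set where
    []  : ∀ {ys} → All (_≡ nothing) ys → Holds ys []
    _∷_ : ∀ {y ys x w} → y ≡ just x → Holds ys w → Holds (y ∷ ys) (x ∷ w)

  Holds-snoc : ∀ {ys w} → Holds ys w → Holds (ys ++ nothing ∷ []) w
  Holds-snoc ([] h)   = [] (Allₚ.++⁺ h (refl ∷ []))
  Holds-snoc (eq ∷ h) = eq ∷ Holds-snoc h

  Holds-pop : ∀ {y ys w} → Holds (y ∷ ys) w → y ≡ List.head w × Holds ys (List.drop 1 w)
  Holds-pop ([] (eq ∷ h)) = eq , [] h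
  Holds-pop (eq ∷ h)      = eq , h

  Holds-empty : ∀ {ys} → Holds ys [] → All (_≡ nothing) ys
  Holds-empty ([] h) = h

  Rep : Stacks → List (Sym cells) → Set
  Rep s r = ∀ i → Holds (track i r) (lookup s i)

  Full : Fin m → Sym cells → Set
  Full i c = Σ Γ λ x → get i c ≡ just x

  home : List (Sym cells) → Tape
  home r = [] , blank , r

  -- The head at distance length l from the resting position, about to read
  -- leftwards through l, respectively rightwards through r.
  leftTape rightTape : List (Sym cells) → List (Sym cells) → Tape
  leftTape []      r = home r
  leftTape (c ∷ l) r = l ++ blank ∷ [] , c , r
  rightTape l []      = l ++ blank ∷ [] , blank , []
  rightTape l (c ∷ r) = l ++ blank ∷ [] , c , r

  move-L : ∀ l c r → move L (l ++ blank ∷ []) c r ≡ leftTape l (c ∷ r)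
  move-L []      c r = refl
  move-L (_ ∷ _) c r = refl

  move-R : ∀ l c r → move R (l ++ blank ∷ []) c r ≡ rightTape (c ∷ l) r
  move-R l c []      = refl
  move-R l c (_ ∷ _) = refl

  move-home : ∀ r → move R [] blank r ≡ rightTape [] r
  move-home []      = refl
  move-home (_ ∷ _) = refl

  -- As the tops stay in the leftmost cell, an operation shifts a whole track by one cell.
  -- `pushing x` goes right and leaves in each cell the symbol of the cell before; `popping` runs to
  -- the end of the stack, and `carrying z` comes back leaving in each cell the entry of its right
  -- neighbour.
  data Phase : Set where
    pushing   : Γ → Phase
    returning : Phase
    popping   : Phase
    carrying  : Maybe Γ → Phase

  instance
    finite-Phase : Finite Phase
    finite-Phase = retract {B = (Γ ⊎ ⊤) ⊎ (⊤ ⊎ Maybe Γ)} it to from λ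
      { (pushing _) → refl ; returning → refl ; popping → refl ; (carrying _) → refl }
      where
      to : Phase → (Γ ⊎ ⊤) ⊎ (⊤ ⊎ Maybe Γ)
      to (pushing x)  = inj₁ (inj₁ x)
      to returning    = inj₁ (inj₂ tt)
      to popping      = inj₂ (inj₁ tt)
      to (carrying x) = inj₂ (inj₂ x)
      from : (Γ ⊎ ⊤) ⊎ (⊤ ⊎ Maybe Γ) → Phase
      from (inj₁ (inj₁ x)) = pushing x
      from (inj₁ (inj₂ _)) = returning
      from (inj₂ (inj₁ _)) = popping
      from (inj₂ (inj₂ x)) = carrying x

  -- On the way back all cells passed are occupied on track `i`, so the first `nothing` met is the
  -- resting blank. What `carrying` holds there is the popped top, or `nothing` if the stack was
  -- empty.
  sweep : Fin m → Phase → Sym cells → Maybe Γ → Sym cells × Move × (Phase ⊎ Maybe Γ)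
  sweep i (pushing x)  c nothing  = set i (just x) c , L , inj₁ returning
  sweep i (pushing x)  c (just y) = set i (just x) c , R , inj₁ (pushing y)
  sweep i returning    c nothing  = c , S , inj₂ nothing
  sweep i returning    c (just _) = c , L , inj₁ returning
  sweep i popping      c nothing  = c , L , inj₁ (carrying nothing)
  sweep i popping      c (just _) = c , R , inj₁ popping
  sweep i (carrying z) c nothing  = c , S , inj₂ z
  sweep i (carrying z) c (just y) = set i z c , L , inj₁ (carrying (just y))

  module Implementation {A B : Set} ⦃ _ : Finite A ⦄ (p : A → StackOp B) where

    Control : Set
    Control = A × Maybe (Fin m × Phase)

    launch : A → StackOp B → Sym cells → Sym cells × Move × (Control ⊎ B)
    launch a (ret b)      c = c , S , inj₂ b
    launch a (push i x _) c = c , R , inj₁ (a , just (i , pushing x))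
    launch a (pop i _)    c = c , R , inj₁ (a , just (i , popping))

    result : StackOp B → Maybe Γ → B
    result (ret b)      _ = b
    result (push _ _ b) _ = b
    result (pop _ f)    y = f y

    continue : A → Fin m → Phase ⊎ Maybe Γ → Control ⊎ B
    continue a i (inj₁ φ) = inj₁ (a , just (i , φ))
    continue a i (inj₂ y) = inj₂ (result (p a) y)

    control : Control → TapeOp (Control ⊎ B)
    control (a , nothing)      c = launch a (p a) c
    control (a , just (i , φ)) c = onTarget (continue a i) (sweep i φ c (get i c))

    sweeps : Flow TapeOp Control B
    sweeps = iter (prim control)

    implement : Flow TapeOp A B
    implement = prim (λ a c → c , S , (a , nothing)) ⨟ sweeps

    step-L : ∀ {a i φ l c r y φ′ b tp t} → sweep i φ c (get i c) ≡ (y , L , inj₁ φ′) →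
             Run sweeps (a , just (i , φ′)) (leftTape l (y ∷ r)) b tp t →
             Run sweeps (a , just (i , φ)) (l ++ blank ∷ [] , c , r) b tp (suc t)
    step-L {a} {i} {l = l} {c} {r} {y} {φ′} eq ρ = again (prim (trans (cong (λ o → Tape.exec k cells (λ _ → onTarget (continue a i) o) (l ++ blank ∷ [] , c , r)) eq) (cong (inj₁ (a , just (i , φ′)) ,_) (move-L l y r)))) ρ

    step-R : ∀ {a i φ l c r y φ′ b tp t} → sweep i φ c (get i c) ≡ (y , R , inj₁ φ′) →
             Run sweeps (a , just (i , φ′)) (rightTape (y ∷ l) r) b tp t →
             Run sweeps (a , just (i , φ)) (l ++ blank ∷ [] , c , r) b tp (suc t)
    step-R {a} {i} {l = l} {c} {r} {y} {φ′} eq ρ = again (prim (trans (cong (λ o → Tape.exec k cells (λ _ → onTarget (continue a i) o) (l ++ blank ∷ [] , c , r)) eq) (cong (inj₁ (a , just (i , φ′)) ,_) (move-R l y r)))) ρ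

    step-home : ∀ {a i φ y r} → sweep i φ blank nothing ≡ (blank , S , inj₂ y) →
                Run sweeps (a , just (i , φ)) (home r) (result (p a) y) (home r) 1
    step-home {a} {i} {φ} {r = r} eq = stop (prim (cong (λ o → Tape.exec k cells (λ _ → onTarget (continue a i) o) (home r))
                                                        (trans (cong (sweep i φ blank) (get-blank i)) eq)))

    return : ∀ {a i} l {r} → All (Full i) l →
             Run sweeps (a , just (i , returning)) (leftTape l r) (result (p a) nothing) (home (l ʳ++ r)) (suc (length l))
    return []      []             = step-home refl
    return {i = i} (c ∷ l) ((x , eq) ∷ fs) = step-L (cong (sweep i returning c) eq) (return l fs)

    -- Stated through `Holds` and not as equality of tracks, because an operation may add a cell at
    -- the right end, which lengthens the other tracks by `nothing`.
    Changes : Fin m → List (Sym cells) → List (Sym cells) → Set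
    Changes i r r′ = ∀ j → j ≢ i → ∀ {w} → Holds (track j r) w → Holds (track j r′) w

    snoc-changes : ∀ i l c → (∀ j → get j c ≡ nothing) → Changes i (l ʳ++ []) (l ʳ++ c ∷ [])
    snoc-changes i l c eq j j≢i {w} h = subst (λ ys → Holds ys w) lemma (Holds-snoc h)
      where
      lemma : track j (l ʳ++ []) ++ nothing ∷ [] ≡ track j (l ʳ++ c ∷ [])
      lemma = begin
        track j (l ʳ++ []) ++ nothing ∷ []          ≡⟨ cong (λ y → track j (l ʳ++ []) ++ y ∷ []) (eq j) ⟨
        track j (l ʳ++ []) ++ track j (c ∷ [])      ≡⟨ Listₚ.map-++ (get j) (l ʳ++ []) (c ∷ []) ⟨
        track j ((l ʳ++ []) ++ c ∷ [])              ≡⟨ cong (track j) (Listₚ.ʳ++-defn l) ⟨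
        track j (l ʳ++ c ∷ [])                      ∎
        where open ≡-Reasoning

    module _ (a : A) (i : Fin m) where

      -- `l` collects the cells already rewritten, nearest first. The bound counts the writes still
      -- due, one more than the length of `w`, and the way back over these cells and `l` to the
      -- resting blank.
      pushed : ∀ r l x {w} → All (Full i) l → Holds (track i r) w →
               Σ (List (Sym cells)) λ r′ →
               Run sweeps (a , just (i , pushing x)) (rightTape l r) (result (p a) nothing) (home (l ʳ++ r′)) (length l + (2 * length w + 2)) ×
               Holds (track i r′) (x ∷ w) × Changes i r r′
      pushed [] l x fs ([] []) =
        set i (just x) blank ∷ [] ,
        weaken (≤-reflexive (+-comm 2 (length l))) (step-L (cong (sweep i (pushing x) blank) (get-blank i)) (return l fs)) ,
        get∘set i (just x) blank ∷ [] [] ,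
        λ { j j≢i ([] []) → [] (trans (get∘set′ j≢i (just x) blank) (get-blank j) ∷ []) }
      pushed (c ∷ r) l x fs ([] (eq ∷ eqs)) =
        set i (just x) c ∷ r ,
        weaken (≤-reflexive (+-comm 2 (length l))) (step-L (cong (sweep i (pushing x) c) eq) (return l fs)) ,
        get∘set i (just x) c ∷ [] eqs ,
        λ j j≢i {w} → subst (λ y → Holds (y ∷ track j r) w) (sym (get∘set′ j≢i (just x) c))
      pushed (c ∷ r) l x {y ∷ w} fs (eq ∷ h) =
        let r′ , ρ , h′ , others = pushed r (set i (just x) c ∷ l) y ((x , get∘set i (just x) c) ∷ fs) h in
        set i (just x) c ∷ r′ ,
        weaken (≤-reflexive (arith (length l) (length w))) (step-R (cong (sweep i (pushing x) c) eq) ρ) ,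
        get∘set i (just x) c ∷ h′ ,
        λ { j j≢i ([] (e ∷ es)) → [] (trans (get∘set′ j≢i (just x) c) e ∷ Holds-empty (others j j≢i ([] es)))
          ; j j≢i (e ∷ hs)      → trans (get∘set′ j≢i (just x) c) e ∷ others j j≢i hs }
        where
        arith : ∀ l w → suc (suc l + (2 * w + 2)) ≡ l + (2 * suc w + 2)
        arith = solve-∀

      -- The invariant treats the entry in hand as lying between `l` and `r`: the sequence of
      -- entries so formed never changes, and at the resting blank its first element is the one in
      -- hand.
      carried : ∀ l z {r} → All (Full i) l →
                Σ (List (Sym cells)) λ r′ → Σ (Maybe Γ) λ y →
                Run sweeps (a , just (i , carrying z)) (leftTape l r) (result (p a) y) (home r′) (suc (length l)) ×
                y ∷ track i r′ ≡ track i l ʳ++ z ∷ track i r × (∀ j → j ≢ i → track j r′ ≡ track j (l ʳ++ r))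
      carried []      z {r} [] = r , z , step-home refl , refl , λ _ _ → refl
      carried (c ∷ l) z {r} ((x , eq) ∷ fs) =
        let r′ , y , ρ , eq′ , others = carried l (just x) {set i z c ∷ r} fs in
        r′ , y , step-L (cong (sweep i (carrying z) c) eq) ρ ,
        trans eq′ (cong₂ (λ u v → track i l ʳ++ u ∷ v ∷ track i r) (sym eq) (get∘set i z c)) ,
        λ j j≢i → trans (others j j≢i) (trans (Listₚ.map-ʳ++ (get j) l) (trans
                    (cong (λ y → track j l ʳ++ y ∷ track j r) (get∘set′ j≢i z c)) (sym (Listₚ.map-ʳ++ (get j) l))))

      -- `ys` is the rest of the track with one additional `nothing`, inserted at the turn, which
      -- `Holds` tolerates. `Holds-pop` then yields both the popped symbol and the shifted track.
      popped : ∀ r l {w} → All (Full i) l → Holds (track i r) w →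
               Σ (List (Sym cells)) λ r′ → Σ (Maybe Γ) λ y → Σ (List (Maybe Γ)) λ ys →
               Run sweeps (a , just (i , popping)) (rightTape l r) (result (p a) y) (home r′) (length l + (2 * length w + 2)) ×
               y ∷ track i r′ ≡ track i l ʳ++ ys × Holds ys w × Changes i (l ʳ++ r) r′
      popped [] l fs ([] []) =
        let r′ , y , ρ , eq , others = carried l nothing {blank ∷ []} fs in
        r′ , y , nothing ∷ get i blank ∷ [] ,
        weaken (≤-reflexive (+-comm 2 (length l))) (step-L (cong (sweep i popping blank) (get-blank i)) ρ) ,
        eq , [] (refl ∷ get-blank i ∷ []) ,
        λ j j≢i {w} h → subst (λ ys → Holds ys w) (sym (others j j≢i)) (snoc-changes i l blank get-blank j j≢i h)
      popped (c ∷ r) l fs ([] (e ∷ es)) =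
        let r′ , y , ρ , eq , others = carried l nothing {c ∷ r} fs in
        r′ , y , nothing ∷ get i c ∷ track i r ,
        weaken (≤-reflexive (+-comm 2 (length l))) (step-L (cong (sweep i popping c) e) ρ) ,
        eq , [] (refl ∷ e ∷ es) ,
        λ j j≢i {w} → subst (λ ys → Holds ys w) (sym (others j j≢i))
      popped (c ∷ r) l {x ∷ w} fs (e ∷ h) =
        let r′ , y , ys , ρ , eq , h′ , others = popped r (c ∷ l) ((x , e) ∷ fs) h in
        r′ , y , get i c ∷ ys ,
        weaken (≤-reflexive (arith (length l) (length w))) (step-R (cong (sweep i popping c) e) ρ) ,
        eq , e ∷ h′ , others
        where
        arith : ∀ l w → suc (suc l + (2 * w + 2)) ≡ l + (2 * suc w + 2)
        arith = solve-∀

    Rep-update : ∀ {i} {s : Stacks} {r r′} (f : List Γ → List Γ) → Rep s r → Holds (track i r′) (f (lookup s i)) → Changes i r r′ → Rep (Vec.updateAt s i f) r′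
    Rep-update {i} {s} {r′ = r′} f rep h others j with j Fin.≟ i
    ... | yes refl = subst (Holds (track i r′)) (sym (Vecₚ.lookup∘updateAt i s)) h
    ... | no j≢i   = subst (Holds (track j r′)) (sym (Vecₚ.lookup∘updateAt′ j i j≢i s)) (others j j≢i (rep j))

    height-update : ∀ {i} {s : Stacks} {H} (f : List Γ → List Γ) → (∀ j → length (lookup s j) ≤ H) → length (f (lookup s i)) ≤ H →
                    ∀ j → length (lookup (Vec.updateAt s i f) j) ≤ H
    height-update {i} {s} {H} f h hᵢ j with j Fin.≟ i
    ... | yes refl = subst (λ w → length w ≤ H) (sym (Vecₚ.lookup∘updateAt i s)) hᵢ
    ... | no j≢i   = subst (λ w → length w ≤ H) (sym (Vecₚ.lookup∘updateAt′ j i j≢i s)) (h j)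

    launched : ∀ {a i φ r b tp t n H} → (∀ c → launch a (p a) c ≡ (c , R , inj₁ (a , just (i , φ)))) →
               Run sweeps (a , just (i , φ)) (rightTape [] r) b tp t → t ≤ 2 * n + 2 → n ≤ H →
               Run implement a (home r) b tp (2 * H + 4)
    launched {a} {i} {φ} {r} {n = n} {H} eq ρ t≤ n≤H =
      weaken (≤-trans (+-monoʳ-≤ 2 (≤-trans t≤ (+-monoˡ-≤ 2 (*-monoʳ-≤ 2 n≤H)))) (≤-reflexive (arith H)))
        (prim refl ⨟ again (prim (trans (cong (λ o → Tape.exec k cells (λ _ → o) (home r)) (eq blank))
                                        (cong (inj₁ (a , just (i , φ)) ,_) (move-home r)))) ρ)
      where
      arith : ∀ H → 2 + (2 * H + 2) ≡ 2 * H + 4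
      arith = solve-∀

    -- Two steps to set up the control and leave the resting blank, then a sweep of at most
    -- `2 * H + 2` steps.
    simulate : ∀ {a s b s′ r H} → execˢ (p a) s ≡ (b , s′) → Rep s r → (∀ i → length (lookup s i) ≤ H) →
               Σ (List (Sym cells)) λ r′ →
               Run implement a (home r) b (home r′) (2 * H + 4) × Rep s′ r′ × (∀ i → length (lookup s′ i) ≤ suc H)
    simulate {a} eq rep h with p a in eqₚ
    simulate {a} {r = r} {H} refl rep h | ret b =
      r , weaken (≤-trans (m≤n+m 2 2) (m≤n+m 4 (2 * H)))
            (prim refl ⨟ stop (prim (cong (λ o → Tape.exec k cells (launch a o) (home r)) eqₚ))) , rep , λ i → m≤n⇒m≤1+n (h i)
    simulate {a} {s} {r = r} {H} refl rep h | push i x b =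
      let r′ , ρ , h′ , others = pushed a i r [] x [] (rep i) in
      r′ ,
      launched (λ c → cong (λ o → launch a o c) eqₚ)
        (subst (λ o → Run sweeps (a , just (i , pushing x)) (rightTape [] r) (result o nothing) (home r′) (2 * length (lookup s i) + 2)) eqₚ ρ)
        ≤-refl (h i) ,
      Rep-update {s = s} {r} (x ∷_) rep h′ others , height-update {i} {s} (x ∷_) (m≤n⇒m≤1+n ∘ h) (s≤s (h i))
    simulate {a} {s} {r = r} {H} refl rep h | pop i f =
      let r′ , y , ys , ρ , eq , h′ , others = popped a i r [] [] (rep i)
          y≡ , hᵢ = Holds-pop (subst (λ ys → Holds ys (lookup s i)) (sym eq) h′) in
      r′ ,
      launched (λ c → cong (λ o → launch a o c) eqₚ)
        (subst₂ (λ o y → Run sweeps (a , just (i , popping)) (rightTape [] r) (result o y) (home r′) (2 * length (lookup s i) + 2)) eqₚ y≡ ρ)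
        ≤-refl (h i) ,
      Rep-update {s = s} {r} (List.drop 1) rep hᵢ others ,
      height-update {i} {s} (List.drop 1) (m≤n⇒m≤1+n ∘ h)
        (m≤n⇒m≤1+n (≤-trans (≤-reflexive (Listₚ.length-drop 1 (lookup s i))) (≤-trans (m∸n≤m _ 1) (h i))))

  compile : ∀ {A B} → Flow StackOp A B → Flow TapeOp A B
  compile (prim p)     = Implementation.implement p
  compile (P ⨟ Q)      = compile P ⨟ compile Q
  compile (iter P)     = iter (compile P)
  compile (branch P Q) = branch (compile P) (compile Q)

  -- An operation raises a stack by at most one, so heights never exceed `H + t`. The bound `W` is
  -- separate from `H + t` to give all parts of a composite run the same price per operation.
  compile-correct : ∀ {A B} {P : Flow StackOp A B} {a s b s′ t r H W} → Run₂.Run P a s b s′ t → H + t ≤ W →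
                    Rep s r → (∀ i → length (lookup s i) ≤ H) →
                    Σ (List (Sym cells)) λ r′ →
                    Run (compile P) a (home r) b (home r′) (t * (2 * W + 4)) × Rep s′ r′ × (∀ i → length (lookup s′ i) ≤ H + t)
  compile-correct {H = H} {W} (Run₂.prim {p = p} eq) hW rep h =
    let r′ , ρ , rep′ , h′ = Implementation.simulate p eq rep h in
    r′ , weaken (≤-trans (+-monoˡ-≤ 4 (*-monoʳ-≤ 2 (≤-trans (m≤m+n H 1) hW))) (≤-reflexive (sym (+-identityʳ _)))) ρ , rep′ ,
    λ i → ≤-trans (h′ i) (≤-reflexive (+-comm 1 H))
  compile-correct {H = H} {W} (Run₂._⨟_ {t₁ = t₁} {t₂} ρ σ) hW rep h =
    let r₁ , ρ′ , rep₁ , h₁ = compile-correct ρ (≤-trans (+-monoʳ-≤ H (m≤m+n t₁ t₂)) hW) rep h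
        r₂ , σ′ , rep₂ , h₂ = compile-correct σ (≤-trans (≤-reflexive (+-assoc H t₁ t₂)) hW) rep₁ h₁ in
    r₂ , weaken (≤-reflexive (sym (*-distribʳ-+ (2 * W + 4) t₁ t₂))) (ρ′ ⨟ σ′) , rep₂ ,
    λ i → ≤-trans (h₂ i) (≤-reflexive (+-assoc H t₁ t₂))
  compile-correct {H = H} {W} (Run₂.again {t₁ = t₁} {t₂} ρ σ) hW rep h =
    let r₁ , ρ′ , rep₁ , h₁ = compile-correct ρ (≤-trans (+-monoʳ-≤ H (m≤m+n t₁ t₂)) hW) rep h
        r₂ , σ′ , rep₂ , h₂ = compile-correct σ (≤-trans (≤-reflexive (+-assoc H t₁ t₂)) hW) rep₁ h₁ in
    r₂ , weaken (≤-reflexive (sym (*-distribʳ-+ (2 * W + 4) t₁ t₂))) (again ρ′ σ′) , rep₂ ,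
    λ i → ≤-trans (h₂ i) (≤-reflexive (+-assoc H t₁ t₂))
  compile-correct (Run₂.stop ρ) hW rep h =
    let r′ , ρ′ , rest = compile-correct ρ hW rep h in r′ , stop ρ′ , rest
  compile-correct (Run₂.branch₁ ρ) hW rep h =
    let r′ , ρ′ , rest = compile-correct ρ hW rep h in r′ , branch₁ ρ′ , rest
  compile-correct (Run₂.branch₂ ρ) hW rep h =
    let r′ , ρ′ , rest = compile-correct ρ hW rep h in r′ , branch₂ ρ′ , rest
  compile-correct {H = H} {W} (Run₂.weaken t≤ ρ) hW rep h =
    let r′ , ρ′ , rep′ , h′ = compile-correct ρ (≤-trans (+-monoʳ-≤ H t≤) hW) rep h in
    r′ , weaken (*-monoˡ-≤ (2 * W + 4) t≤) ρ′ , rep′ , λ i → ≤-trans (h′ i) (+-monoʳ-≤ H t≤)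

  initialStacks : Fin m → List Γ → Stacks
  initialStacks i w = Vec.replicate m [] [ i ]≔ w

  -- Loading the input and writing the output

  module InputOutput (inp out : Fin m) where

    toΓ : Sym cells → Γ
    toΓ (letter a) = letter a
    toΓ blank      = blank
    toΓ sep        = sep
    toΓ (extra _)  = blank

    load : Sym cells → Sym cells
    load c = set inp (just (toΓ c)) blank

    scanIn : ⊤ → TapeOp (⊤ ⊎ ⊤)
    scanIn _ blank = blank , L , inj₂ tt
    scanIn _ c     = load c , R , inj₁ tt

    rewind : Maybe Γ → Sym cells → Sym cells × Move × (⊤ ⊎ ⊤)
    rewind nothing  c = c , S , inj₂ tt
    rewind (just _) c = c , L , inj₁ tt

    -- Rewinding runs off the left end of the tape, where a fresh blank appears: this becomes the
    -- resting position.
    loadInput : Flow TapeOp ⊤ ⊤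
    loadInput = iter (prim scanIn) ⨟ iter (prim λ _ c → rewind (get inp c) c)

    startTape endTape : List (Sym cells) → List (Sym cells) → Tape
    startTape l []      = l , blank , []
    startTape l (c ∷ r) = l , c , r
    endTape []      r = home r
    endTape (c ∷ l) r = l , c , r

    move-start : ∀ l c r → move R l c r ≡ startTape (c ∷ l) r
    move-start l c []      = refl
    move-start l c (_ ∷ _) = refl

    move-end : ∀ l c r → move L l c r ≡ endTape l (c ∷ r)
    move-end []      c r = refl
    move-end (_ ∷ _) c r = refl

    scanIn-run : ∀ xs l → All (_≢ blank) xs →
                 Run (iter (prim scanIn)) tt (startTape l xs) tt (endTape (List.map load xs ʳ++ l) (blank ∷ [])) (suc (length xs))
    scanIn-run []       l []       = stop (prim (cong (tt′ ,_) (move-end l blank [])))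
      where tt′ = inj₂ tt
    scanIn-run (letter a ∷ xs) l (_ ∷ ne) = again (prim (cong (inj₁ tt ,_) (move-start l _ xs))) (scanIn-run xs (load (letter a) ∷ l) ne)
    scanIn-run (blank ∷ xs)    l (ne ∷ _) = ⊥-elim (ne refl)
    scanIn-run (sep ∷ xs)      l (_ ∷ ne) = again (prim (cong (inj₁ tt ,_) (move-start l _ xs))) (scanIn-run xs (load sep ∷ l) ne)
    scanIn-run (extra z ∷ xs)  l (_ ∷ ne) = again (prim (cong (inj₁ tt ,_) (move-start l _ xs))) (scanIn-run xs (load (extra z) ∷ l) ne)

    rewind-run : ∀ l r → All (Full inp) l →
                 Run (iter (prim λ _ c → rewind (get inp c) c)) tt (endTape l r) tt (home (l ʳ++ r)) (suc (length l))
    rewind-run []      r [] = stop (prim (cong (λ y → Tape.exec k cells (λ _ → rewind y blank) (home r)) (get-blank inp)))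
    rewind-run (c ∷ l) r ((x , eq) ∷ fs) =
      again (prim (trans (cong (λ y → Tape.exec k cells (λ _ → rewind y c) (l , c , r)) eq) (cong (inj₁ tt ,_) (move-end l c r))))
            (rewind-run l (c ∷ r) fs)

    get-load : ∀ c → get inp (load c) ≡ just (toΓ c)
    get-load c = get∘set inp (just (toΓ c)) blank

    loadInput-run : ∀ xs → All (_≢ blank) xs →
                    Run loadInput tt (startTape [] xs) tt (home (List.map load xs ++ blank ∷ [])) (2 * length xs + 2)
    loadInput-run xs ne =
      subst₂ (λ r t → Run loadInput tt (startTape [] xs) tt (home r) t)
        (Listₚ.ʳ++-ʳ++ (List.map load xs))
        (trans (cong (λ n → suc (length xs) + suc n) (trans (Listₚ.length-ʳ++ (List.map load xs)) (trans (+-identityʳ _) (Listₚ.length-map load xs)))) (arith (length xs)))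
        (scanIn-run xs [] ne ⨟ rewind-run (List.map load xs ʳ++ []) (blank ∷ [])
          (All-ʳ++ (Allₚ.map⁺ (All.universal (λ c → toΓ c , get-load c) xs)) []))
      where
      arith : ∀ n → suc n + suc n ≡ 2 * n + 2
      arith = solve-∀

    loadInput-Rep : ∀ xs → Rep (initialStacks inp (List.map toΓ xs)) (List.map load xs ++ blank ∷ [])
    loadInput-Rep xs j with j Fin.≟ inp
    ... | yes refl = subst (Holds (track inp (List.map load xs ++ blank ∷ []))) (sym (Vecₚ.lookup∘updateAt inp (Vec.replicate m []))) (full xs)
      where
      full : ∀ xs → Holds (track inp (List.map load xs ++ blank ∷ [])) (List.map toΓ xs)
      full []       = [] (get-blank inp ∷ [])
      full (c ∷ xs) = get-load c ∷ full xs
    ... | no j≢inp = subst (Holds (track j (List.map load xs ++ blank ∷ [])))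
                       (sym (trans (Vecₚ.lookup∘updateAt′ j inp j≢inp (Vec.replicate m [])) (Vecₚ.lookup-replicate j []))) ([] (clear xs))
      where
      clear : ∀ xs → All (_≡ nothing) (track j (List.map load xs ++ blank ∷ []))
      clear []       = get-blank j ∷ []
      clear (c ∷ xs) = trans (get∘set′ j≢inp (just (toΓ c)) blank) (get-blank j) ∷ clear xs

    scanOut : Maybe Γ → Sym cells × Move × (⊤ ⊎ ⊤)
    scanOut (just (letter a)) = letter a , R , inj₁ tt
    scanOut _                 = blank , L , inj₂ tt

    rewindOut : ⊤ → TapeOp (⊤ ⊎ ⊤)
    rewindOut _ (letter a) = letter a , L , inj₁ tt
    rewindOut _ c          = c , R , inj₂ tt

    -- The result has to be plain letters starting under the head. The cells are overwritten by the
    -- letters of stack `out`, a blank cuts off what remains to the right, and the resting blank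
    -- stops the rewinding.
    storeOutput : Flow TapeOp ⊤ ⊤
    storeOutput = prim (λ _ c → c , R , tt) ⨟ iter (prim λ _ c → scanOut (get out c)) ⨟ iter (prim rewindOut)

    letters : Word k → List (Sym cells)
    letters = List.map letter

    step-out : ∀ {l r y o b tp t} c → get out c ≡ y → scanOut y ≡ (o , R , inj₁ tt) →
               Run (iter (prim λ _ c → scanOut (get out c))) tt (rightTape (o ∷ l) r) b tp t →
               Run (iter (prim λ _ c → scanOut (get out c))) tt (l ++ blank ∷ [] , c , r) b tp (suc t)
    step-out {l} {r} {o = o} c refl eq ρ = again (prim (trans (cong (λ z → Tape.exec k cells (λ _ → z) (l ++ blank ∷ [] , c , r)) eq) (cong (inj₁ tt ,_) (move-R l o r)))) ρ

    stop-out : ∀ l {r} c → get out c ≡ nothing →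
               Run (iter (prim λ _ c → scanOut (get out c))) tt (l ++ blank ∷ [] , c , r) tt (leftTape l (blank ∷ r)) 1
    stop-out l {r} c eq = stop (prim (trans (cong (λ y → Tape.exec k cells (λ _ → scanOut y) (l ++ blank ∷ [] , c , r)) eq) (cong (inj₂ tt ,_) (move-L l blank r))))

    scanOut-run : ∀ r l w → Holds (track out r) (List.map letter w) →
                  Σ (List (Sym cells)) λ r′ →
                  Run (iter (prim λ _ c → scanOut (get out c))) tt (rightTape l r) tt (leftTape (letters w ʳ++ l) (blank ∷ r′)) (suc (length w))
    scanOut-run []      l []      _             = [] , stop-out l blank (get-blank out)
    scanOut-run (c ∷ r) l []      ([] (eq ∷ _)) = r , stop-out l c eq
    scanOut-run (c ∷ r) l (a ∷ w) (eq ∷ h)      =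
      let r′ , ρ = scanOut-run r (letter a ∷ l) w h in r′ , step-out c eq refl ρ

    rewindOut-run : ∀ w r → Run (iter (prim rewindOut)) tt (leftTape (letters w) r) tt (startTape (blank ∷ []) (letters w ʳ++ r)) (suc (length w))
    rewindOut-run []      r = stop (prim (cong (inj₂ tt ,_) (move-start [] blank r)))
    rewindOut-run (a ∷ w) r = again (prim (cong (inj₁ tt ,_) (move-L (letters w) (letter a) r))) (rewindOut-run w (letter a ∷ r))

    storeOutput-run : ∀ {r} w → Holds (track out r) (List.map letter w) →
                      Σ (List (Sym cells)) λ r′ →
                      Run storeOutput tt (home r) tt (startTape (blank ∷ []) (letters w ++ blank ∷ r′)) (2 * length w + 3)
    storeOutput-run {r} w h =
      let r′ , ρ = scanOut-run r [] w h in
      r′ ,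
      weaken (≤-reflexive (trans (cong (λ n → 1 + (suc (length w) + suc n)) (trans (Listₚ.length-ʳ++ w) (+-identityʳ _))) (arith (length w))))
        (prim (cong (tt ,_) (move-home r)) ⨟ ρ ⨟
         subst₂ (λ l xs → Run (iter (prim rewindOut)) tt (leftTape l (blank ∷ r′)) tt (startTape (blank ∷ []) xs) (suc (length (w ʳ++ []))))
           (Listₚ.map-ʳ++ letter w)
           (trans (cong (_ʳ++ blank ∷ r′) (Listₚ.map-ʳ++ letter w)) (Listₚ.ʳ++-ʳ++ (letters w)))
           (rewindOut-run (w ʳ++ []) (blank ∷ r′)))
      where
      arith : ∀ n → 1 + (suc n + suc n) ≡ 2 * n + 3
      arith = solve-∀

    encode-≢blank : ∀ {n} (ds : Vec (Word k) n) → All (_≢ blank) (encode cells ds)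
    encode-≢blank []            = []
    encode-≢blank (d ∷ [])      = Allₚ.map⁺ (All.universal (λ _ ()) d)
    encode-≢blank (d ∷ d′ ∷ ds) = Allₚ.++⁺ (Allₚ.map⁺ (All.universal (λ _ ()) d)) ((λ ()) ∷ encode-≢blank (d′ ∷ ds))

    toΓ-letters : ∀ w → List.map toΓ (List.map letter w) ≡ List.map letter w
    toΓ-letters w = sym (Listₚ.map-∘ w)

    toΓ-encode : ∀ {n} (ds : Vec (Word k) n) → List.map toΓ (encode cells ds) ≡ encode E ds
    toΓ-encode []            = refl
    toΓ-encode (d ∷ [])      = toΓ-letters d
    toΓ-encode (d ∷ d′ ∷ ds) =
      trans (Listₚ.map-++ toΓ (letters d) _) (cong₂ (λ u v → u ++ sep ∷ v) (toΓ-letters d) (toΓ-encode (d′ ∷ ds)))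

    module _ {n : ℕ} (f : Vec (Word k) n → Word k) (P : Flow StackOp ⊤ ⊤) (p : Poly)
             (P-run : ∀ ds → Σ Stacks λ s → Run₂.Run P tt (initialStacks inp (encode E ds)) tt s (⟪ p ⟫ (inputSize ds)) ×
                                            lookup s out ≡ List.map letter (f ds)) where

      size : Poly
      size = 𝕏 ⊕ con n

      time : Poly
      time = (con 2 ⊗ size ⊕ con 2) ⊕ (p ⊗ (con 2 ⊗ (size ⊕ p) ⊕ con 4) ⊕ (con 2 ⊗ (size ⊕ p) ⊕ con 3))

      whole : Flow TapeOp ⊤ ⊤
      whole = loadInput ⨟ compile P ⨟ storeOutput

      height : ∀ (ds : Vec (Word k) n) i → length (lookup (initialStacks inp (encode E ds)) i) ≤ ⟪ size ⟫ (inputSize ds)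
      height ds i with i Fin.≟ inp
      ... | yes refl = subst (λ w → length w ≤ ⟪ size ⟫ (inputSize ds)) (sym (Vecₚ.lookup∘updateAt inp (Vec.replicate m []))) (length-encode E ds)
      ... | no i≢inp = subst (λ w → length w ≤ ⟪ size ⟫ (inputSize ds))
                         (sym (trans (Vecₚ.lookup∘updateAt′ i inp i≢inp (Vec.replicate m [])) (Vecₚ.lookup-replicate i []))) z≤n

      whole-run : ∀ ds → Σ (List (Sym cells)) λ r →
                  Run whole tt (startTape [] (encode cells ds)) tt (startTape (blank ∷ []) (letters (f ds) ++ blank ∷ r)) (⟪ time ⟫ (inputSize ds))
      whole-run ds =
        let N = inputSize ds
            s , ρ , out≡ = P-run ds
            rep₀ = subst (λ w → Rep (initialStacks inp w) (List.map load (encode cells ds) ++ blank ∷ [])) (toΓ-encode ds) (loadInput-Rep (encode cells ds))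
            r₁ , ρ₁ , rep₁ , h₁ = compile-correct ρ ≤-refl rep₀ (height ds)
            r₂ , ρ₂ = storeOutput-run (f ds) (subst (Holds (track out r₁)) out≡ (rep₁ out))
            -- The length of the output is bounded by the final height of the stack that holds it.
            len : length (f ds) ≤ ⟪ size ⊕ p ⟫ N
            len = ≤-trans (≤-reflexive (sym (trans (cong length out≡) (Listₚ.length-map letter (f ds))))) (h₁ out)
        in r₂ ,
           weaken (+-monoˡ-≤ _ (+-monoˡ-≤ 2 (*-monoʳ-≤ 2 (length-encode cells ds)))) (loadInput-run (encode cells ds) (encode-≢blank ds) ⨟
             weaken (+-monoʳ-≤ (⟪ p ⟫ N * (2 * ⟪ size ⊕ p ⟫ N + 4)) (+-monoˡ-≤ 3 (*-monoʳ-≤ 2 len))) (ρ₁ ⨟ ρ₂))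

      open Compile whole

      readWord-letters : ∀ w r → readWord machine (letters w ++ blank ∷ r) ≡ w
      readWord-letters []      r = refl
      readWord-letters (a ∷ w) r = cong (a ∷_) (readWord-letters w r)

      initial≡ : ∀ xs → initial machine xs ≡ fromTape Fin.zero (startTape [] xs)
      initial≡ []      = refl
      initial≡ (_ ∷ _) = refl

      halted : ∀ tp → Halted machine (fromTape (Fin.suc Fin.zero) tp)
      halted _ = refl

      output≡ : ∀ w r → output machine (fromTape (Fin.suc Fin.zero) (startTape (blank ∷ []) (letters w ++ blank ∷ r))) ≡ w
      output≡ []      r = refl
      output≡ (a ∷ w) r = cong (a ∷_) (readWord-letters w r)

      stackProgram⇒FPtime : FPtime f
      stackProgram⇒FPtime = machine , 2 + degree time , λ ds →
        let r , ρ = whole-run ds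
            t , t≤ , eq = Run⇒run ρ
            eq′ = trans (cong (run machine t) (trans (cong (initial machine) (encode≡ machine ds)) (initial≡ (encode cells ds)))) eq
        in t , ≤-trans t≤ (Poly-≤-diagonal time (inputSize ds)) ,
           subst (Halted machine) (sym eq′) (halted (startTape (blank ∷ []) (letters (f ds) ++ blank ∷ r))) ,
           trans (cong (output machine) eq′) (output≡ (f ds) r)

-- Stack programs

instance
  finite-Move : ∀ {k} → Finite (TM.Move k)
  finite-Move {k} = retract {B = Maybe (Maybe ⊤)} it to from λ { L → refl ; R → refl ; S → refl }
    where
    open TM k
    to : Move → Maybe (Maybe ⊤)
    to L = nothing
    to R = just nothing
    to S = just (just tt)
    from : Maybe (Maybe ⊤) → Move
    from nothing          = L
    from (just nothing)   = R
    from (just (just tt)) = S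

-- The count of `simulation-run`, with `𝕏 + n` for the length of the encoded input and the power for
-- the running time of the machine.
simulation-time : ℕ → ℕ → Poly
simulation-time n c = con 4 ⊗ (𝕏 ⊕ con n) ⊕ con 6 ⊗ pow (𝕏 ⊕ con c) c ⊕ con 9

-- Stack programs with an evaluation stack, two stacks for the two halves of the tape of a
-- simulated machine, and V registers.  Words lie on the evaluation stack with their last letter
-- on top, and in the registers with their first letter on top.
module Registers (k E V : ℕ) where
  open TM k hiding (encode)
  open Stacks k E (3 + V) public
  open Run₂ public

  val lft rgt : Fin (3 + V)
  val = Fin.zero
  lft = Fin.suc Fin.zero
  rgt = Fin.suc (Fin.suc Fin.zero)

  reg : Fin V → Fin (3 + V)
  reg X = Fin.suc (Fin.suc (Fin.suc X))

  letters : Word k → List Γ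
  letters = List.map letter

  noop : Flow StackOp ⊤ ⊤
  noop = prim ret

  -- `st` is a context with a hole at stack `i`, so that loops over a stack are verified once for
  -- all stacks. For registers the hole is an update of a vector, where the laws hold only
  -- propositionally.
  record Pops (i : Fin (3 + V)) (st : List Γ → Stacks) : Set where
    field
      top  : ∀ u → lookup (st u) i ≡ u
      rest : ∀ u → Vec.updateAt (st u) i (List.drop 1) ≡ st (List.drop 1 u)

    exec-pop : ∀ {B} (f : Maybe Γ → B) u → execˢ (pop i f) (st u) ≡ (f (List.head u) , st (List.drop 1 u))
    exec-pop f u = cong₂ (λ y s → f (List.head y) , s) (top u) (rest u)

  record Moves (i j : Fin (3 + V)) (st : List Γ → List Γ → Stacks) : Set where
    field
      pops   : ∀ d → Pops i (λ u → st u d)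
      pushes : ∀ x u d → Vec.updateAt (st u d) j (x ∷_) ≡ st u (x ∷ d)

    exec-push : ∀ {B} (b : B) x u d → execˢ (push j x b) (st u d) ≡ (b , st u (x ∷ d))
    exec-push b x u d = cong (b ,_) (pushes x u d)

  pops-val : ∀ {l r vs} → Pops val (λ v → v ∷ l ∷ r ∷ vs)
  pops-val = record { top = λ _ → refl ; rest = λ _ → refl }

  pops-lft : ∀ {v r vs} → Pops lft (λ l → v ∷ l ∷ r ∷ vs)
  pops-lft = record { top = λ _ → refl ; rest = λ _ → refl }

  pops-rgt : ∀ {v l vs} → Pops rgt (λ r → v ∷ l ∷ r ∷ vs)
  pops-rgt = record { top = λ _ → refl ; rest = λ _ → refl }

  pops-reg : ∀ {v l r vs} X → Pops (reg X) (λ u → v ∷ l ∷ r ∷ vs [ X ]≔ u)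
  pops-reg {v} {l} {r} {vs} X = record
    { top  = λ u → Vecₚ.lookup∘updateAt X vs
    ; rest = λ u → cong (λ us → v ∷ l ∷ r ∷ us) (Vecₚ.updateAt-updateAt X vs)
    }

  moves-val-rgt : ∀ {l vs} → Moves val rgt (λ v r → v ∷ l ∷ r ∷ vs)
  moves-val-rgt = record { pops = λ _ → pops-val ; pushes = λ _ _ _ → refl }

  moves-rgt-val : ∀ {l vs} → Moves rgt val (λ r v → v ∷ l ∷ r ∷ vs)
  moves-rgt-val = record { pops = λ _ → pops-rgt ; pushes = λ _ _ _ → refl }

  moves-val-lft : ∀ {r vs} → Moves val lft (λ v l → v ∷ l ∷ r ∷ vs)
  moves-val-lft = record { pops = λ _ → pops-val ; pushes = λ _ _ _ → refl }

  pushes-reg : ∀ {v l r : List Γ} {vs : Vec (List Γ) V} X x d →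
               Vec.updateAt (v ∷ l ∷ r ∷ vs [ X ]≔ d) (reg X) (x ∷_) ≡ v ∷ l ∷ r ∷ vs [ X ]≔ (x ∷ d)
  pushes-reg {v} {l} {r} {vs} X x d = cong (λ us → v ∷ l ∷ r ∷ us) (Vecₚ.updateAt-updateAt X vs)

  moves-lft-reg : ∀ {v r vs} X → Moves lft (reg X) (λ l d → v ∷ l ∷ r ∷ vs [ X ]≔ d)
  moves-lft-reg {vs = vs} X = record { pops = λ _ → pops-lft ; pushes = λ x u d → pushes-reg {vs = vs} X x d }

  moves-val-reg : ∀ {l r vs} X → Moves val (reg X) (λ v d → v ∷ l ∷ r ∷ vs [ X ]≔ d)
  moves-val-reg {vs = vs} X = record { pops = λ _ → pops-val ; pushes = λ x u d → pushes-reg {vs = vs} X x d }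

  moves-rgt-reg : ∀ {v l vs} X → Moves rgt (reg X) (λ r d → v ∷ l ∷ r ∷ vs [ X ]≔ d)
  moves-rgt-reg {vs = vs} X = record { pops = λ _ → pops-rgt ; pushes = λ x u d → pushes-reg {vs = vs} X x d }

  nonempty? : Maybe Γ → ⊤ ⊎ ⊤
  nonempty? = Maybe.maybe (λ _ → inj₁ tt) (inj₂ tt)

  clear : Fin (3 + V) → Flow StackOp ⊤ ⊤
  clear i = iter (prim λ _ → pop i nonempty?)

  clear-run : ∀ {i st} → Pops i st → ∀ u → Run (clear i) tt (st u) tt (st []) (length u + 1)
  clear-run ps []      = stop (prim (Pops.exec-pop ps nonempty? []))
  clear-run ps (x ∷ u) = again (prim (Pops.exec-pop ps nonempty? (x ∷ u))) (clear-run ps u)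

  pushUnless : Bool → Fin (3 + V) → Γ → StackOp (⊤ ⊎ ⊤)
  pushUnless true  j x = ret (inj₂ tt)
  pushUnless false j x = push j x (inj₁ tt)

  transferStep : (Γ → Bool) → Fin (3 + V) → Maybe Γ → StackOp (⊤ ⊎ ⊤)
  transferStep end j nothing  = ret (inj₂ tt)
  transferStep end j (just x) = pushUnless (end x) j x

  transfer : (Γ → Bool) → Fin (3 + V) → Fin (3 + V) → Flow StackOp ⊤ ⊤
  transfer end i j = iter (prim (λ _ → pop i id) ⨟ prim (transferStep end j))

  data Ends (end : Γ → Bool) : List Γ → Set where
    []  : Ends end []
    hit : ∀ {x w} → end x ≡ true → Ends end (x ∷ w)

  -- The terminator is popped before it is recognised, so it is consumed; the bottom of the stack
  -- also terminates.
  transfer-run : ∀ {end i j st} → Moves i j st → ∀ w {rest d} → All (λ x → end x ≡ false) w → Ends end rest →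
                 Run (transfer end i j) tt (st (w ++ rest) d) tt (st (List.drop 1 rest) (w ʳ++ d)) (2 * length w + 2)
  transfer-run mv [] [] [] =
    stop (prim (Pops.exec-pop (Moves.pops mv _) id []) ⨟ prim refl)
  transfer-run {st = st} mv [] {x ∷ rest} {d} [] (hit eq) =
    stop (prim (Pops.exec-pop (Moves.pops mv d) id (x ∷ rest)) ⨟
          prim (cong (λ b → execˢ (pushUnless b _ x) (st rest d)) eq))
  transfer-run {st = st} mv (x ∷ w) {rest} {d} (eq ∷ eqs) e =
    weaken (≤-reflexive (cong (_+ 2) (sym (*-suc 2 (length w)))))
      (again (prim (Pops.exec-pop (Moves.pops mv d) id (x ∷ w ++ rest)) ⨟
              prim (trans (cong (λ b → execˢ (pushUnless b _ x) (st (w ++ rest) d)) eq)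
                          (Moves.exec-push mv (inj₁ tt) x (w ++ rest) d)))
             (transfer-run mv w eqs e))

  isBlank notLetter : Γ → Bool
  isBlank blank = true
  isBlank _     = false
  notLetter (letter _) = false
  notLetter _          = true

  letters-∌-end : ∀ w → All (λ x → notLetter x ≡ false) (letters w)
  letters-∌-end w = Allₚ.map⁺ (All.universal (λ _ → refl) w)

  copyPush : Maybe Γ → StackOp (Maybe Γ)
  copyPush nothing  = ret nothing
  copyPush (just x) = push val x (just x)

  copyKeep : Maybe Γ → StackOp (⊤ ⊎ ⊤)
  copyKeep nothing  = ret (inj₂ tt)
  copyKeep (just x) = push lft x (inj₁ tt)

  -- Reading a register empties it. Each letter is put on `val`, reversed as wanted there, and on
  -- `lft`, from which the register is restored.
  copyLoop copy : Fin V → Flow StackOp ⊤ ⊤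
  copyLoop X = iter (prim (λ _ → pop (reg X) id) ⨟ prim copyPush ⨟ prim copyKeep)
  copy X     = copyLoop X ⨟ transfer notLetter lft (reg X)

  copyLoop-run : ∀ {v l r vs} X w → Run (copyLoop X) tt (v ∷ l ∷ r ∷ vs [ X ]≔ w) tt
                   ((w ʳ++ v) ∷ (w ʳ++ l) ∷ r ∷ vs [ X ]≔ []) (3 * length w + 3)
  copyLoop-run X []      = stop (prim (Pops.exec-pop (pops-reg X) id []) ⨟ prim refl ⨟ prim refl)
  copyLoop-run X (x ∷ w) =
    weaken (≤-reflexive (cong (_+ 3) (sym (*-suc 3 (length w)))))
      (again (prim (Pops.exec-pop (pops-reg X) id (x ∷ w)) ⨟ prim refl ⨟ prim refl) (copyLoop-run X w))

  copy-run : ∀ {v r vs} X w → lookup vs X ≡ letters w →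
             Run (copy X) tt (v ∷ [] ∷ r ∷ vs) tt ((letters w ʳ++ v) ∷ [] ∷ r ∷ vs) (5 * length w + 5)
  copy-run {v} {r} {vs} X w eq =
    weaken (≤-reflexive (trans (cong₂ (λ a b → 3 * a + 3 + (2 * b + 2)) (Listₚ.length-map letter w) len) (arith (length w))))
      (subst (λ us → Run (copyLoop X) tt (v ∷ [] ∷ r ∷ us) tt ((letters w ʳ++ v) ∷ (letters w ʳ++ []) ∷ r ∷ vs [ X ]≔ []) (3 * length (letters w) + 3))
         vs≡ (copyLoop-run X (letters w)) ⨟
       subst₂ (λ l us → Run (transfer notLetter lft (reg X)) tt ((letters w ʳ++ v) ∷ l ∷ r ∷ vs [ X ]≔ []) tt ((letters w ʳ++ v) ∷ [] ∷ r ∷ us) (2 * length (letters w ʳ++ []) + 2))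
         (Listₚ.++-identityʳ (letters w ʳ++ []))
         (trans (cong (vs [ X ]≔_) (trans (Listₚ.ʳ++-ʳ++ (letters w)) (Listₚ.++-identityʳ (letters w)))) vs≡)
         (transfer-run (moves-lft-reg X) (letters w ʳ++ []) {[]} (All-ʳ++ (letters-∌-end w) []) []))
    where
    vs≡ : vs [ X ]≔ letters w ≡ vs
    vs≡ = trans (cong (vs [ X ]≔_) (sym eq)) (Vecₚ.[]≔-lookup vs X)
    len : length (letters w ʳ++ []) ≡ length w
    len = trans (Listₚ.length-ʳ++ (letters w)) (trans (+-identityʳ _) (Listₚ.length-map letter w))
    arith : ∀ n → 3 * n + 3 + (2 * n + 2) ≡ 5 * n + 5
    arith = solve-∀

  store : Fin V → Flow StackOp ⊤ ⊤
  store X = clear (reg X) ⨟ transfer notLetter val (reg X)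

  store-run : ∀ {v l r vs} X w → Ends notLetter v →
               Run (store X) tt ((letters w ʳ++ v) ∷ l ∷ r ∷ vs) tt (List.drop 1 v ∷ l ∷ r ∷ vs [ X ]≔ letters w)
                   (length (lookup vs X) + 2 * length w + 3)
  store-run {v} {l} {r} {vs} X w e =
    weaken (≤-reflexive (trans (cong (λ n → length (lookup vs X) + 1 + (2 * n + 2)) len) (arith (length (lookup vs X)) (length w))))
      (subst (λ us → Run (clear (reg X)) tt ((letters w ʳ++ v) ∷ l ∷ r ∷ us) tt ((letters w ʳ++ v) ∷ l ∷ r ∷ vs [ X ]≔ []) (length (lookup vs X) + 1))
         (Vecₚ.[]≔-lookup vs X) (clear-run (pops-reg {v = letters w ʳ++ v} {vs = vs} X) (lookup vs X)) ⨟
       subst₂ (λ u us → Run (transfer notLetter val (reg X)) tt (u ∷ l ∷ r ∷ vs [ X ]≔ []) tt (List.drop 1 v ∷ l ∷ r ∷ vs [ X ]≔ us) (2 * length (letters w ʳ++ []) + 2))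
         (sym (Listₚ.ʳ++-defn (letters w)))
         (trans (Listₚ.ʳ++-ʳ++ (letters w)) (Listₚ.++-identityʳ (letters w)))
         (transfer-run (moves-val-reg X) (letters w ʳ++ []) (All-ʳ++ (letters-∌-end w) []) e))
    where
    len : length (letters w ʳ++ []) ≡ length w
    len = trans (Listₚ.length-ʳ++ (letters w)) (trans (+-identityʳ _) (Listₚ.length-map letter w))
    arith : ∀ a n → a + 1 + (2 * n + 2) ≡ a + 2 * n + 3
    arith = solve-∀

  is : Fin k → Maybe Γ → ⊤ ⊎ ⊤
  is a (just (letter b)) with a Fin.≟ b
  ... | yes _ = inj₁ tt
  ... | no _  = inj₂ tt
  is a _ = inj₂ tt

  is-refl : ∀ a → is a (just (letter a)) ≡ inj₁ tt
  is-refl a with a Fin.≟ a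
  ... | yes _ = refl
  ... | no ¬p = ⊥-elim (¬p refl)

  is-≢ : ∀ {a b} → a ≢ b → is a (just (letter b)) ≡ inj₂ tt
  is-≢ {a} {b} a≢b with a Fin.≟ b
  ... | yes p = ⊥-elim (a≢b p)
  ... | no _  = refl

  match : Word k → Flow StackOp ⊤ (⊤ ⊎ ⊤)
  match []      = prim (λ _ → pop val (Maybe.maybe (λ _ → inj₂ tt) (inj₁ tt)))
  match (a ∷ w) = prim (λ _ → pop val (is a)) ⨟ branch (match w) (prim λ _ → ret (inj₂ tt))

  match-yes : ∀ {l r vs} w → Run (match w) tt (letters w ∷ l ∷ r ∷ vs) (inj₁ tt) ([] ∷ l ∷ r ∷ vs) (length w + 2)
  match-yes []      = weaken (n≤1+n 1) (prim refl)
  match-yes (a ∷ w) = prim (cong (_, (letters w ∷ _ ∷ _ ∷ _)) (is-refl a)) ⨟ branch₁ (match-yes w)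

  match-no : ∀ {l r vs} w u → u ≢ w →
             Σ (List Γ) λ v → Run (match w) tt (letters u ∷ l ∷ r ∷ vs) (inj₂ tt) (v ∷ l ∷ r ∷ vs) (length w + 2) × length v ≤ length u
  match-no []      []      u≢w = ⊥-elim (u≢w refl)
  match-no []      (b ∷ u) u≢w = letters u , weaken (n≤1+n 1) (prim refl) , m≤n⇒m≤1+n (≤-reflexive (Listₚ.length-map letter u))
  match-no (a ∷ w) []      u≢w = [] , weaken (m≤n+m 2 (suc (length w))) (prim refl ⨟ branch₂ (prim refl)) , z≤n
  match-no (a ∷ w) (b ∷ u) u≢w with a Fin.≟ b
  ... | no a≢b   = letters u , weaken (m≤n+m 2 (suc (length w))) (prim (cong (_, (letters u ∷ _ ∷ _ ∷ _)) (is-≢ a≢b)) ⨟ branch₂ (prim refl)) ,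
                   m≤n⇒m≤1+n (≤-reflexive (Listₚ.length-map letter u))
  ... | yes refl = let v , ρ , v≤ = match-no w u (λ eq → u≢w (cong (a ∷_) eq)) in
                   v , prim (cong (_, (letters u ∷ _ ∷ _ ∷ _)) (is-refl a)) ⨟ branch₁ ρ , m≤n⇒m≤1+n v≤

  -- `val` shows the last letter first, hence the reversal of `w`. A failed match may leave letters
  -- behind; they are cleared, and both outcomes continue from an empty `val`.
  test : Word k → Flow StackOp ⊤ (⊤ ⊎ ⊤)
  test w = match (w ʳ++ []) ⨟ branch (prim (ret ∘ inj₁)) (clear val ⨟ prim (ret ∘ inj₂))

  test-yes : ∀ {l r vs u} w → u ≡ w → Run (test w) tt ((letters u ʳ++ []) ∷ l ∷ r ∷ vs) (inj₁ tt) ([] ∷ l ∷ r ∷ vs) (length w + length u + 4)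
  test-yes {l} {r} {vs} w refl =
    weaken (≤-trans (≤-reflexive (trans (cong (λ n → n + 2 + 1) (trans (Listₚ.length-ʳ++ w) (+-identityʳ _))) (+-assoc (length w) 2 1)))
                    (≤-trans (+-monoʳ-≤ (length w) (n≤1+n 3)) (+-monoˡ-≤ 4 (m≤m+n (length w) (length w)))))
      (subst (λ v → Run (match (w ʳ++ [])) tt (v ∷ l ∷ r ∷ vs) (inj₁ tt) ([] ∷ l ∷ r ∷ vs) (length (w ʳ++ []) + 2))
         (Listₚ.map-ʳ++ letter w) (match-yes (w ʳ++ [])) ⨟ branch₁ (prim refl))

  test-no : ∀ {l r vs u} w → u ≢ w → Run (test w) tt ((letters u ʳ++ []) ∷ l ∷ r ∷ vs) (inj₂ tt) ([] ∷ l ∷ r ∷ vs) (length w + length u + 4)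
  test-no {l} {r} {vs} {u} w u≢w =
    let v , ρ , v≤ = match-no (w ʳ++ []) (u ʳ++ []) (u≢w ∘ Listₚ.reverse-injective) in
    weaken (≤-trans (+-mono-≤ (≤-reflexive (cong (_+ 2) (trans (Listₚ.length-ʳ++ w) (+-identityʳ _))))
                              (+-monoˡ-≤ 1 (+-monoˡ-≤ 1 (≤-trans v≤ (≤-reflexive (trans (Listₚ.length-ʳ++ u) (+-identityʳ _)))))))
                    (≤-reflexive (arith (length w) (length u))))
      (subst (λ v′ → Run (match (w ʳ++ [])) tt (v′ ∷ l ∷ r ∷ vs) (inj₂ tt) (v ∷ l ∷ r ∷ vs) (length (w ʳ++ []) + 2))
         (Listₚ.map-ʳ++ letter u) ρ ⨟ branch₂ (clear-run pops-val v ⨟ prim refl))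
    where
    arith : ∀ a b → a + 2 + (b + 1 + 1) ≡ a + b + 4
    arith = solve-∀

  -- Simulating a Turing machine on two stacks

  module Embed (M : Machine) (extras≤E : Machine.extras M ≤ E) where
    open Machine M

    emb : Sym extras → Γ
    emb (letter a) = letter a
    emb blank      = blank
    emb sep        = sep
    emb (extra z)  = extra (Fin.inject≤ z extras≤E)

    prj : Γ → Sym extras
    prj (letter a) = letter a
    prj blank      = blank
    prj sep        = sep
    prj (extra z) with toℕ z <? extras
    ... | yes p = extra (fromℕ< p)
    ... | no _  = blank

    prj-emb : ∀ x → prj (emb x) ≡ x
    prj-emb (letter _) = refl
    prj-emb blank      = refl
    prj-emb sep        = refl
    prj-emb (extra z) with toℕ (Fin.inject≤ z extras≤E) <? extras
    ... | yes p = cong extra (Finₚ.toℕ-injective (trans (Finₚ.toℕ-fromℕ< p) (Finₚ.toℕ-inject≤ z extras≤E)))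
    ... | no ¬p = ⊥-elim (¬p (subst (_< extras) (sym (Finₚ.toℕ-inject≤ z extras≤E)) (Finₚ.toℕ<n z)))

    Control : Set
    Control = Fin (suc states) × Sym extras

    -- An exhausted half of the tape continues with blanks.
    read : Maybe Γ → Sym extras
    read = Maybe.maybe prj blank

    write : Sym extras → Maybe (Fin (suc states) × Sym extras × Move) → StackOp (Sym extras ⊎ (Fin (suc states) × Sym extras × Move))
    write c nothing            = ret (inj₁ c)
    write c (just (q , y , L)) = push rgt (emb y) (inj₂ (q , y , L))
    write c (just (q , y , R)) = push lft (emb y) (inj₂ (q , y , R))
    write c (just (q , y , S)) = ret (inj₂ (q , y , S))

    shift : Sym extras ⊎ (Fin (suc states) × Sym extras × Move) → StackOp (Control ⊎ Sym extras)
    shift (inj₁ c)           = ret (inj₂ c)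
    shift (inj₂ (q , y , L)) = pop lft (λ z → inj₁ (q , read z))
    shift (inj₂ (q , y , R)) = pop rgt (λ z → inj₁ (q , read z))
    shift (inj₂ (q , y , S)) = ret (inj₁ (q , y))

    cycle : Flow StackOp Control (Control ⊎ Sym extras)
    cycle = prim (λ (q , c) → write c (δ q c)) ⨟ prim shift

    tape : List Γ → Vec (List Γ) V → Config M → Stacks
    tape v vs (conf q l c r) = v ∷ List.map emb l ∷ List.map emb r ∷ vs

    control : Config M → Control
    control (conf q l c r) = q , c

    extent : Config M → ℕ
    extent (conf q l c r) = length l + length r

    cycle-run : ∀ {v vs} γ → δ (proj₁ (control γ)) (proj₂ (control γ)) ≢ nothing →
                Run cycle (control γ) (tape v vs γ) (inj₁ (control (step M γ))) (tape v vs (step M γ)) 2 × extent (step M γ) ≤ suc (extent γ)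
    cycle-run {v} {vs} (conf q l c r) moving with δ q c in eq
    cycle-run (conf q l c r) moving | nothing = ⊥-elim (moving refl)
    cycle-run {v} {vs} (conf q [] c r) moving | just (q′ , y , L) =
      prim (cong (λ d → execˢ (write c d) (tape v vs (conf q [] c r))) eq) ⨟ prim refl , ≤-refl
    cycle-run {v} {vs} (conf q (x ∷ l) c r) moving | just (q′ , y , L) =
      prim (cong (λ d → execˢ (write c d) (tape v vs (conf q (x ∷ l) c r))) eq) ⨟ prim (cong (λ z → inj₁ (q′ , z) , tape v vs (conf q l y (y ∷ r))) (prj-emb x)) ,
      ≤-trans (≤-reflexive (+-suc (length l) (length r))) (n≤1+n _)
    cycle-run {v} {vs} (conf q l c []) moving | just (q′ , y , R) =
      prim (cong (λ d → execˢ (write c d) (tape v vs (conf q l c []))) eq) ⨟ prim refl , ≤-refl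
    cycle-run {v} {vs} (conf q l c (x ∷ r)) moving | just (q′ , y , R) =
      prim (cong (λ d → execˢ (write c d) (tape v vs (conf q l c (x ∷ r)))) eq) ⨟ prim (cong (λ z → inj₁ (q′ , z) , tape v vs (conf q (y ∷ l) y r)) (prj-emb x)) ,
      ≤-trans (≤-reflexive (sym (+-suc (length l) (length r)))) (n≤1+n _)
    cycle-run {v} {vs} (conf q l c r) moving | just (q′ , y , S) =
      prim (cong (λ d → execˢ (write c d) (tape v vs (conf q l c r))) eq) ⨟ prim refl , n≤1+n _

    step-halted : ∀ γ → Halted M γ → step M γ ≡ γ
    step-halted (conf q l c r) eq rewrite eq = refl

    run-halted : ∀ t γ → Halted M γ → run M t γ ≡ γ
    run-halted zero    γ h = refl
    run-halted (suc t) γ h = trans (cong (run M t) (step-halted γ h)) (run-halted t γ h)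

    just≢nothing : ∀ {A : Set} {x : A} → just x ≢ nothing
    just≢nothing ()

    -- The machine may have halted long before time `t`. The flow stops at the first halt, and
    -- `run-halted` identifies that configuration with the one at time `t`. The bound on `extent`
    -- pays later for reading and clearing the tape.
    machine-run : ∀ {v vs} t γ → Halted M (run M t γ) →
                  Run (iter cycle) (control γ) (tape v vs γ) (proj₂ (control (run M t γ))) (tape v vs (run M t γ)) (2 * t + 2) ×
                  extent (run M t γ) ≤ extent γ + t
    machine-run {v} {vs} t γ@(conf q l c r) h with δ q c in eq
    machine-run {v} {vs} t γ@(conf q l c r) h | nothing =
      subst (λ γ′ → Run (iter cycle) (control γ) (tape v vs γ) (proj₂ (control γ′)) (tape v vs γ′) (2 * t + 2)) (sym (run-halted t γ eq))
        (weaken (m≤n+m 2 (2 * t)) (stop (prim (cong (λ d → execˢ (write c d) (tape v vs γ)) eq) ⨟ prim refl))) ,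
      ≤-trans (≤-reflexive (cong extent (run-halted t γ eq))) (m≤m+n (extent γ) t)
    machine-run zero γ@(conf q l c r) h | just _ = ⊥-elim (just≢nothing (trans (sym eq) h))
    machine-run (suc t) γ@(conf q l c r) h | just d =
      let ρ , ext  = cycle-run γ (λ eq′ → just≢nothing (trans (sym eq) eq′))
          σ , ext′ = machine-run t (step M γ) h in
      weaken (≤-reflexive (cong (_+ 2) (sym (*-suc 2 t)))) (again ρ σ) ,
      ≤-trans ext′ (≤-trans (+-monoˡ-≤ t ext) (≤-reflexive (sym (+-suc (extent γ) t))))

    emit : Sym extras → StackOp (Maybe ⊤)
    emit (letter a) = push val (letter a) (just tt)
    emit _          = ret nothing

    advance : Maybe ⊤ → StackOp (Sym extras ⊎ ⊤)
    advance nothing  = ret (inj₂ tt)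
    advance (just _) = pop rgt (inj₁ ∘ read)

    readOut : Flow StackOp (Sym extras) ⊤
    readOut = iter (prim emit ⨟ prim advance)

    readOut-run : ∀ {v l vs} c r → Σ (List (Sym extras)) λ r′ →
                  Run readOut c (v ∷ l ∷ List.map emb r ∷ vs) tt ((letters (readWord M (c ∷ r)) ʳ++ v) ∷ l ∷ List.map emb r′ ∷ vs) (2 * length r + 4) ×
                  length r′ ≤ length r
    readOut-run (letter a) []      = [] , again (prim refl ⨟ prim refl) (stop (prim refl ⨟ prim refl)) , z≤n
    readOut-run (letter a) (x ∷ r) =
      let r′ , ρ , r′≤ = readOut-run x r in
      r′ , weaken (≤-reflexive (cong (_+ 4) (sym (*-suc 2 (length r)))))
             (again (prim refl ⨟ prim (cong (λ z → inj₁ z , _) (prj-emb x))) ρ) , m≤n⇒m≤1+n r′≤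
    readOut-run blank     r = r , weaken (≤-trans (m≤m+n 2 2) (m≤n+m 4 (2 * length r))) (stop (prim refl ⨟ prim refl)) , ≤-refl
    readOut-run sep       r = r , weaken (≤-trans (m≤m+n 2 2) (m≤n+m 4 (2 * length r))) (stop (prim refl ⨟ prim refl)) , ≤-refl
    readOut-run (extra z) r = r , weaken (≤-trans (m≤m+n 2 2) (m≤n+m 4 (2 * length r))) (stop (prim refl ⨟ prim refl)) , ≤-refl

    -- Both halves of the tape are cleared at the end, because the next operator call of the same
    -- program uses them again.
    simulation : Flow StackOp ⊤ ⊤
    simulation = prim (λ _ → pop rgt (λ z → Fin.zero , read z)) ⨟ iter cycle ⨟ readOut ⨟ clear lft ⨟ clear rgt

    map-emb-encode : ∀ {n} (ds : Vec (Word k) n) → List.map emb (encode extras ds) ≡ encode E ds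
    map-emb-encode []            = refl
    map-emb-encode (d ∷ [])      = sym (Listₚ.map-∘ d)
    map-emb-encode (d ∷ d′ ∷ ds) =
      trans (Listₚ.map-++ emb (List.map letter d) _) (cong₂ (λ u v → u ++ sep ∷ v) (sym (Listₚ.map-∘ d)) (map-emb-encode (d′ ∷ ds)))

    extent-initial : ∀ xs → extent (initial M xs) ≤ length xs
    extent-initial []       = z≤n
    extent-initial (x ∷ xs) = n≤1+n (length xs)

    -- After `t` steps each half of the tape has at most `length xs + t` cells; this bounds the
    -- reading of the output and both clearings.
    simulation-run : ∀ {v vs} xs t → Halted M (run M t (initial M xs)) →
                     Run simulation tt (v ∷ [] ∷ List.map emb xs ∷ vs) tt ((letters (output M (run M t (initial M xs))) ʳ++ v) ∷ [] ∷ [] ∷ vs)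
                         (4 * length xs + 6 * t + 9)
    simulation-run {v} {vs} xs t h = finish xs (run M t (initial M xs)) (first xs) (proj₁ run′) (≤-trans (proj₂ run′) (+-monoˡ-≤ t (extent-initial xs)))
      where
      run′ = machine-run {v} {vs} t (initial M xs) h
      first : ∀ xs → Run (prim (λ _ → pop rgt (λ z → Fin.zero , read z))) tt (v ∷ [] ∷ List.map emb xs ∷ vs)
                         (control (initial M xs)) (tape v vs (initial M xs)) 1
      first []       = prim refl
      first (x ∷ xs) = prim (cong (λ z → (Fin.zero , z) , v ∷ [] ∷ List.map emb xs ∷ vs) (prj-emb x))
      arith : ∀ x t → 1 + (2 * t + 2 + (2 * (x + t) + 4 + (x + t + 1 + (x + t + 1)))) ≡ 4 * x + 6 * t + 9
      arith = solve-∀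
      finish : ∀ xs γ → Run (prim (λ _ → pop rgt (λ z → Fin.zero , read z))) tt (v ∷ [] ∷ List.map emb xs ∷ vs)
                         (control (initial M xs)) (tape v vs (initial M xs)) 1 →
               Run (iter cycle) (control (initial M xs)) (tape v vs (initial M xs)) (proj₂ (control γ)) (tape v vs γ) (2 * t + 2) →
               extent γ ≤ length xs + t →
               Run simulation tt (v ∷ [] ∷ List.map emb xs ∷ vs) tt ((letters (output M γ) ʳ++ v) ∷ [] ∷ [] ∷ vs) (4 * length xs + 6 * t + 9)
      finish xs (conf q l c r) ρ₀ ρ₁ ext =
        let r′ , ρ₂ , r′≤ = readOut-run c r
            l≤ = ≤-trans (m≤m+n (length l) (length r)) ext
            r≤ = ≤-trans (m≤n+m (length r) (length l)) ext in
        weaken (≤-reflexive (arith (length xs) t))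
          (ρ₀ ⨟ ρ₁ ⨟ weaken (+-monoˡ-≤ 4 (*-monoʳ-≤ 2 r≤)) ρ₂ ⨟
            weaken (+-monoˡ-≤ 1 (≤-trans (≤-reflexive (Listₚ.length-map emb l)) l≤)) (clear-run pops-lft (List.map emb l)) ⨟
            weaken (+-monoˡ-≤ 1 (≤-trans (≤-reflexive (Listₚ.length-map emb r′)) (≤-trans r′≤ r≤))) (clear-run pops-rgt (List.map emb r′)))

    readWord-≤ : ∀ xs → length (readWord M xs) ≤ length xs
    readWord-≤ []              = z≤n
    readWord-≤ (letter _ ∷ xs) = s≤s (readWord-≤ xs)
    readWord-≤ (blank ∷ xs)    = z≤n
    readWord-≤ (sep ∷ xs)      = z≤n
    readWord-≤ (extra _ ∷ xs)  = z≤n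

    output-≤ : ∀ xs t → Halted M (run M t (initial M xs)) → length (output M (run M t (initial M xs))) ≤ suc (length xs + t)
    -- The stacks are dummies: only the bound on `extent` is taken from the run.
    output-≤ xs t h = bound (run M t (initial M xs)) (≤-trans (proj₂ (machine-run {[]} {Vec.replicate V []} t (initial M xs) h)) (+-monoˡ-≤ t (extent-initial xs)))
      where
      bound : ∀ γ → extent γ ≤ length xs + t → length (output M γ) ≤ suc (length xs + t)
      bound (conf q l c r) ext = ≤-trans (readWord-≤ (c ∷ r)) (s≤s (≤-trans (m≤n+m (length r) (length l)) ext))

    simulation-computes : ∀ {n c} {f : Vec (Word k) n → Word k} →
      (∀ ds → Σ ℕ λ t → t ≤ (inputSize ds + c) ^ c × Halted M (run M t (initial M (TM.encode k M ds))) ×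
                        output M (run M t (initial M (TM.encode k M ds))) ≡ f ds) →
      ∀ {v vs} ds → Run simulation tt (v ∷ [] ∷ encode E ds ∷ vs) tt ((letters (f ds) ʳ++ v) ∷ [] ∷ [] ∷ vs) (⟪ simulation-time n c ⟫ (inputSize ds))
    simulation-computes {n} {c} comp {v} {vs} ds =
      let t , t≤ , h , out≡ = comp ds
          xs = encode extras ds
          eq = encode≡ M ds in
      weaken (+-monoˡ-≤ 9 (+-mono-≤ (*-monoʳ-≤ 4 (length-encode extras ds)) (*-monoʳ-≤ 6 t≤)))
        (subst₂ (λ r w → Run simulation tt (v ∷ [] ∷ r ∷ vs) tt ((letters w ʳ++ v) ∷ [] ∷ [] ∷ vs) (4 * length xs + 6 * t + 9))
          (map-emb-encode ds) (trans (cong (λ ys → output M (run M t (initial M ys))) (sym eq)) out≡)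
          (simulation-run xs t (subst (λ ys → Halted M (run M t (initial M ys))) eq h)))

-- Programs as stack programs

tabulate-≡ : ∀ {A : Set} {n} {f : Fin n → A} {xs : Vec A n} → (∀ i → f i ≡ lookup xs i) → Vec.tabulate f ≡ xs
tabulate-≡ {xs = xs} h = trans (Vecₚ.tabulate-cong h) (Vecₚ.tabulate∘lookup xs)

length-lookup≤maxLen : ∀ {k n} (ds : Vec (Word k) n) i → length (lookup ds i) ≤ maxLen ds
length-lookup≤maxLen (d ∷ ds) Fin.zero    = m≤m⊔n (length d) (maxLen ds)
length-lookup≤maxLen (d ∷ ds) (Fin.suc i) = ≤-trans (length-lookup≤maxLen ds i) (m≤n⊔m (length d) (maxLen ds))

length-Factor : ∀ {k} {w d : Word k} → Factor w d → length w ≤ length d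
length-Factor {w = w} (u , u′ , refl) = begin
  length w                              ≤⟨ m≤m+n (length w) (length u′) ⟩
  length w + length u′                  ≡⟨ Listₚ.length-++ w ⟨
  length (w ++ u′)                      ≤⟨ m≤n+m (length (w ++ u′)) (length u) ⟩
  length u + length (w ++ u′)           ≡⟨ Listₚ.length-++ u ⟨
  length (u ++ w ++ u′)                 ∎
  where open ≤-Reasoning

inputSize-≤ : ∀ {k n} (ds : Vec (Word k) n) {b} → maxLen ds ≤ b → TM.inputSize k ds ≤ n * b
inputSize-≤ []       h = z≤n
inputSize-≤ (d ∷ ds) h = +-mono-≤ (≤-trans (m≤m⊔n (length d) (maxLen ds)) h) (inputSize-≤ ds (≤-trans (m≤n⊔m (length d) (maxLen ds)) h))

-- Big-step semantics with step counts

module BigStep (k : ℕ) (𝐭 𝐟 : Word k) (Sg : Signature k) where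
  open Lang k 𝐭 𝐟 Sg

  mutual
    data Big : Store → Cmd → Store → ℕ → Set where
      skip   : ∀ {μ} → Big μ skip μ 1
      assign : ∀ {μ X e} → Big μ (X ≔ e) (μ [ X ← eval μ e ]) 1
      seq    : ∀ {μ μ₁ μ₂ C C′ t t′} → Big μ C μ₁ t → Big μ₁ C′ μ₂ t′ → Big μ (C ⨾ C′) μ₂ (t + t′)
      if-tt  : ∀ {μ μ₁ e C C′ t} → eval μ e ≡ 𝐭 → Big μ C μ₁ t → Big μ (if e then C else C′) μ₁ (suc t)
      if-ff  : ∀ {μ μ₁ e C C′ t} → eval μ e ≡ 𝐟 → Big μ C′ μ₁ t → Big μ (if e then C else C′) μ₁ (suc t)
      while  : ∀ {μ μ₁ e C i t} → Loop e C μ μ₁ i t → Big μ (while e C) μ₁ t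

    -- The number of iterations is an index beside the number of steps, since the comparison of two
    -- runs by tiers concerns iterations only: steps may differ.
    data Loop (e : Exp) (C : Cmd) : Store → Store → ℕ → ℕ → Set where
      exit : ∀ {μ} → eval μ e ≡ 𝐟 → Loop e C μ μ 0 1
      next : ∀ {μ μ₁ μ₂ i t t′} → eval μ e ≡ 𝐭 → Big μ C μ₁ t → Loop e C μ₁ μ₂ i t′ → Loop e C μ μ₂ (suc i) (suc (t + t′))

  →s-done⇒Big : ∀ {μ C μ₁} → μ ⊨ C →s done μ₁ → Σ ℕ (Big μ C μ₁)
  →s-done⇒Big skip→        = _ , skip
  →s-done⇒Big assign→      = _ , assign
  →s-done⇒Big (while-ff e) = _ , while (exit e)

  -- Expansion along one small step: the derivation of the remaining command is taken apart and
  -- rebuilt around the step. An unfolded loop thereby gains its first iteration.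
  →s⇒Big : ∀ {μ C μ₁ C₁ μ₂ t} → μ ⊨ C →s (μ₁ ⊨ C₁) → Big μ₁ C₁ μ₂ t → Σ ℕ (Big μ C μ₂)
  →s⇒Big (seq-done s) β         = _ , seq (proj₂ (→s-done⇒Big s)) β
  →s⇒Big (seq-cont s) (seq β γ) = _ , seq (proj₂ (→s⇒Big s β)) γ
  →s⇒Big (if-tt e)    β         = _ , if-tt e β
  →s⇒Big (if-ff e)    β         = _ , if-ff e β
  →s⇒Big (while-tt e) (seq β (while ℓ)) = _ , while (next e β ℓ)

  ⇓⇒Big : ∀ {μ C μ₁} → μ ⊨ C ⇓ μ₁ → Σ ℕ (Big μ C μ₁)
  ⇓⇒Big (last s)   = →s-done⇒Big s
  ⇓⇒Big (more s r) = →s⇒Big s (proj₂ (⇓⇒Big r))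

-- Interpreting commands by stack programs

module Interpreter (k : ℕ) (𝐭 𝐟 : Word k) (𝐭≢𝐟 : 𝐭 ≢ 𝐟) (Sg : Signature k)
                   (fp : ∀ o → TM.FPtime k (Signature.⟦_⟧ Sg o))
                   (np : ∀ o → Lang.Neutral k 𝐭 𝐟 Sg o ⊎ Lang.Positive k 𝐭 𝐟 Sg o) where
  open Signature Sg
  open Lang k 𝐭 𝐟 Sg
  open BigStep k 𝐭 𝐟 Sg
  open TM k hiding (encode)

  program : Op → Machine
  program o = proj₁ (fp o)

  -- Neutral operators obey the bound of positive ones: truth values have constant length, and
  -- factors are no longer than an argument.
  opGrowth : ∀ o → Σ ℕ λ c → ∀ ds → length (⟦ o ⟧ ds) ≤ maxLen ds + c
  opGrowth o with np o
  ... | inj₂ pos = pos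
  ... | inj₁ (inj₁ b) = length 𝐭 + length 𝐟 , λ ds → ≤-trans (bound ds (b ds)) (m≤n+m _ (maxLen ds))
    where
    bound : ∀ ds → ⟦ o ⟧ ds ≡ 𝐭 ⊎ ⟦ o ⟧ ds ≡ 𝐟 → length (⟦ o ⟧ ds) ≤ length 𝐭 + length 𝐟
    bound ds (inj₁ eq) = subst (λ w → length w ≤ length 𝐭 + length 𝐟) (sym eq) (m≤m+n (length 𝐭) (length 𝐟))
    bound ds (inj₂ eq) = subst (λ w → length w ≤ length 𝐭 + length 𝐟) (sym eq) (m≤n+m (length 𝐟) (length 𝐭))
  ... | inj₁ (inj₂ sub) = 0 , λ ds → let i , fac = sub ds in
    ≤-trans (length-Factor fac) (≤-trans (length-lookup≤maxLen ds i) (m≤m+n (maxLen ds) 0))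

  mutual
    varsᴱ : Exp → ℕ
    varsᴱ (var X)   = suc X
    varsᴱ (op o es) = varsᴱˢ es

    varsᴱˢ : ∀ {n} → Vec Exp n → ℕ
    varsᴱˢ []       = 0
    varsᴱˢ (e ∷ es) = varsᴱ e ⊔ varsᴱˢ es

  mutual
    extrasᴱ : Exp → ℕ
    extrasᴱ (var X)   = 0
    extrasᴱ (op o es) = Machine.extras (program o) ⊔ extrasᴱˢ es

    extrasᴱˢ : ∀ {n} → Vec Exp n → ℕ
    extrasᴱˢ []       = 0
    extrasᴱˢ (e ∷ es) = extrasᴱ e ⊔ extrasᴱˢ es

  mutual
    growᴱ : Exp → ℕ
    growᴱ (var X)   = 0
    growᴱ (op o es) = growᴱˢ es + proj₁ (opGrowth o)

    growᴱˢ : ∀ {n} → Vec Exp n → ℕ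
    growᴱˢ []       = 0
    growᴱˢ (e ∷ es) = growᴱ e + growᴱˢ es

  -- Here and in the costs below, `𝕏` stands for a bound on the lengths of the variables, not for
  -- the size of the input.
  argSize : ∀ {n} → Vec Exp n → Poly
  argSize {n} es = con n ⊗ (𝕏 ⊕ con (growᴱˢ es))

  mutual
    costᴱ : Exp → Poly
    costᴱ (var X)   = con 5 ⊗ 𝕏 ⊕ con 5
    costᴱ (op o es) = con 1 ⊕ (costᴱˢ es ⊕ ((con 2 ⊗ (argSize es ⊕ con (arity o)) ⊕ con 2) ⊕
                                           simulation-time (arity o) (proj₁ (proj₂ (fp o))) ⊙ argSize es))

    costᴱˢ : ∀ {n} → Vec Exp n → Poly
    costᴱˢ []           = con 1
    costᴱˢ (e ∷ [])     = costᴱ e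
    costᴱˢ (e ∷ e′ ∷ es) = costᴱ e ⊕ (con 1 ⊕ costᴱˢ (e′ ∷ es))

  varsᶜ extrasᶜ growᶜ : Cmd → ℕ
  varsᶜ (X ≔ e)               = suc X ⊔ varsᴱ e
  varsᶜ (C ⨾ C′)              = varsᶜ C ⊔ varsᶜ C′
  varsᶜ skip                  = 0
  varsᶜ (if e then C else C′) = varsᴱ e ⊔ (varsᶜ C ⊔ varsᶜ C′)
  varsᶜ (while e C)           = varsᴱ e ⊔ varsᶜ C

  extrasᶜ (X ≔ e)               = extrasᴱ e
  extrasᶜ (C ⨾ C′)              = extrasᶜ C ⊔ extrasᶜ C′
  extrasᶜ skip                  = 0
  extrasᶜ (if e then C else C′) = extrasᴱ e ⊔ (extrasᶜ C ⊔ extrasᶜ C′)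
  extrasᶜ (while e C)           = extrasᴱ e ⊔ extrasᶜ C

  growᶜ (X ≔ e)               = growᴱ e
  growᶜ (C ⨾ C′)              = growᶜ C ⊔ growᶜ C′
  growᶜ skip                  = 0
  growᶜ (if e then C else C′) = growᶜ C ⊔ growᶜ C′
  growᶜ (while e C)           = growᶜ C

  costᴳ : Exp → Poly
  costᴳ e = costᴱ e ⊕ (con (length 𝐭) ⊕ (𝕏 ⊕ con (growᴱ e)) ⊕ con 4)

  -- The price of any single step counted by `Big`, not of a whole execution. Sums merely bound
  -- maxima from above, and a loop does not multiply.
  costᶜ : Cmd → Poly
  costᶜ (X ≔ e)               = costᴱ e ⊕ (𝕏 ⊕ con 2 ⊗ (𝕏 ⊕ con (growᴱ e)) ⊕ con 3)
  costᶜ (C ⨾ C′)              = costᶜ C ⊕ costᶜ C′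
  costᶜ skip                  = con 1
  costᶜ (if e then C else C′) = costᴳ e ⊕ (costᶜ C ⊕ costᶜ C′)
  costᶜ (while e C)           = (costᴳ e ⊕ con 1) ⊕ costᶜ C

  module Compiler (E V : ℕ) where
    open Registers k E V

    image : Store → Vec (List Γ) V
    image μ = Vec.tabulate λ X → letters (μ (toℕ X))

    lookup-image : ∀ μ {X} (X<V : X < V) → lookup (image μ) (fromℕ< X<V) ≡ letters (μ X)
    lookup-image μ X<V = trans (Vecₚ.lookup∘tabulate _ (fromℕ< X<V)) (cong (letters ∘ μ) (Finₚ.toℕ-fromℕ< X<V))

    image-update : ∀ μ {X} (X<V : X < V) d → image (μ [ X ← d ]) ≡ image μ [ fromℕ< X<V ]≔ letters d
    image-update μ {X} X<V d = tabulate-≡ pointwise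
      where
      pointwise : ∀ i → letters ((μ [ X ← d ]) (toℕ i)) ≡ lookup (image μ [ fromℕ< X<V ]≔ letters d) i
      pointwise i with X Data.Nat.≟ toℕ i
      ... | yes refl = sym (trans (cong (λ j → lookup (image μ [ j ]≔ letters d) i) (Finₚ.fromℕ<-toℕ i X<V)) (Vecₚ.lookup∘updateAt i (image μ)))
      ... | no X≢i   = sym (trans (Vecₚ.lookup∘updateAt′ i (fromℕ< X<V) (λ { refl → X≢i (sym (Finₚ.toℕ-fromℕ< X<V)) }) (image μ))
                                  (Vecₚ.lookup∘tabulate _ i))

    Bounded : ℕ → Store → Set
    Bounded W μ = ∀ X → X < V → length (μ X) ≤ W

    mutual
      Fitsᴱ : Exp → Set
      Fitsᴱ (var X)   = X < V
      Fitsᴱ (op o es) = Machine.extras (program o) ≤ E × Fitsᴱˢ es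

      Fitsᴱˢ : ∀ {n} → Vec Exp n → Set
      Fitsᴱˢ []       = ⊤
      Fitsᴱˢ (e ∷ es) = Fitsᴱ e × Fitsᴱˢ es

    Fitsᶜ : Cmd → Set
    Fitsᶜ (X ≔ e)               = X < V × Fitsᴱ e
    Fitsᶜ (C ⨾ C′)              = Fitsᶜ C × Fitsᶜ C′
    Fitsᶜ skip                  = ⊤
    Fitsᶜ (if e then C else C′) = Fitsᴱ e × Fitsᶜ C × Fitsᶜ C′
    Fitsᶜ (while e C)           = Fitsᴱ e × Fitsᶜ C

    mutual
      fitsᴱ : ∀ e → varsᴱ e ≤ V → extrasᴱ e ≤ E → Fitsᴱ e
      fitsᴱ (var X)   v≤ e≤ = v≤
      fitsᴱ (op o es) v≤ e≤ = m⊔n≤o⇒m≤o (Machine.extras (program o)) (extrasᴱˢ es) e≤ , fitsᴱˢ es v≤ (m⊔n≤o⇒n≤o (Machine.extras (program o)) (extrasᴱˢ es) e≤)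

      fitsᴱˢ : ∀ {n} (es : Vec Exp n) → varsᴱˢ es ≤ V → extrasᴱˢ es ≤ E → Fitsᴱˢ es
      fitsᴱˢ []       v≤ e≤ = tt
      fitsᴱˢ (e ∷ es) v≤ e≤ =
        fitsᴱ e (m⊔n≤o⇒m≤o (varsᴱ e) (varsᴱˢ es) v≤) (m⊔n≤o⇒m≤o (extrasᴱ e) (extrasᴱˢ es) e≤) ,
        fitsᴱˢ es (m⊔n≤o⇒n≤o (varsᴱ e) (varsᴱˢ es) v≤) (m⊔n≤o⇒n≤o (extrasᴱ e) (extrasᴱˢ es) e≤)

    fitsᶜ : ∀ C → varsᶜ C ≤ V → extrasᶜ C ≤ E → Fitsᶜ C
    fitsᶜ (X ≔ e) v≤ e≤ = m⊔n≤o⇒m≤o (suc X) (varsᴱ e) v≤ , fitsᴱ e (m⊔n≤o⇒n≤o (suc X) (varsᴱ e) v≤) e≤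
    fitsᶜ (C ⨾ C′) v≤ e≤ =
      fitsᶜ C (m⊔n≤o⇒m≤o (varsᶜ C) (varsᶜ C′) v≤) (m⊔n≤o⇒m≤o (extrasᶜ C) (extrasᶜ C′) e≤) ,
      fitsᶜ C′ (m⊔n≤o⇒n≤o (varsᶜ C) (varsᶜ C′) v≤) (m⊔n≤o⇒n≤o (extrasᶜ C) (extrasᶜ C′) e≤)
    fitsᶜ skip v≤ e≤ = tt
    fitsᶜ (if e then C else C′) v≤ e≤ =
      fitsᴱ e (m⊔n≤o⇒m≤o (varsᴱ e) _ v≤) (m⊔n≤o⇒m≤o (extrasᴱ e) _ e≤) ,
      fitsᶜ C (m⊔n≤o⇒m≤o (varsᶜ C) (varsᶜ C′) v≤′) (m⊔n≤o⇒m≤o (extrasᶜ C) (extrasᶜ C′) e≤′) ,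
      fitsᶜ C′ (m⊔n≤o⇒n≤o (varsᶜ C) (varsᶜ C′) v≤′) (m⊔n≤o⇒n≤o (extrasᶜ C) (extrasᶜ C′) e≤′)
      where
      v≤′ = m⊔n≤o⇒n≤o (varsᴱ e) (varsᶜ C ⊔ varsᶜ C′) v≤
      e≤′ = m⊔n≤o⇒n≤o (extrasᴱ e) (extrasᶜ C ⊔ extrasᶜ C′) e≤
    fitsᶜ (while e C) v≤ e≤ =
      fitsᴱ e (m⊔n≤o⇒m≤o (varsᴱ e) (varsᶜ C) v≤) (m⊔n≤o⇒m≤o (extrasᴱ e) (extrasᶜ C) e≤) ,
      fitsᶜ C (m⊔n≤o⇒n≤o (varsᴱ e) (varsᶜ C) v≤) (m⊔n≤o⇒n≤o (extrasᴱ e) (extrasᶜ C) e≤)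

    mutual
      -- Results of enclosing expressions may lie below, so a blank, which no encoding contains,
      -- marks where the arguments begin. Transferring down to it reverses the arguments into the
      -- input tape of the operator's machine.
      evalFlow : ∀ e → Fitsᴱ e → Flow StackOp ⊤ ⊤
      evalFlow (var X)   X<V        = copy (fromℕ< X<V)
      evalFlow (op o es) (e≤ , fit) =
        prim (λ _ → push val TM.blank tt) ⨟ evalsFlow es fit ⨟ transfer isBlank val rgt ⨟ Embed.simulation (program o) e≤

      evalsFlow : ∀ {n} (es : Vec Exp n) → Fitsᴱˢ es → Flow StackOp ⊤ ⊤
      evalsFlow []            _           = noop
      evalsFlow (e ∷ [])      (fit , _)   = evalFlow e fit
      evalsFlow (e ∷ e′ ∷ es) (fit , fits) = evalFlow e fit ⨟ prim (λ _ → push val TM.sep tt) ⨟ evalsFlow (e′ ∷ es) fits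

    mutual
      length-eval : ∀ {W μ} e → Fitsᴱ e → Bounded W μ → length (eval μ e) ≤ W + growᴱ e
      length-eval {W} (var X)   X<V h = ≤-trans (h X X<V) (m≤m+n W 0)
      length-eval {W} {μ} (op o es) (_ , fit) h =
        ≤-trans (proj₂ (opGrowth o) (evals μ es))
          (≤-trans (+-monoˡ-≤ (proj₁ (opGrowth o)) (length-evals es fit h)) (≤-reflexive (+-assoc W (growᴱˢ es) _)))

      length-evals : ∀ {n W μ} (es : Vec Exp n) → Fitsᴱˢ es → Bounded W μ → maxLen (evals μ es) ≤ W + growᴱˢ es
      length-evals []       _ h = z≤n
      length-evals {W = W} (e ∷ es) (fit , fits) h = ⊔-lub
        (≤-trans (length-eval e fit h) (+-monoʳ-≤ W (m≤m+n (growᴱ e) (growᴱˢ es))))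
        (≤-trans (length-evals es fits h) (+-monoʳ-≤ W (m≤n+m (growᴱˢ es) (growᴱ e))))

    encode-≢blank : ∀ {n} (ds : Vec (Word k) n) → All (λ x → isBlank x ≡ false) (encode E ds)
    encode-≢blank []            = []
    encode-≢blank (d ∷ [])      = Allₚ.map⁺ (All.universal (λ _ → refl) d)
    encode-≢blank (d ∷ d′ ∷ ds) = Allₚ.++⁺ (Allₚ.map⁺ (All.universal (λ _ → refl) d)) (refl ∷ encode-≢blank (d′ ∷ ds))

    mutual
      eval-run : ∀ e fit {v W μ} → Bounded W μ →
                 Run (evalFlow e fit) tt (v ∷ [] ∷ [] ∷ image μ) tt ((letters (eval μ e) ʳ++ v) ∷ [] ∷ [] ∷ image μ) (⟪ costᴱ e ⟫ W)
      eval-run (var X)   X<V {μ = μ} h =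
        weaken (+-monoˡ-≤ 5 (*-monoʳ-≤ 5 (h X X<V))) (copy-run (fromℕ< X<V) (μ X) (lookup-image μ X<V))
      eval-run (op o es) (e≤ , fit) {v} {W} {μ} h =
        prim refl ⨟ evals-run es fit h ⨟
        weaken (+-monoˡ-≤ 2 (*-monoʳ-≤ 2 (≤-trans (≤-reflexive (trans (Listₚ.length-ʳ++ (encode E ds)) (+-identityʳ _)))
                                                  (≤-trans (length-encode E ds) (+-monoˡ-≤ (arity o) size≤)))))
          (subst₂ (λ u r → Run (transfer isBlank val rgt) tt (u ∷ [] ∷ [] ∷ image μ) tt (v ∷ [] ∷ r ∷ image μ) (2 * length (encode E ds ʳ++ []) + 2))
             (sym (Listₚ.ʳ++-defn (encode E ds)))
             (trans (Listₚ.ʳ++-ʳ++ (encode E ds)) (Listₚ.++-identityʳ (encode E ds)))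
             (transfer-run moves-val-rgt (encode E ds ʳ++ []) (All-ʳ++ (encode-≢blank ds) []) (hit refl))) ⨟
        weaken (Poly-mono (simulation-time (arity o) c) size≤)
          (Embed.simulation-computes (program o) e≤ {c = c} {f = ⟦ o ⟧} (proj₂ (proj₂ (fp o))) ds)
        where
        c = proj₁ (proj₂ (fp o))
        ds = evals μ es
        size≤ : inputSize ds ≤ ⟪ argSize es ⟫ W
        size≤ = inputSize-≤ ds (length-evals es fit h)

      evals-run : ∀ {n} (es : Vec Exp n) fits {v W μ} → Bounded W μ →
                  Run (evalsFlow es fits) tt (v ∷ [] ∷ [] ∷ image μ) tt ((encode E (evals μ es) ʳ++ v) ∷ [] ∷ [] ∷ image μ) (⟪ costᴱˢ es ⟫ W)
      evals-run []            _            h = prim refl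
      evals-run (e ∷ [])      (fit , _)    h = eval-run e fit h
      evals-run (e ∷ e′ ∷ es) (fit , fits) {v} {W} {μ} h =
        eval-run e fit h ⨟ prim refl ⨟
        subst (λ u → Run (evalsFlow (e′ ∷ es) fits) tt ((TM.sep ∷ (letters (eval μ e) ʳ++ v)) ∷ [] ∷ [] ∷ image μ) tt (u ∷ [] ∷ [] ∷ image μ) (⟪ costᴱˢ (e′ ∷ es) ⟫ W))
          (sym (Listₚ.++-ʳ++ (letters (eval μ e)))) (evals-run (e′ ∷ es) fits h)

    -- Guards are compared with `𝐭` only; in a derivable run the other value is `𝐟`, which differs
    -- from it.
    execFlow : ∀ C → Fitsᶜ C → Flow StackOp ⊤ ⊤
    execFlow (X ≔ e)  (X<V , fit)  = evalFlow e fit ⨟ store (fromℕ< X<V)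
    execFlow (C ⨾ C′) (fit , fit′) = execFlow C fit ⨟ execFlow C′ fit′
    execFlow skip     _            = noop
    execFlow (if e then C else C′) (fitᴱ , fit , fit′) = (evalFlow e fitᴱ ⨟ test 𝐭) ⨟ branch (execFlow C fit) (execFlow C′ fit′)
    execFlow (while e C) (fitᴱ , fit) =
      iter ((evalFlow e fitᴱ ⨟ test 𝐭) ⨟ branch (execFlow C fit ⨟ prim (ret ∘ inj₁)) (prim (ret ∘ inj₂)))

    idle : Store → Stacks
    idle μ = [] ∷ [] ∷ [] ∷ image μ

    guard-yes : ∀ e fit {μ W} → Bounded W μ → eval μ e ≡ 𝐭 →
                Run (evalFlow e fit ⨟ test 𝐭) tt (idle μ) (inj₁ tt) (idle μ) (⟪ costᴳ e ⟫ W)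
    guard-yes e fit h eq = eval-run e fit h ⨟ weaken (+-monoˡ-≤ 4 (+-monoʳ-≤ (length 𝐭) (length-eval e fit h))) (test-yes 𝐭 eq)

    guard-no : ∀ e fit {μ W} → Bounded W μ → eval μ e ≡ 𝐟 →
               Run (evalFlow e fit ⨟ test 𝐭) tt (idle μ) (inj₂ tt) (idle μ) (⟪ costᴳ e ⟫ W)
    guard-no e fit h eq = eval-run e fit h ⨟ weaken (+-monoˡ-≤ 4 (+-monoʳ-≤ (length 𝐭) (length-eval e fit h))) (test-no 𝐭 (λ eq′ → 𝐭≢𝐟 (trans (sym eq′) eq)))

    -- `K` bounds the growth per step, `W` all lengths during the whole run and `Q` the price of a
    -- step. Below, `B` bounds the lengths at the current moment and becomes `B + K * t` after `t`
    -- steps.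
    module Execution (K W Q : ℕ) where

      Affords : Cmd → Set
      Affords (X ≔ e)               = ⟪ costᶜ (X ≔ e) ⟫ W ≤ Q × growᴱ e ≤ K
      Affords (C ⨾ C′)              = Affords C × Affords C′
      Affords skip                  = 1 ≤ Q
      Affords (if e then C else C′) = ⟪ costᴳ e ⟫ W ≤ Q × Affords C × Affords C′
      Affords (while e C)           = ⟪ costᴳ e ⟫ W + 1 ≤ Q × Affords C

      affords : ∀ C → ⟪ costᶜ C ⟫ W ≤ Q → growᶜ C ≤ K → Affords C
      affords (X ≔ e)  c≤ g≤ = c≤ , g≤
      affords (C ⨾ C′) c≤ g≤ =
        affords C (m+n≤o⇒m≤o (⟪ costᶜ C ⟫ W) c≤) (m⊔n≤o⇒m≤o (growᶜ C) (growᶜ C′) g≤) ,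
        affords C′ (m+n≤o⇒n≤o (⟪ costᶜ C ⟫ W) c≤) (m⊔n≤o⇒n≤o (growᶜ C) (growᶜ C′) g≤)
      affords skip     c≤ g≤ = c≤
      affords (if e then C else C′) c≤ g≤ =
        m+n≤o⇒m≤o (⟪ costᴳ e ⟫ W) c≤ ,
        affords C (m+n≤o⇒m≤o (⟪ costᶜ C ⟫ W) (m+n≤o⇒n≤o (⟪ costᴳ e ⟫ W) c≤)) (m⊔n≤o⇒m≤o (growᶜ C) (growᶜ C′) g≤) ,
        affords C′ (m+n≤o⇒n≤o (⟪ costᶜ C ⟫ W) (m+n≤o⇒n≤o (⟪ costᴳ e ⟫ W) c≤)) (m⊔n≤o⇒n≤o (growᶜ C) (growᶜ C′) g≤)
      affords (while e C) c≤ g≤ =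
        m+n≤o⇒m≤o (⟪ costᴳ e ⟫ W + 1) c≤ , affords C (m+n≤o⇒n≤o (⟪ costᴳ e ⟫ W + 1) c≤) g≤

      start≤ : ∀ {B} t → B + K * t ≤ W → B ≤ W
      start≤ {B} t h = ≤-trans (m≤m+n B (K * t)) h

      front≤ : ∀ {B} t t′ → B + K * (t + t′) ≤ W → B + K * t ≤ W
      front≤ {B} t t′ h = ≤-trans (+-monoʳ-≤ B (*-monoʳ-≤ K (m≤m+n t t′))) h

      tail≤ : ∀ {B} t t′ → B + K * (t + t′) ≤ W → B + K * t′ ≤ W
      tail≤ {B} t t′ h = ≤-trans (+-monoʳ-≤ B (*-monoʳ-≤ K (m≤n+m t′ t))) h

      split : ∀ B t t′ → B + K * (t + t′) ≡ B + K * t + K * t′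
      split B t t′ = trans (cong (B +_) (*-distribˡ-+ K t t′)) (sym (+-assoc B (K * t) (K * t′)))

      widen : ∀ {B B′ μ} → B ≤ B′ → Bounded B μ → Bounded B′ μ
      widen B≤ h X X<V = ≤-trans (h X X<V) B≤

      Outcome : ∀ C → Fitsᶜ C → Store → Store → ℕ → ℕ → Set₁
      Outcome C fit μ μ₁ B t = Run (execFlow C fit) tt (idle μ) tt (idle μ₁) (t * Q) × Bounded (B + K * t) μ₁

      mutual
        exec-run : ∀ C fit {μ μ₁ t B} → Big μ C μ₁ t → Bounded B μ → B + K * t ≤ W → Affords C → Outcome C fit μ μ₁ B t
        exec-run (X ≔ e) (X<V , fit) {μ} {B = B} assign h B≤ (c≤ , g≤) =
          weaken (≤-trans (+-monoʳ-≤ (⟪ costᴱ e ⟫ W) (+-monoˡ-≤ 3 (+-mono-≤ old≤ (*-monoʳ-≤ 2 (length-eval e fit h′)))))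
                          (≤-trans c≤ (≤-reflexive (sym (+-identityʳ Q)))))
            (eval-run e fit h′ ⨟
             subst (λ us → Run (store (fromℕ< X<V)) tt ((letters (eval μ e) ʳ++ []) ∷ [] ∷ [] ∷ image μ) tt ([] ∷ [] ∷ [] ∷ us)
                             (length (lookup (image μ) (fromℕ< X<V)) + 2 * length (eval μ e) + 3))
               (sym (image-update μ X<V (eval μ e))) (store-run (fromℕ< X<V) (eval μ e) [])) ,
          bounded
          where
          h′ : Bounded W μ
          h′ = widen {μ = μ} (start≤ {B} 1 B≤) h
          old≤ : length (lookup (image μ) (fromℕ< X<V)) ≤ W
          old≤ = ≤-trans (≤-reflexive (trans (cong length (lookup-image μ X<V)) (Listₚ.length-map TM.letter (μ X)))) (h′ X X<V)
          bounded : Bounded (B + K * 1) (μ [ X ← eval μ e ])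
          bounded Y Y<V with X Data.Nat.≟ Y
          ... | yes _ = ≤-trans (length-eval e fit h) (+-monoʳ-≤ B (≤-trans g≤ (≤-reflexive (sym (*-identityʳ K)))))
          ... | no _  = ≤-trans (h Y Y<V) (m≤m+n B (K * 1))
        exec-run (C ⨾ C′) (fit , fit′) {μ₁ = μ₂} {B = B} (seq {t = t} {t′} β γ) h B≤ (a , a′) =
          let ρ , h₁ = exec-run C fit β h (front≤ {B} t t′ B≤) a
              σ , h₂ = exec-run C′ fit′ γ h₁ (subst (_≤ W) (split B t t′) B≤) a′
          in weaken (≤-reflexive (sym (*-distribʳ-+ Q t t′))) (ρ ⨟ σ) , subst (λ n → Bounded n μ₂) (sym (split B t t′)) h₂
        exec-run skip _ {μ} {B = B} skip h B≤ 1≤Q =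
          weaken (≤-trans 1≤Q (≤-reflexive (sym (+-identityʳ Q)))) (prim refl) , widen {μ = μ} (m≤m+n B (K * 1)) h
        exec-run (if e then C else C′) (fitᴱ , fit , fit′) {μ} {μ₁} {B = B} (if-tt {t = t} eq β) h B≤ (c≤ , a , a′) =
          let ρ , h₁ = exec-run C fit β h (tail≤ {B} 1 t B≤) a
          in weaken c≤ (guard-yes e fitᴱ (widen {μ = μ} (start≤ {B} (suc t) B≤) h) eq) ⨟ branch₁ ρ ,
             widen {μ = μ₁} (+-monoʳ-≤ B (*-monoʳ-≤ K (n≤1+n t))) h₁
        exec-run (if e then C else C′) (fitᴱ , fit , fit′) {μ} {μ₁} {B = B} (if-ff {t = t} eq β) h B≤ (c≤ , a , a′) =
          let ρ , h₁ = exec-run C′ fit′ β h (tail≤ {B} 1 t B≤) a′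
          in weaken c≤ (guard-no e fitᴱ (widen {μ = μ} (start≤ {B} (suc t) B≤) h) eq) ⨟ branch₂ ρ ,
             widen {μ = μ₁} (+-monoʳ-≤ B (*-monoʳ-≤ K (n≤1+n t))) h₁
        exec-run (while e C) fit (while ℓ) h B≤ a = loop-run e C fit ℓ h B≤ a

        loop-run : ∀ e C fit {μ μ₁ i t B} → Loop e C μ μ₁ i t → Bounded B μ → B + K * t ≤ W → Affords (while e C) →
                   Outcome (while e C) fit μ μ₁ B t
        loop-run e C (fitᴱ , fit) {μ} {B = B} (exit eq) h B≤ (c≤ , a) =
          weaken (≤-trans c≤ (≤-reflexive (sym (+-identityʳ Q))))
            (stop (guard-no e fitᴱ (widen {μ = μ} (start≤ {B} 1 B≤) h) eq ⨟ branch₂ (prim refl))) ,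
          widen {μ = μ} (m≤m+n B (K * 1)) h
        loop-run e C (fitᴱ , fit) {μ} {μ₂} {B = B} (next {t = t} {t′} eq β ℓ) h B≤ (c≤ , a) =
          let ρ , h₁ = exec-run C fit β h (front≤ {B} t t′ (tail≤ {B} 1 (t + t′) B≤)) a
              σ , h₂ = loop-run e C (fitᴱ , fit) ℓ h₁ (subst (_≤ W) (split B t t′) (tail≤ {B} 1 (t + t′) B≤)) (c≤ , a)
          -- The additional 1 in the price of a loop guard pays for the `ret` that hands control
          -- back to the loop.
          in weaken (≤-trans (≤-reflexive (arith (⟪ costᴳ e ⟫ W) (t * Q) (t′ * Q)))
                      (+-mono-≤ c≤ (≤-reflexive (sym (*-distribʳ-+ Q t t′)))))
               (again (guard-yes e fitᴱ (widen {μ = μ} (start≤ {B} (suc (t + t′)) B≤) h) eq ⨟ branch₁ (ρ ⨟ prim refl)) σ) ,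
             widen {μ = μ₂} (≤-trans (≤-reflexive (sym (split B t t′))) (+-monoʳ-≤ B (*-monoʳ-≤ K (n≤1+n (t + t′))))) h₂
          where
          arith : ∀ g a b → g + (a + 1) + b ≡ g + 1 + (a + b)
          arith = solve-∀

    -- The last argument is on top of `val`. Storing from the last to the first is also the order of
    -- updates in `initStore`, so the two agree even if an input variable is repeated.
    distribute : ∀ {n} (Xs : Vec ℕ n) → (∀ i → lookup Xs i < V) → Flow StackOp ⊤ ⊤
    distribute []            <V = noop
    distribute (X ∷ [])      <V = store (fromℕ< (<V Fin.zero))
    distribute (X ∷ X′ ∷ Xs) <V = distribute (X′ ∷ Xs) (<V ∘ Fin.suc) ⨟ store (fromℕ< (<V Fin.zero))

    initStore-≤ : ∀ {n} (Xs : Vec ℕ n) ds X → length (initStore Xs ds X) ≤ inputSize ds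
    initStore-≤ []       []       X = z≤n
    initStore-≤ (Y ∷ Xs) (d ∷ ds) X with Y Data.Nat.≟ X
    ... | yes _ = m≤m+n (length d) (inputSize ds)
    ... | no _  = ≤-trans (initStore-≤ Xs ds X) (m≤n+m (inputSize ds) (length d))

    image-μ₀ : image μ₀ ≡ Vec.replicate V []
    image-μ₀ = tabulate-≡ λ i → sym (Vecₚ.lookup-replicate i [])

    store-input : ∀ {n v N X} (X<V : X < V) d (Xs : Vec ℕ n) ds → length d ≤ N → inputSize ds ≤ N → Ends notLetter v →
                  Run (store (fromℕ< X<V)) tt ((letters d ʳ++ v) ∷ [] ∷ [] ∷ image (initStore Xs ds)) tt
                      (List.drop 1 v ∷ [] ∷ [] ∷ image (initStore (X ∷ Xs) (d ∷ ds))) (3 * N + 3)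
    store-input {v = v} {N} {X} X<V d Xs ds d≤ ds≤ e =
      weaken (+-monoˡ-≤ 3 (+-mono-≤ old≤ (*-monoʳ-≤ 2 d≤)))
        (subst (λ us → Run (store (fromℕ< X<V)) tt ((letters d ʳ++ v) ∷ [] ∷ [] ∷ image (initStore Xs ds)) tt (List.drop 1 v ∷ [] ∷ [] ∷ us)
                         (length (lookup (image (initStore Xs ds)) (fromℕ< X<V)) + 2 * length d + 3))
          (sym (image-update (initStore Xs ds) X<V d)) (store-run (fromℕ< X<V) d e))
      where
      old≤ : length (lookup (image (initStore Xs ds)) (fromℕ< X<V)) ≤ N
      old≤ = ≤-trans (≤-reflexive (trans (cong length (lookup-image (initStore Xs ds) X<V)) (Listₚ.length-map TM.letter (initStore Xs ds X))))
                     (≤-trans (initStore-≤ Xs ds X) ds≤)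

    distribute-run : ∀ {n N v} (Xs : Vec ℕ (suc n)) <V ds → inputSize ds ≤ N → Ends notLetter v →
                     Run (distribute Xs <V) tt ((encode E ds ʳ++ v) ∷ [] ∷ [] ∷ image μ₀) tt (List.drop 1 v ∷ [] ∷ [] ∷ image (initStore Xs ds)) (suc n * (3 * N + 3))
    distribute-run {N = N} (X ∷ [])      <V (d ∷ []) ds≤ e =
      weaken (m≤m+n (3 * N + 3) 0) (store-input (<V Fin.zero) d [] [] (≤-trans (m≤m+n _ 0) ds≤) z≤n e)
    distribute-run {suc n} {N} {v} (X ∷ X′ ∷ Xs) <V (d ∷ d′ ∷ ds) ds≤ e =
      weaken (≤-reflexive (+-comm (suc n * (3 * N + 3)) (3 * N + 3)))
        (subst (λ u → Run (distribute (X′ ∷ Xs) (<V ∘ Fin.suc)) tt (u ∷ [] ∷ [] ∷ image μ₀) tt ((letters d ʳ++ v) ∷ [] ∷ [] ∷ image (initStore (X′ ∷ Xs) (d′ ∷ ds))) (suc n * (3 * N + 3)))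
           (sym (Listₚ.++-ʳ++ (letters d)))
           (distribute-run (X′ ∷ Xs) (<V ∘ Fin.suc) (d′ ∷ ds) (m+n≤o⇒n≤o (length d) ds≤) (hit refl)) ⨟
         store-input (<V Fin.zero) d (X′ ∷ Xs) (d′ ∷ ds) (m+n≤o⇒m≤o _ ds≤) (m+n≤o⇒n≤o (length d) ds≤) e)

    distribute-all : ∀ {n} (Xs : Vec ℕ n) <V ds →
                     Run (distribute Xs <V) tt ((encode E ds ʳ++ []) ∷ [] ∷ [] ∷ image μ₀) tt (idle (initStore Xs ds)) (n * (3 * inputSize ds + 3) + 1)
    distribute-all []       <V [] = prim refl
    distribute-all (X ∷ Xs) <V ds = weaken (m≤m+n _ 1) (distribute-run (X ∷ Xs) <V ds ≤-refl [])

    input : ∀ {n} (Xs : Vec ℕ n) → (∀ i → lookup Xs i < V) → Flow StackOp ⊤ ⊤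
    input Xs <V = transfer (λ _ → false) rgt val ⨟ distribute Xs <V

    input-cost : ℕ → Poly
    input-cost n = (con 2 ⊗ (𝕏 ⊕ con n) ⊕ con 2) ⊕ (con n ⊗ (con 3 ⊗ 𝕏 ⊕ con 3) ⊕ con 1)

    input-run : ∀ {n} (Xs : Vec ℕ n) <V ds →
                Run (input Xs <V) tt (initialStacks rgt (encode E ds)) tt (idle (initStore Xs ds)) (⟪ input-cost n ⟫ (inputSize ds))
    input-run Xs <V ds =
      weaken (+-monoˡ-≤ 2 (*-monoʳ-≤ 2 (length-encode E ds)))
        (subst₂ (λ r us → Run (transfer (λ _ → false) rgt val) tt ([] ∷ [] ∷ r ∷ us) tt ((encode E ds ʳ++ []) ∷ [] ∷ [] ∷ image μ₀) (2 * length (encode E ds) + 2))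
          (Listₚ.++-identityʳ (encode E ds)) image-μ₀
          (transfer-run moves-rgt-val (encode E ds) {[]} (All.universal (λ _ → refl) (encode E ds)) [])) ⨟
      distribute-all Xs <V ds

-- Tiers and the number of steps

Factor-refl : ∀ {k} (w : Word k) → Factor w w
Factor-refl w = [] , [] , sym (Listₚ.++-identityʳ w)

Factor-trans : ∀ {k} {u w d : Word k} → Factor u w → Factor w d → Factor u d
Factor-trans {u = u} (a , b , refl) (a′ , b′ , refl) = a′ ++ a , b ++ b′ , (begin
  a′ ++ (a ++ u ++ b) ++ b′    ≡⟨ cong (a′ ++_) (trans (Listₚ.++-assoc a (u ++ b) b′) (cong (a ++_) (Listₚ.++-assoc u b b′))) ⟩
  a′ ++ a ++ u ++ b ++ b′      ≡⟨ Listₚ.++-assoc a′ a (u ++ b ++ b′) ⟨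
  (a′ ++ a) ++ u ++ b ++ b′    ∎)
  where open ≡-Reasoning

slice : ∀ {k} → Word k → ℕ → ℕ → Word k
slice d i l = List.take l (List.drop i d)

slice-Factor : ∀ {k} (d : Word k) i l → Factor (slice d i l) d
slice-Factor d i l = List.take i d , List.drop l (List.drop i d) ,
  sym (trans (cong (List.take i d ++_) (Listₚ.take++drop≡id l (List.drop i d))) (Listₚ.take++drop≡id i d))

Factor-slice : ∀ {k} {w d : Word k} ((u , _) : Factor w d) → slice d (length u) (length w) ≡ w
Factor-slice {w = w} (u , u′ , refl) = trans (cong (List.take (length w)) (skip u)) (keep w)
  where
  skip : ∀ u → List.drop (length u) (u ++ w ++ u′) ≡ w ++ u′
  skip []      = refl
  skip (_ ∷ u) = skip u
  keep : ∀ w → List.take (length w) (w ++ u′) ≡ w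
  keep []      = refl
  keep (x ∷ w) = cong (x ∷_) (keep w)

Factor-slice-toℕ : ∀ {k a b} {w d : Word k} (fac@(u , _) : Factor w d) (p : length u < a) (q : length w < b) →
                   slice d (toℕ (fromℕ< p)) (toℕ (fromℕ< q)) ≡ w
Factor-slice-toℕ {d = d} fac p q = trans (cong₂ (slice d) (Finₚ.toℕ-fromℕ< p) (Finₚ.toℕ-fromℕ< q)) (Factor-slice fac)

Factor-offset : ∀ {k} {w d : Word k} ((u , _) : Factor w d) → length u ≤ length d
Factor-offset (u , u′ , refl) = ≤-trans (m≤m+n (length u) _) (≤-reflexive (sym (Listₚ.length-++ u)))

-- Factors are slices, so trying offsets and lengths up to `length d` decides. This decidability
-- later removes a double negation.
Factor? : ∀ {k} (w d : Word k) → Dec (Factor w d)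
Factor? w d = map′
  (λ (i , l , eq) → subst (λ w → Factor w d) eq (slice-Factor d (toℕ i) (toℕ l)))
  (λ fac → fromℕ< (s≤s (Factor-offset fac)) , fromℕ< (s≤s (length-Factor fac)) ,
           Factor-slice-toℕ fac (s≤s (Factor-offset fac)) (s≤s (length-Factor fac)))
  (Finₚ.any? λ (i : Fin (suc (length d))) → Finₚ.any? λ (l : Fin (suc (length d))) → Listₚ.≡-dec Fin._≟_ (slice d (toℕ i) (toℕ l)) w)

𝟙⪯⇒≡ : ∀ {α β} → β ⪯ α → β ≡ 𝟙 → α ≡ 𝟙
𝟙⪯⇒≡ 𝟙⪯𝟙 _ = refl

𝟙⪯⋀ : ∀ {n} α (αs : Vec Tier n) → 𝟙 ⪯ ⋀ (α ∷ αs) → α ≡ 𝟙 × 𝟙 ⪯ ⋀ αs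
𝟙⪯⋀ 𝟙 αs h = refl , h

∨≡𝟘 : ∀ α β → α ∨ᵗ β ≡ 𝟘 → α ≡ 𝟘 × β ≡ 𝟘
∨≡𝟘 𝟘 𝟘 _ = refl , refl

𝟘≢𝟙 : 𝟘 ≢ 𝟙
𝟘≢𝟙 ()

module Tiered (k : ℕ) (𝐭 𝐟 : Word k) (𝐭≢𝐟 : 𝐭 ≢ 𝐟) (Sg : Signature k)
              (fp : ∀ o → TM.FPtime k (Signature.⟦_⟧ Sg o))
              (np : ∀ o → Lang.Neutral k 𝐭 𝐟 Sg o ⊎ Lang.Positive k 𝐭 𝐟 Sg o)
              (Γ : ℕ → Tier) (Δ : Lang.OpTyping k 𝐭 𝐟 Sg) (safe : Lang.SafeΔ k 𝐭 𝐟 Sg Δ) (E V : ℕ) where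
  open Signature Sg
  open Lang k 𝐭 𝐟 Sg
  open Typing Γ Δ
  open BigStep k 𝐭 𝐟 Sg
  open Interpreter k 𝐭 𝐟 𝐭≢𝐟 Sg fp np
  open Compiler E V

  infix 4 _≈_
  _≈_ : Store → Store → Set
  μ ≈ ν = ∀ X → X < V → Γ X ≡ 𝟙 → μ X ≡ ν X

  mutual
    -- By safety a result of tier `𝟙` forces every argument to have tier `𝟙`, so no tier-0 variable
    -- is read anywhere in the expression.
    eval-≈ : ∀ {e α μ ν} → ⊢E e ∶ α → α ≡ 𝟙 → Fitsᴱ e → μ ≈ ν → eval μ e ≡ eval ν e
    eval-≈ (tvar {X}) Γ≡𝟙 X<V h = h X X<V Γ≡𝟙
    eval-≈ (top {o} {αs = αs} ts d) refl (_ , fit) h = cong ⟦ o ⟧ (evals-≈ ts (proj₁ (safe o αs 𝟙 d)) fit h)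

    evals-≈ : ∀ {n} {es : Vec Exp n} {αs μ ν} → ⊢Es es ∶ αs → 𝟙 ⪯ ⋀ αs → Fitsᴱˢ es → μ ≈ ν → evals μ es ≡ evals ν es
    evals-≈ []       _ _ h = refl
    evals-≈ {αs = α ∷ αs} (t ∷ ts) 𝟙⪯ (fit , fits) h =
      let α≡𝟙 , 𝟙⪯′ = 𝟙⪯⋀ α αs 𝟙⪯ in cong₂ _∷_ (eval-≈ t α≡𝟙 fit h) (evals-≈ ts 𝟙⪯′ fits h)

  -- A loop has tier `𝟙` and a sequence the join of its tiers, so a command of tier `𝟘` is free of
  -- loops and assigns only tier-0 variables.
  low-≈ : ∀ {C α μ μ₁ t} → ⊢C C ∶ α → α ≡ 𝟘 → Big μ C μ₁ t → μ ≈ μ₁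
  low-≈ (tassign {X} _ _) Γ≡𝟘 assign Y Y<V Γ≡𝟙 with X Data.Nat.≟ Y
  ... | yes refl = ⊥-elim (𝟘≢𝟙 (trans (sym Γ≡𝟘) Γ≡𝟙))
  ... | no _     = refl
  low-≈ (tseq {α = α} {β} c c′) eq (seq b b′) X X<V Γ≡𝟙 =
    let α≡ , β≡ = ∨≡𝟘 α β eq in trans (low-≈ c α≡ b X X<V Γ≡𝟙) (low-≈ c′ β≡ b′ X X<V Γ≡𝟙)
  low-≈ tskip        eq skip                = λ _ _ _ → refl
  low-≈ (tif _ c c′) eq (if-tt _ b)         = low-≈ c eq b
  low-≈ (tif _ c c′) eq (if-ff _ b)         = low-≈ c′ eq b

  -- Tier 1 determines even the number of iterations of a loop.
  mutual
    exec-≈ : ∀ {C α μ μ₁ ν ν₁ t t′} → ⊢C C ∶ α → Fitsᶜ C → Big μ C μ₁ t → Big ν C ν₁ t′ → μ ≈ ν → μ₁ ≈ ν₁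
    exec-≈ (tassign {X} te Γ⪯) (_ , fit) assign assign h Y Y<V Γ≡𝟙 with X Data.Nat.≟ Y
    ... | yes refl = eval-≈ te (𝟙⪯⇒≡ Γ⪯ Γ≡𝟙) fit h
    ... | no _     = h Y Y<V Γ≡𝟙
    exec-≈ (tseq c c′) (fit , fit′) (seq b₁ b₂) (seq d₁ d₂) h = exec-≈ c′ fit′ b₂ d₂ (exec-≈ c fit b₁ d₁ h)
    exec-≈ tskip _ skip skip h = h
    -- The two runs may take different branches here, but neither branch changes tier 1.
    exec-≈ (tif {α = 𝟘} te c c′) fit b d h X X<V Γ≡𝟙 =
      trans (sym (low-≈ (tif te c c′) refl b X X<V Γ≡𝟙)) (trans (h X X<V Γ≡𝟙) (low-≈ (tif te c c′) refl d X X<V Γ≡𝟙))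
    exec-≈ (tif {α = 𝟙} te c c′) (fitᴱ , fit , fit′) (if-tt eq b) (if-tt eq′ d) h = exec-≈ c fit b d h
    exec-≈ (tif {α = 𝟙} te c c′) (fitᴱ , fit , fit′) (if-ff eq b) (if-ff eq′ d) h = exec-≈ c′ fit′ b d h
    exec-≈ (tif {α = 𝟙} te c c′) (fitᴱ , fit , fit′) (if-tt eq b) (if-ff eq′ d) h = ⊥-elim (𝐭≢𝐟 (trans (sym eq) (trans (eval-≈ te refl fitᴱ h) eq′)))
    exec-≈ (tif {α = 𝟙} te c c′) (fitᴱ , fit , fit′) (if-ff eq b) (if-tt eq′ d) h = ⊥-elim (𝐭≢𝐟 (sym (trans (sym eq) (trans (eval-≈ te refl fitᴱ h) eq′))))
    exec-≈ (twhile te c) fit (while ℓ) (while ℓ′) h = proj₂ (loop-≈ te c fit ℓ ℓ′ h)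

    loop-≈ : ∀ {e C α μ μ₁ ν ν₁ i i′ t t′} → ⊢E e ∶ 𝟙 → ⊢C C ∶ α → Fitsᴱ e × Fitsᶜ C →
             Loop e C μ μ₁ i t → Loop e C ν ν₁ i′ t′ → μ ≈ ν → i ≡ i′ × μ₁ ≈ ν₁
    loop-≈ te c fit (exit eq) (exit eq′) h = refl , h
    loop-≈ te c fit (next eq b ℓ) (next eq′ b′ ℓ′) h =
      let i≡ , h′ = loop-≈ te c fit ℓ ℓ′ (exec-≈ c (proj₂ fit) b b′ h) in cong suc i≡ , h′
    loop-≈ te c fit (exit eq) (next eq′ _ _) h = ⊥-elim (𝐭≢𝐟 (trans (sym eq′) (trans (sym (eval-≈ te refl (proj₁ fit) h)) eq)))
    loop-≈ te c fit (next eq _ _) (exit eq′) h = ⊥-elim (𝐭≢𝐟 (trans (sym eq) (trans (eval-≈ te refl (proj₁ fit) h) eq′)))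

  NeutralAt : ∀ o → Vec (Word k) (arity o) → Set
  NeutralAt o ds = (⟦ o ⟧ ds ≡ 𝐭 ⊎ ⟦ o ⟧ ds ≡ 𝐟) ⊎ Σ (Fin (arity o)) λ i → Factor (⟦ o ⟧ ds) (lookup ds i)

  Neutral⇒At : ∀ {o} → Neutral o → ∀ ds → NeutralAt o ds
  Neutral⇒At (inj₁ b)   ds = inj₁ (b ds)
  Neutral⇒At (inj₂ sub) ds = inj₂ (sub ds)

  -- Safety only yields that o is not not neutral, but neutrality at ds is decidable.
  neutralAt : ∀ {o αs} → Δ o αs 𝟙 → ∀ ds → NeutralAt o ds
  neutralAt {o} {αs} d ds with np o
  ... | inj₁ neu = Neutral⇒At neu ds
  ... | inj₂ pos = decidable-stable
    ((Listₚ.≡-dec Fin._≟_ (⟦ o ⟧ ds) 𝐭 ⊎-dec Listₚ.≡-dec Fin._≟_ (⟦ o ⟧ ds) 𝐟) ⊎-dec Finₚ.any? λ i → Factor? (⟦ o ⟧ ds) (lookup ds i))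
    λ ¬at → 𝟘≢𝟙 (sym (proj₂ (safe o αs 𝟙 d) pos λ neu → ¬at (Neutral⇒At neu ds)))

  -- `𝕏` stands for the number of tier-1 stores, which bounds the iterations of every single
  -- execution of a loop. The final 1 of a loop is the guard evaluation that leaves it.
  stepsᶜ : Cmd → Poly
  stepsᶜ (X ≔ e)               = con 1
  stepsᶜ (C ⨾ C′)              = stepsᶜ C ⊕ stepsᶜ C′
  stepsᶜ skip                  = con 1
  stepsᶜ (if e then C else C′) = con 1 ⊕ (stepsᶜ C ⊕ stepsᶜ C′)
  stepsᶜ (while e C)           = 𝕏 ⊗ (con 1 ⊕ stepsᶜ C) ⊕ con 1

  -- Counting tier-1 stores and loop iterations

  module Counting {m : ℕ} (D : Vec (Word k) (suc m)) {B : ℕ} (D≤ : ∀ j → length (lookup D j) ≤ B) where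

    Inside : Word k → Set
    Inside w = Σ (Fin (suc m)) λ j → Factor w (lookup D j)

    -- A factor of a source is given by the source, an offset and a length, both at most `B`.
    words : ℕ
    words = suc m * (suc B * suc B)

    offset< : ∀ {w} ((j , u , _) : Inside w) → length u < suc B
    offset< (j , fac) = s≤s (≤-trans (Factor-offset fac) (D≤ j))

    length< : ∀ {w} → Inside w → length w < suc B
    length< (j , fac) = s≤s (≤-trans (length-Factor fac) (D≤ j))

    code : ∀ {w} → Inside w → Fin words
    code p = Fin.combine (proj₁ p) (Fin.combine (fromℕ< (offset< p)) (fromℕ< (length< p)))

    sliceAt : Fin (suc m) → Fin (suc B) × Fin (suc B) → Word k
    sliceAt j (i , l) = slice (lookup D j) (toℕ i) (toℕ l)

    decode : Fin words → Word k
    decode c = let (j , il) = Fin.remQuot (suc B * suc B) c in sliceAt j (Fin.remQuot (suc B) il)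

    decode-code : ∀ {w} (p : Inside w) → decode (code p) ≡ w
    decode-code p@(j , fac) =
      trans (cong (λ (j , il) → sliceAt j (Fin.remQuot (suc B) il)) (Finₚ.remQuot-combine j (Fin.combine (fromℕ< (offset< p)) (fromℕ< (length< p)))))
        (trans (cong (sliceAt j) (Finₚ.remQuot-combine (fromℕ< (offset< p)) (fromℕ< (length< p))))
               (Factor-slice-toℕ fac (offset< p) (length< p)))

    code-injective : ∀ {w w′} (p : Inside w) (q : Inside w′) → code p ≡ code q → w ≡ w′
    code-injective p q eq = trans (sym (decode-code p)) (trans (cong decode eq) (decode-code q))

    -- Tier-0 variables all get one dummy code, which exists because there is at least one source;
    -- fingerprints thus ignore their values.
    codeIf : ∀ {w} τ → (τ ≡ 𝟙 → Inside w) → Fin words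
    codeIf 𝟘 p = Fin.zero
    codeIf 𝟙 p = code (p refl)

    codeIf-injective : ∀ {w w′ τ} (p : τ ≡ 𝟙 → Inside w) (q : τ ≡ 𝟙 → Inside w′) → τ ≡ 𝟙 → codeIf τ p ≡ codeIf τ q → w ≡ w′
    codeIf-injective p q refl = code-injective (p refl) (q refl)

    Good : Store → Set
    Good μ = ∀ X → X < V → Γ X ≡ 𝟙 → Inside (μ X)

    stores : ℕ
    stores = words ^ V

    fingerprint : ∀ {μ} → Good μ → Fin stores
    fingerprint g = Fin.funToFin λ X → codeIf (Γ (toℕ X)) (g (toℕ X) (Finₚ.toℕ<n X))

    fingerprint-≈ : ∀ {μ ν} (g : Good μ) (g′ : Good ν) → fingerprint g ≡ fingerprint g′ → μ ≈ ν
    fingerprint-≈ {μ} {ν} g g′ eq X X<V Γ≡𝟙 =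
      subst (λ Y → μ Y ≡ ν Y) X≡ (codeIf-injective (g (toℕ X′) (Finₚ.toℕ<n X′)) (g′ (toℕ X′) (Finₚ.toℕ<n X′)) (trans (cong Γ X≡) Γ≡𝟙)
        (trans (sym (Finₚ.finToFun-funToFin (λ X → codeIf (Γ (toℕ X)) (g (toℕ X) (Finₚ.toℕ<n X))) X′))
          (trans (cong (λ c → Fin.finToFun c X′) eq)
                 (Finₚ.finToFun-funToFin (λ X → codeIf (Γ (toℕ X)) (g′ (toℕ X) (Finₚ.toℕ<n X))) X′))))
      where
      X′ = fromℕ< X<V
      X≡ : toℕ X′ ≡ X
      X≡ = Finₚ.toℕ-fromℕ< X<V

    module _ (𝐭-in : Inside 𝐭) (𝐟-in : Inside 𝐟) where

      mutual
        eval-Inside : ∀ {e α μ} → ⊢E e ∶ α → α ≡ 𝟙 → Fitsᴱ e → Good μ → Inside (eval μ e)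
        eval-Inside (tvar {X}) Γ≡𝟙 X<V g = g X X<V Γ≡𝟙
        eval-Inside {μ = μ} (top {es = es} {αs} ts d) refl (_ , fit) g with neutralAt d (evals μ es)
        ... | inj₁ (inj₁ eq)  = subst Inside (sym eq) 𝐭-in
        ... | inj₁ (inj₂ eq)  = subst Inside (sym eq) 𝐟-in
        ... | inj₂ (i , fac)  = let j , fac′ = evals-Inside ts (proj₁ (safe _ αs 𝟙 d)) fit g i in j , Factor-trans fac fac′

        evals-Inside : ∀ {n} {es : Vec Exp n} {αs μ} → ⊢Es es ∶ αs → 𝟙 ⪯ ⋀ αs → Fitsᴱˢ es → Good μ → ∀ i → Inside (lookup (evals μ es) i)
        evals-Inside {αs = α ∷ αs} (t ∷ ts) 𝟙⪯ (fit , fits) g Fin.zero    = eval-Inside t (proj₁ (𝟙⪯⋀ α αs 𝟙⪯)) fit g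
        evals-Inside {αs = α ∷ αs} (t ∷ ts) 𝟙⪯ (fit , fits) g (Fin.suc i) = evals-Inside ts (proj₂ (𝟙⪯⋀ α αs 𝟙⪯)) fits g i

      mutual
        exec-Good : ∀ {C α μ μ₁ t} → ⊢C C ∶ α → Fitsᶜ C → Big μ C μ₁ t → Good μ → Good μ₁
        exec-Good (tassign {X} te Γ⪯) (_ , fit) assign g Y Y<V Γ≡𝟙 with X Data.Nat.≟ Y
        ... | yes refl = eval-Inside te (𝟙⪯⇒≡ Γ⪯ Γ≡𝟙) fit g
        ... | no _     = g Y Y<V Γ≡𝟙
        exec-Good (tseq c c′)   (fit , fit′)     (seq b b′)  g = exec-Good c′ fit′ b′ (exec-Good c fit b g)
        exec-Good tskip         _                skip        g = g
        exec-Good (tif _ c c′)  (_ , fit , fit′) (if-tt _ b) g = exec-Good c fit b g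
        exec-Good (tif _ c c′)  (_ , fit , fit′) (if-ff _ b) g = exec-Good c′ fit′ b g
        exec-Good (twhile te c) (_ , fit)        (while ℓ)   g = loop-Good c fit ℓ g

        loop-Good : ∀ {e C α μ μ₁ i t} → ⊢C C ∶ α → Fitsᶜ C → Loop e C μ μ₁ i t → Good μ → Good μ₁
        loop-Good c fit (exit _)     g = g
        loop-Good c fit (next _ b ℓ) g = loop-Good c fit ℓ (exec-Good c fit b g)

      -- A loop of `i` iterations has `i + 1` heads, the one at which it exits included. Each comes
      -- with the rest of the loop, whose length tells the heads apart.
      head : ∀ {e C α μ μ₁ i t} → ⊢C C ∶ α → Fitsᶜ C → Loop e C μ μ₁ i t → Good μ →
             (j : Fin (suc i)) → Σ Store λ ν → Good ν × Σ ℕ (Loop e C ν μ₁ (i ∸ toℕ j))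
      head c fit ℓ            g Fin.zero    = _ , g , _ , ℓ
      head c fit (next _ b ℓ) g (Fin.suc j) = head c fit ℓ (exec-Good c fit b g) j

      -- Two loop heads that agree on tier 1 would have the same number of iterations left.
      iterations-≤ : ∀ {e C α μ μ₁ i t} → ⊢E e ∶ 𝟙 → ⊢C C ∶ α → Fitsᴱ e × Fitsᶜ C → Loop e C μ μ₁ i t → Good μ → i < stores
      iterations-≤ {i = i} te c fit ℓ g with suc i ≤? stores
      ... | yes i<  = i<
      ... | no  i≮  =
        let heads = head c (proj₂ fit) ℓ g
            j , j′ , j<j′ , eq = Finₚ.pigeonhole (≰⇒> i≮) (λ j → fingerprint (proj₁ (proj₂ (heads j))))
            _ , g₁ , _ , ℓ₁ = heads j
            _ , g₂ , _ , ℓ₂ = heads j′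
            left≡ = proj₁ (loop-≈ te c fit ℓ₁ ℓ₂ (fingerprint-≈ g₁ g₂ eq))
        in ⊥-elim (<⇒≢ j<j′ (∸-cancelˡ-≡ (≤-pred (Finₚ.toℕ<n j)) (≤-pred (Finₚ.toℕ<n j′)) left≡))

      mutual
        steps-≤ : ∀ {C α μ μ₁ t} → ⊢C C ∶ α → Fitsᶜ C → Big μ C μ₁ t → Good μ → t ≤ ⟪ stepsᶜ C ⟫ stores
        steps-≤ (tassign _ _)  _                assign      g = ≤-refl
        steps-≤ (tseq c c′)    (fit , fit′)     (seq b b′)  g = +-mono-≤ (steps-≤ c fit b g) (steps-≤ c′ fit′ b′ (exec-Good c fit b g))
        steps-≤ tskip          _                skip        g = ≤-refl
        steps-≤ (tif _ c c′)   (_ , fit , fit′) (if-tt _ b) g = s≤s (≤-trans (steps-≤ c fit b g) (m≤m+n _ _))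
        steps-≤ (tif _ c c′)   (_ , fit , fit′) (if-ff _ b) g = s≤s (≤-trans (steps-≤ c′ fit′ b g) (m≤n+m _ _))
        steps-≤ {while e C} (twhile te c) fit (while ℓ) g =
          ≤-trans (loop-steps c (proj₂ fit) ℓ g) (+-monoˡ-≤ 1 (*-monoˡ-≤ (1 + ⟪ stepsᶜ C ⟫ stores) (<⇒≤ (iterations-≤ te c fit ℓ g))))

        loop-steps : ∀ {e C α μ μ₁ i t} → ⊢C C ∶ α → Fitsᶜ C → Loop e C μ μ₁ i t → Good μ → t ≤ i * (1 + ⟪ stepsᶜ C ⟫ stores) + 1
        loop-steps c fit (exit _) g = ≤-refl
        loop-steps {C = C} {i = suc i} c fit (next _ b ℓ) g =
          s≤s (≤-trans (+-mono-≤ (steps-≤ c fit b g) (loop-steps c fit ℓ (exec-Good c fit b g)))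
                       (≤-reflexive (sym (+-assoc (⟪ stepsᶜ C ⟫ stores) (i * (1 + ⟪ stepsᶜ C ⟫ stores)) 1))))

maxVar : ∀ {n} → Vec ℕ n → ℕ
maxVar []       = 0
maxVar (X ∷ Xs) = suc X ⊔ maxVar Xs

lookup<maxVar : ∀ {n} (Xs : Vec ℕ n) i → lookup Xs i < maxVar Xs
lookup<maxVar (X ∷ Xs) Fin.zero    = m≤m⊔n (suc X) (maxVar Xs)
lookup<maxVar (X ∷ Xs) (Fin.suc i) = ≤-trans (lookup<maxVar Xs i) (m≤n⊔m (suc X) (maxVar Xs))

-- Safe programs compute polynomial-time functions

module SafeProgram (k : ℕ) (𝐭 𝐟 : Word k) (𝐭≢𝐟 : 𝐭 ≢ 𝐟) (Sg : Signature k)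
                   (fp : ∀ o → TM.FPtime k (Signature.⟦_⟧ Sg o))
                   (np : ∀ o → Lang.Neutral k 𝐭 𝐟 Sg o ⊎ Lang.Positive k 𝐭 𝐟 Sg o)
                   (n : ℕ) (f : Vec (Word k) n → Word k) (M : Lang.SeqProgram k 𝐭 𝐟 Sg n)
                   (M-safe : Lang.Safe k 𝐭 𝐟 Sg (Lang.SeqProgram.body M))
                   (M-computes : ∀ ds → Lang.Computes k 𝐭 𝐟 Sg M ds (f ds)) where
  open Lang k 𝐭 𝐟 Sg
  open BigStep k 𝐭 𝐟 Sg
  open SeqProgram M
  open Interpreter k 𝐭 𝐟 𝐭≢𝐟 Sg fp np
  open TM k using (inputSize)

  E V K : ℕ
  E = extrasᶜ body
  V = varsᶜ body ⊔ (suc output ⊔ maxVar inputs)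
  K = growᶜ body

  output<V : output < V
  output<V = ≤-trans (m≤m⊔n (suc output) (maxVar inputs)) (m≤n⊔m (varsᶜ body) (suc output ⊔ maxVar inputs))

  inputs<V : ∀ i → lookup inputs i < V
  inputs<V i = ≤-trans (lookup<maxVar inputs i)
    (≤-trans (m≤n⊔m (suc output) (maxVar inputs)) (m≤n⊔m (varsᶜ body) (suc output ⊔ maxVar inputs)))

  open Compiler E V
  open Tiered k 𝐭 𝐟 𝐭≢𝐟 Sg fp np (proj₁ M-safe) (proj₁ (proj₂ M-safe)) (proj₁ (proj₂ (proj₂ M-safe))) E V
  open Registers k E V using (StackOp; Run; _⨟_; weaken; rgt; reg; letters; initialStacks; module InputOutput)

  fits : Fitsᶜ body
  fits = fitsᶜ body (m≤m⊔n (varsᶜ body) (suc output ⊔ maxVar inputs)) ≤-refl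

  -- Every variable below `V`, empty or not, contributes its initial value. The initial store is
  -- then `Good` with each variable as its own source.
  sources : Vec (Word k) n → Vec (Word k) (2 + V)
  sources ds = 𝐭 ∷ 𝐟 ∷ Vec.tabulate λ X → initStore inputs ds (toℕ X)

  -- The exponent `V` depends on the program only, which makes the number of tier-1 stores
  -- polynomial in the input size. `size-bound` is the initial length plus `K` letters for every
  -- step.
  source-size stores-bound steps-bound size-bound time : Poly
  source-size  = con (length 𝐭) ⊕ con (length 𝐟) ⊕ 𝕏
  stores-bound = pow (con (2 + V) ⊗ ((con 1 ⊕ source-size) ⊗ (con 1 ⊕ source-size))) V
  steps-bound  = stepsᶜ body ⊙ stores-bound
  size-bound   = 𝕏 ⊕ con K ⊗ steps-bound
  time         = input-cost n ⊕ steps-bound ⊗ (costᶜ body ⊙ size-bound)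

  sources-≤ : ∀ ds j → length (lookup (sources ds) j) ≤ ⟪ source-size ⟫ (inputSize ds)
  sources-≤ ds Fin.zero                = ≤-trans (m≤m+n (length 𝐭) (length 𝐟)) (m≤m+n (length 𝐭 + length 𝐟) (inputSize ds))
  sources-≤ ds (Fin.suc Fin.zero)      = ≤-trans (m≤n+m (length 𝐟) (length 𝐭)) (m≤m+n (length 𝐭 + length 𝐟) (inputSize ds))
  sources-≤ ds (Fin.suc (Fin.suc X))   = ≤-trans
    (≤-trans (≤-reflexive (cong length (Vecₚ.lookup∘tabulate (λ X → initStore inputs ds (toℕ X)) X))) (initStore-≤ inputs ds (toℕ X)))
    (m≤n+m (inputSize ds) (length 𝐭 + length 𝐟))

  flow : Flow StackOp ⊤ ⊤
  flow = input inputs inputs<V ⨟ execFlow body fits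

  flow-run : ∀ ds → Σ _ λ s → Run flow tt (initialStacks rgt (encode E ds)) tt s (⟪ time ⟫ (inputSize ds)) ×
                              lookup s (reg (fromℕ< output<V)) ≡ letters (f ds)
  flow-run ds =
    let μ , ev , out≡ = M-computes ds
        t , β = ⇓⇒Big ev
        t≤ = steps-≤ (Fin.zero , Factor-refl 𝐭) (Fin.suc Fin.zero , Factor-refl 𝐟) (proj₂ (proj₂ (proj₂ (proj₂ M-safe)))) fits β good
        ρ , _ = exec-run body fits β (λ X _ → initStore-≤ inputs ds X) (+-monoʳ-≤ N (*-monoʳ-≤ K t≤)) (affords body ≤-refl ≤-refl)
    in idle μ , input-run inputs inputs<V ds ⨟ weaken (*-monoˡ-≤ Q t≤) ρ , trans (lookup-image μ output<V) (cong letters out≡)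
    where
    N = inputSize ds
    Q = ⟪ costᶜ body ⊙ size-bound ⟫ N
    open Execution K (⟪ size-bound ⟫ N) Q
    open Counting (sources ds) (sources-≤ ds)
    good : Good (initStore inputs ds)
    good X X<V _ = Fin.suc (Fin.suc (fromℕ< X<V)) , subst (Factor (initStore inputs ds X))
      (sym (trans (Vecₚ.lookup∘tabulate (λ X → initStore inputs ds (toℕ X)) (fromℕ< X<V)) (cong (initStore inputs ds) (Finₚ.toℕ-fromℕ< X<V))))
      (Factor-refl (initStore inputs ds X))

  computed⇒FPtime : TM.FPtime k f
  computed⇒FPtime = InputOutput.stackProgram⇒FPtime rgt (reg (fromℕ< output<V)) f flow time flow-run

-- Programs for polynomial-time functions

module Determinism (k : ℕ) (𝐭 𝐟 : Word k) (𝐭≢𝐟 : 𝐭 ≢ 𝐟) (Sg : Signature k) where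
  open Lang k 𝐭 𝐟 Sg

  done≢⊨ : ∀ {μ ν C} → done μ ≢ (ν ⊨ C)
  done≢⊨ ()

  →s-deterministic : ∀ {μ C c c′} → μ ⊨ C →s c → μ ⊨ C →s c′ → c ≡ c′
  →s-deterministic skip→         skip→          = refl
  →s-deterministic assign→       assign→        = refl
  →s-deterministic (seq-done s)  (seq-done s′)  with →s-deterministic s s′
  ... | refl = refl
  →s-deterministic (seq-done s)  (seq-cont s′)  = ⊥-elim (done≢⊨ (→s-deterministic s s′))
  →s-deterministic (seq-cont s)  (seq-done s′)  = ⊥-elim (done≢⊨ (→s-deterministic s′ s))
  →s-deterministic (seq-cont s)  (seq-cont s′)  with →s-deterministic s s′
  ... | refl = refl
  →s-deterministic (if-tt _)     (if-tt _)      = refl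
  →s-deterministic (if-ff _)     (if-ff _)      = refl
  →s-deterministic (if-tt eq)    (if-ff eq′)    = ⊥-elim (𝐭≢𝐟 (trans (sym eq) eq′))
  →s-deterministic (if-ff eq)    (if-tt eq′)    = ⊥-elim (𝐭≢𝐟 (trans (sym eq′) eq))
  →s-deterministic (while-ff _)  (while-ff _)   = refl
  →s-deterministic (while-tt _)  (while-tt _)   = refl
  →s-deterministic (while-tt eq) (while-ff eq′) = ⊥-elim (𝐭≢𝐟 (trans (sym eq) eq′))
  →s-deterministic (while-ff eq) (while-tt eq′) = ⊥-elim (𝐭≢𝐟 (trans (sym eq′) eq))

  -- By determinism the only successor is the next configuration of the given finite reduction, so
  -- one terminating run yields strong termination from that store.
  ⇓⇒Acc : ∀ {μ C μ′} → μ ⊨ C ⇓ μ′ → Acc Succ (μ , C)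
  ⇓⇒Acc (last s)   = acc λ s′ → ⊥-elim (done≢⊨ (→s-deterministic s s′))
  ⇓⇒Acc (more s r) = acc λ s′ → same (→s-deterministic s s′) (⇓⇒Acc r)
    where
    same : ∀ {μ C μ′ C′} → (μ ⊨ C) ≡ (μ′ ⊨ C′) → Acc Succ (μ , C) → Acc Succ (μ′ , C′)
    same refl a = a

  ⇓-⨾ : ∀ {μ C μ₁ C′ μ₂} → μ ⊨ C ⇓ μ₁ → μ₁ ⊨ C′ ⇓ μ₂ → μ ⊨ (C ⨾ C′) ⇓ μ₂
  ⇓-⨾ (last s)   r′ = more (seq-done s) r′
  ⇓-⨾ (more s r) r′ = more (seq-cont s) (⇓-⨾ r r′)

  update-same : ∀ μ X d → (μ [ X ← d ]) X ≡ d
  update-same μ X d with X Data.Nat.≟ X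
  ... | yes _  = refl
  ... | no X≢X = ⊥-elim (X≢X refl)

  update-other : ∀ μ {X Y} d → X ≢ Y → (μ [ X ← d ]) Y ≡ μ Y
  update-other μ {X} {Y} d X≢Y with X Data.Nat.≟ Y
  ... | yes X≡Y = ⊥-elim (X≢Y X≡Y)
  ... | no _    = refl

  initStore-lookup : ∀ {n} (g : Fin n → ℕ) → (∀ {i j} → g i ≡ g j → i ≡ j) → ∀ ds i → initStore (Vec.tabulate g) ds (g i) ≡ lookup ds i
  initStore-lookup g inj (d ∷ ds) Fin.zero    = update-same (initStore (Vec.tabulate (g ∘ Fin.suc)) ds) (g Fin.zero) d
  initStore-lookup g inj (d ∷ ds) (Fin.suc i) =
    trans (update-other (initStore (Vec.tabulate (g ∘ Fin.suc)) ds) d λ eq → Finₚ.0≢1+n (inj eq))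
          (initStore-lookup (g ∘ Fin.suc) (Finₚ.suc-injective ∘ inj) ds i)

  initStore-other : ∀ {n} (g : Fin n → ℕ) X → (∀ i → g i ≢ X) → ∀ ds → initStore (Vec.tabulate g) ds X ≡ []
  initStore-other g X ≢X []       = refl
  initStore-other g X ≢X (d ∷ ds) =
    trans (update-other (initStore (Vec.tabulate (g ∘ Fin.suc)) ds) d (≢X Fin.zero)) (initStore-other (g ∘ Fin.suc) X (≢X ∘ Fin.suc) ds)

-- The operators of the program for a polynomial-time function

module Operators (k : ℕ) (𝐭 𝐟 : Word k) (n : ℕ) (f : Vec (Word k) n → Word k) (f-FPtime : TM.FPtime k f) where
  open TM k hiding (encode)

  M : Machine
  M = proj₁ f-FPtime

  c : ℕ
  c = proj₁ (proj₂ f-FPtime)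

  -- The head cell plus the cells to its right: at most the encoded input and one new cell per step
  -- of the machine.
  output-bound : Poly
  output-bound = con 1 ⊕ (𝕏 ⊕ con n ⊕ pow (𝕏 ⊕ con c) c)

  length-f : ∀ ds → length (f ds) ≤ ⟪ output-bound ⟫ (inputSize ds)
  length-f ds =
    let t , t≤ , h , out≡ = proj₂ (proj₂ f-FPtime) ds in
    ≤-trans (≤-reflexive (cong length (sym out≡)))
      (≤-trans (Registers.Embed.output-≤ k (Machine.extras M) 0 M ≤-refl (TM.encode k M ds) t h)
        (s≤s (+-mono-≤ (≤-trans (≤-reflexive (cong length (encode≡ M ds))) (length-encode (Machine.extras M) ds)) t≤)))

  data Op : Set where
    nonempty tail grow : Op

  arity : Op → ℕ
  arity nonempty = 1
  arity tail     = 1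
  arity grow     = suc n

  ⟦_⟧ : (o : Op) → Vec (Word k) (arity o) → Word k
  ⟦ nonempty ⟧ ([] ∷ [])      = 𝐟
  ⟦ nonempty ⟧ ((_ ∷ _) ∷ []) = 𝐭
  ⟦ tail ⟧     (d ∷ [])       = List.drop 1 d
  ⟦ grow ⟧     (y ∷ ds)       = List.take (suc (length y)) (f ds)

  signature : Signature k
  signature = record { Op = Op ; arity = arity ; ⟦_⟧ = ⟦_⟧ }

  module Simple where
    open Registers k 0 0

    spell : Word k → Flow StackOp ⊤ ⊤
    spell []      = noop
    spell (a ∷ w) = spell w ⨟ prim (λ _ → push lft (TM.letter a) tt)

    spell-run : ∀ {v r vs} w → Run (spell w) tt (v ∷ [] ∷ r ∷ vs) tt (v ∷ letters w ∷ r ∷ vs) (length w + 1)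
    spell-run []      = prim refl
    spell-run (a ∷ w) = weaken (≤-reflexive (+-comm (length w + 1) 1)) (spell-run w ⨟ prim refl)

    nonempty-FPtime : FPtime ⟦ nonempty ⟧
    nonempty-FPtime = InputOutput.stackProgram⇒FPtime rgt lft ⟦ nonempty ⟧
      (prim (λ _ → pop rgt nonempty?) ⨟ branch (spell 𝐭) (spell 𝐟)) (con (1 + (length 𝐭 + length 𝐟 + 1))) λ
        { ([] ∷ [])      → _ , prim refl ⨟ branch₂ (weaken (+-monoˡ-≤ 1 (m≤n+m (length 𝐟) (length 𝐭))) (spell-run 𝐟)) , refl
        ; ((a ∷ d) ∷ []) → _ , prim refl ⨟ branch₁ (weaken (+-monoˡ-≤ 1 (m≤m+n (length 𝐭) (length 𝐟))) (spell-run 𝐭)) , refl }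

    tail-FPtime : FPtime ⟦ tail ⟧
    tail-FPtime = InputOutput.stackProgram⇒FPtime rgt rgt ⟦ tail ⟧ (prim (λ _ → pop rgt (λ _ → tt))) (con 1) λ
      { ([] ∷ [])      → _ , prim refl , refl
      ; ((a ∷ d) ∷ []) → _ , prim refl , refl }

  module Grow where
    open Registers k (Machine.extras M) 1
    open Embed M ≤-refl

    emitPop : Maybe Γ → StackOp (⊤ ⊎ ⊤)
    emitPop nothing  = ret (inj₂ tt)
    emitPop (just x) = push val x (inj₁ tt)

    count : ⊤ ⊎ ⊤ → StackOp (⊤ ⊎ ⊤)
    count (inj₁ _) = pop (reg Fin.zero) nonempty?
    count (inj₂ _) = ret (inj₂ tt)

    -- A letter is emitted before the counter is popped, so one letter more comes out than the
    -- counter holds.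
    takeFlow : Flow StackOp ⊤ ⊤
    takeFlow = iter (prim (λ _ → pop lft id) ⨟ prim emitPop ⨟ prim count)

    takeFlow-run : ∀ u w {v r} → Σ (List Γ) λ l → Σ (List Γ) λ u′ →
                   Run takeFlow tt (v ∷ letters w ∷ r ∷ u ∷ []) tt ((letters (List.take (suc (length u)) w) ʳ++ v) ∷ l ∷ r ∷ u′ ∷ []) (3 * length u + 3)
    takeFlow-run u       []      = _ , _ , weaken (m≤n+m 3 (3 * length u)) (stop (prim refl ⨟ prim refl ⨟ prim refl))
    takeFlow-run []      (a ∷ w) = _ , _ , stop (prim refl ⨟ prim refl ⨟ prim refl)
    takeFlow-run (x ∷ u) (a ∷ w) =
      let l , u′ , ρ = takeFlow-run u w in
      l , u′ , weaken (≤-reflexive (cong (_+ 3) (sym (*-suc 3 (length u))))) (again (prim refl ⨟ prim refl ⨟ prim refl) ρ)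

    -- Only the length of `y` matters, so `y` moves into the register as a unary counter. Removing
    -- it with its separator leaves on `rgt` exactly the encoded arguments of `f`.
    growFlow : Flow StackOp ⊤ ⊤
    growFlow = transfer notLetter rgt (reg Fin.zero) ⨟ simulation ⨟ transfer (λ _ → false) val lft ⨟ takeFlow ⨟ transfer (λ _ → false) val rgt

    time : Poly
    time = (con 2 ⊗ 𝕏 ⊕ con 2) ⊕ (simulation-time n c ⊕ ((con 2 ⊗ output-bound ⊕ con 2) ⊕ ((con 3 ⊗ 𝕏 ⊕ con 3) ⊕ (con 2 ⊗ output-bound ⊕ con 2))))

    after : ∀ {n} → Vec (Word k) n → List Γ
    after []       = []
    after (d ∷ ds) = TM.sep ∷ encode (Machine.extras M) (d ∷ ds)

    encode-∷ : ∀ {n} y (ds : Vec (Word k) n) → encode (Machine.extras M) (y ∷ ds) ≡ letters y ++ after ds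
    encode-∷ y []       = sym (Listₚ.++-identityʳ (letters y))
    encode-∷ y (_ ∷ _) = refl

    drop-after : ∀ {n} (ds : Vec (Word k) n) → List.drop 1 (after ds) ≡ encode (Machine.extras M) ds
    drop-after []      = refl
    drop-after (_ ∷ _) = refl

    after-ends : ∀ {n} (ds : Vec (Word k) n) → Ends notLetter (after ds)
    after-ends []      = []
    after-ends (_ ∷ _) = hit refl

    reversed : ∀ w → (letters w ʳ++ []) ʳ++ [] ≡ letters w
    reversed w = trans (Listₚ.ʳ++-ʳ++ (letters w)) (Listₚ.++-identityʳ (letters w))

    length-reversed : ∀ w → length (letters w ʳ++ []) ≡ length w
    length-reversed w = trans (Listₚ.length-ʳ++ (letters w)) (trans (+-identityʳ _) (Listₚ.length-map TM.letter w))

    growFlow-run : ∀ yds → Σ Stacks λ s → Run growFlow tt (initialStacks rgt (encode (Machine.extras M) yds)) tt s (⟪ time ⟫ (inputSize yds)) ×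
                                          lookup s rgt ≡ letters (⟦ grow ⟧ yds)
    growFlow-run (y ∷ ds) =
      let l , u , ρ = takeFlow-run (letters y ʳ++ []) (f ds) {[]} {[]} in
      [] ∷ l ∷ letters z ∷ u ∷ [] ,
      weaken (+-monoˡ-≤ 2 (*-monoʳ-≤ 2 y≤))
        (subst₂ (λ r r′ → Run (transfer notLetter rgt (reg Fin.zero)) tt ([] ∷ [] ∷ r ∷ [] ∷ []) tt ([] ∷ [] ∷ r′ ∷ (letters y ʳ++ []) ∷ []) (2 * length (letters y) + 2))
          (sym (encode-∷ y ds)) (drop-after ds)
          (transfer-run (moves-rgt-reg {vs = [] ∷ []} Fin.zero) (letters y) {after ds} {[]} (letters-∌-end y) (after-ends ds))) ⨟
      weaken (Poly-mono (simulation-time n c) ds≤) (simulation-computes {n} {c} {f} (proj₂ (proj₂ f-FPtime)) ds) ⨟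
      weaken (+-monoˡ-≤ 2 (*-monoʳ-≤ 2 (≤-trans (≤-reflexive (length-reversed (f ds))) f≤)))
        (subst₂ (λ v l → Run (transfer (λ _ → false) val lft) tt (v ∷ [] ∷ [] ∷ _ ∷ []) tt ([] ∷ l ∷ [] ∷ _ ∷ []) (2 * length (letters (f ds) ʳ++ []) + 2))
          (Listₚ.++-identityʳ (letters (f ds) ʳ++ [])) (reversed (f ds))
          (transfer-run moves-val-lft (letters (f ds) ʳ++ []) {[]} (All.universal (λ _ → refl) _) [])) ⨟
      weaken (+-monoˡ-≤ 3 (*-monoʳ-≤ 3 (≤-trans (≤-reflexive (trans (length-reversed y) (sym (Listₚ.length-map TM.letter y)))) y≤))) ρ ⨟
      weaken (+-monoˡ-≤ 2 (*-monoʳ-≤ 2 (≤-trans (≤-reflexive (length-reversed z)) (≤-trans z≤ f≤))))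
        (subst₂ (λ v r → Run (transfer (λ _ → false) val rgt) tt (v ∷ l ∷ [] ∷ u ∷ []) tt ([] ∷ l ∷ r ∷ u ∷ []) (2 * length (letters z ʳ++ []) + 2))
          (Listₚ.++-identityʳ (letters z ʳ++ [])) (reversed z)
          (transfer-run moves-val-rgt (letters z ʳ++ []) {[]} (All.universal (λ _ → refl) _) [])) ,
      cong (λ m → letters (List.take (suc m) (f ds))) (length-reversed y)
      where
      z = List.take (suc (length (letters y ʳ++ []))) (f ds)
      y≤ : length (letters y) ≤ inputSize (y ∷ ds)
      y≤ = ≤-trans (≤-reflexive (Listₚ.length-map TM.letter y)) (m≤m+n (length y) (inputSize ds))
      ds≤ : inputSize ds ≤ inputSize (y ∷ ds)
      ds≤ = m≤n+m (inputSize ds) (length y)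
      f≤ : length (f ds) ≤ ⟪ output-bound ⟫ (inputSize (y ∷ ds))
      f≤ = ≤-trans (length-f ds) (Poly-mono output-bound ds≤)
      z≤ : length z ≤ length (f ds)
      z≤ = ≤-trans (≤-reflexive (Listₚ.length-take (suc (length (letters y ʳ++ []))) (f ds))) (m⊓n≤n _ (length (f ds)))

    grow-FPtime : FPtime ⟦ grow ⟧
    grow-FPtime = InputOutput.stackProgram⇒FPtime rgt rgt ⟦ grow ⟧ growFlow time growFlow-run

  operators-FPtime : ∀ o → FPtime ⟦ o ⟧
  operators-FPtime nonempty = Simple.nonempty-FPtime
  operators-FPtime tail     = Simple.tail-FPtime
  operators-FPtime grow     = Grow.grow-FPtime

-- Each execution of the innermost assignment Y ≔ grow (Y , inputs) lengthens the prefix of f inputs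
-- stored in Y by a letter; e nested loops over the inputs execute it (2 + N) ^ e times.
module GrowProgram (k : ℕ) (𝐭 𝐟 : Word k) (𝐭≢𝐟 : 𝐭 ≢ 𝐟) (n : ℕ) (f : Vec (Word k) n → Word k) (f-FPtime : TM.FPtime k f) where
  open Operators k 𝐭 𝐟 n f f-FPtime
  open Lang k 𝐭 𝐟 signature
  open Determinism k 𝐭 𝐟 𝐭≢𝐟 signature
  open TM k using (inputSize)

  inputs : Vec ℕ n
  inputs = Vec.tabulate toℕ

  inputs<n : ∀ i → lookup inputs i < n
  inputs<n i = subst (_< n) (sym (Vecₚ.lookup∘tabulate toℕ i)) (Finₚ.toℕ<n i)

  -- Variables below `n` are the inputs, `n` itself holds the growing prefix, and `Z j` is the
  -- counter shared by the loops of level `j`.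
  Z : ℕ → ℕ
  Z j = suc n + j

  extend : Cmd
  extend = n ≔ op grow (var n ∷ Vec.map var inputs)

  loop : ℕ → Cmd → Cmd
  loop j C = while (op nonempty (var (Z j) ∷ [])) ((Z j ≔ op tail (var (Z j) ∷ [])) ⨾ C)

  loops : ∀ {m} → ℕ → Cmd → Vec ℕ m → Cmd
  loops j C []       = skip
  loops j C (X ∷ Xs) = ((Z j ≔ var X) ⨾ loop j C) ⨾ loops j C Xs

  -- The loops over all inputs run `level j` as often as the input size `N`, and the two further
  -- copies bring this to `2 + N`, the base used in `Poly-≤`.
  level : ℕ → Cmd
  level zero    = extend
  level (suc j) = loops j (level j) inputs ⨾ (level j ⨾ level j)

  args : Store → Vec (Word k) n
  args μ = Vec.map μ inputs

  grows : ℕ → Vec (Word k) n → Word k → Word k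
  grows zero    ds y = y
  grows (suc m) ds y = grows m ds (⟦ grow ⟧ (y ∷ ds))

  grows-+ : ∀ a b ds y → grows (a + b) ds y ≡ grows b ds (grows a ds y)
  grows-+ zero    b ds y = refl
  grows-+ (suc a) b ds y = grows-+ a b ds (⟦ grow ⟧ (y ∷ ds))

  -- Beyond the length of `w` both sides are `w`, so surplus iterations of `grow` are harmless.
  take-length-take : ∀ {A : Set} m (w : List A) → List.take (suc (length (List.take m w))) w ≡ List.take (suc m) w
  take-length-take m       []      = refl
  take-length-take zero    (x ∷ w) = refl
  take-length-take (suc m) (x ∷ w) = cong (x ∷_) (take-length-take m w)

  grows-take : ∀ m a ds → grows m ds (List.take a (f ds)) ≡ List.take (a + m) (f ds)
  grows-take zero    a ds = cong (λ b → List.take b (f ds)) (sym (+-identityʳ a))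
  grows-take (suc m) a ds = trans (cong (grows m ds) (take-length-take a (f ds)))
    (trans (grows-take m (suc a) ds) (cong (λ b → List.take b (f ds)) (sym (+-suc a m))))

  -- Inputs and the counters of the enclosing loops are kept; the prefix in variable `n` and the
  -- counters of inner levels may change.
  Frame : ℕ → Store → Store → Set
  Frame j μ μ′ = ∀ X → X < n ⊎ Z j ≤ X → μ′ X ≡ μ X

  map-Frame : ∀ {j m μ μ′} (Xs : Vec ℕ m) → (∀ i → lookup Xs i < n) → Frame j μ μ′ → Vec.map μ′ Xs ≡ Vec.map μ Xs
  map-Frame []       <n fr = refl
  map-Frame (X ∷ Xs) <n fr = cong₂ _∷_ (fr X (inj₁ (<n Fin.zero))) (map-Frame Xs (<n ∘ Fin.suc) fr)

  Frame-trans : ∀ {j μ μ₁ μ₂} → Frame j μ μ₁ → Frame j μ₁ μ₂ → Frame j μ μ₂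
  Frame-trans fr fr′ X h = trans (fr′ X h) (fr X h)

  Frame-suc : ∀ {j μ μ′} → Frame j μ μ′ → Frame (suc j) μ μ′
  Frame-suc {j} fr X (inj₁ h) = fr X (inj₁ h)
  Frame-suc {j} fr X (inj₂ h) = fr X (inj₂ (≤-trans (+-monoʳ-≤ (suc n) (n≤1+n j)) h))

  Frame-Z : ∀ j μ d → Frame (suc j) μ (μ [ Z j ← d ])
  Frame-Z j μ d X (inj₁ h) = update-other μ d λ eq → <⇒≢ (≤-trans (m≤n⇒m≤1+n h) (m≤m+n (suc n) j)) (sym eq)
  Frame-Z j μ d X (inj₂ h) = update-other μ d (<⇒≢ (≤-trans (≤-reflexive (sym (+-suc (suc n) j))) h))

  Z≢n : ∀ j → Z j ≢ n
  Z≢n j eq = <⇒≢ (m≤m+n (suc n) j) (sym eq)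

  Executes : ℕ → Cmd → Store → ℕ → Set
  Executes j C μ m = Σ Store λ μ′ → (μ ⊨ C ⇓ μ′) × Frame j μ μ′ × μ′ n ≡ grows m (args μ) (μ n)

  seq-executes : ∀ {j C C′ μ} a b → Executes j C μ a → (∀ μ′ → args μ′ ≡ args μ → Executes j C′ μ′ b) → Executes j (C ⨾ C′) μ (a + b)
  seq-executes {μ = μ} a b (μ₁ , r , fr , eq) next =
    let args≡ = map-Frame inputs inputs<n fr
        μ₂ , r′ , fr′ , eq′ = next μ₁ args≡ in
    μ₂ , ⇓-⨾ r r′ , Frame-trans fr fr′ ,
    trans eq′ (trans (cong₂ (grows b) args≡ eq) (sym (grows-+ a b (args μ) (μ n))))

  set-Z : ∀ j X μ → Executes (suc j) (Z j ≔ var X) μ 0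
  set-Z j X μ = μ [ Z j ← μ X ] , last assign→ , Frame-Z j μ (μ X) , update-other μ (μ X) (Z≢n j)

  evals-var : ∀ {m} μ (Xs : Vec ℕ m) → evals μ (Vec.map var Xs) ≡ Vec.map μ Xs
  evals-var μ []       = refl
  evals-var μ (X ∷ Xs) = cong (μ X ∷_) (evals-var μ Xs)

  extend-executes : ∀ μ → Executes 0 extend μ 1
  extend-executes μ = _ , last assign→ , frame , trans (update-same μ n _) (cong (λ ds → ⟦ grow ⟧ (μ n ∷ ds)) (evals-var μ inputs))
    where
    frame : Frame 0 μ (μ [ n ← _ ])
    frame X (inj₁ h) = update-other μ _ λ eq → <⇒≢ h (sym eq)
    frame X (inj₂ h) = update-other μ _ (<⇒≢ (≤-trans (m≤m+n (suc n) 0) h))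

  nonempty-yes : ∀ (d : Word k) {m} → length d ≡ suc m → ⟦ nonempty ⟧ (d ∷ []) ≡ 𝐭
  nonempty-yes (_ ∷ _) eq = refl

  nonempty-no : ∀ (d : Word k) → length d ≡ 0 → ⟦ nonempty ⟧ (d ∷ []) ≡ 𝐟
  nonempty-no [] eq = refl

  loop-executes : ∀ {j C a} (ds : Vec (Word k) n) → (∀ μ → args μ ≡ ds → Executes j C μ a) →
                  ∀ l μ → args μ ≡ ds → length (μ (Z j)) ≡ l → Executes (suc j) (loop j C) μ (l * a)
  loop-executes {j} ds body zero    μ args≡ len = μ , last (while-ff (nonempty-no (μ (Z j)) len)) , (λ _ _ → refl) , refl
  loop-executes {j} {C} {a} ds body (suc l) μ args≡ len =
    let μ₁ = μ [ Z j ← List.drop 1 (μ (Z j)) ]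
        fr₁ = Frame-Z j μ (List.drop 1 (μ (Z j)))
        args₁ = map-Frame inputs inputs<n fr₁
        μ₂ , r₂ , fr₂ , eq₂ = body μ₁ (trans args₁ args≡)
        args₂ = map-Frame inputs inputs<n fr₂
        len₂ : length (μ₂ (Z j)) ≡ l
        -- The frame of the body protects the counter `Z j`, so an iteration shortens it by exactly
        -- the one letter removed by `tail`.
        len₂ = trans (cong length (trans (fr₂ (Z j) (inj₂ ≤-refl)) (update-same μ (Z j) (List.drop 1 (μ (Z j))))))
                     (trans (Listₚ.length-drop 1 (μ (Z j))) (cong (_∸ 1) len))
        μ₃ , r₃ , fr₃ , eq₃ = loop-executes ds body l μ₂ (trans args₂ (trans args₁ args≡)) len₂
    in μ₃ , more (while-tt (nonempty-yes (μ (Z j)) len)) (⇓-⨾ (⇓-⨾ (last assign→) r₂) r₃) ,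
       Frame-trans fr₁ (Frame-trans (Frame-suc fr₂) fr₃) ,
       (begin
         μ₃ n                                            ≡⟨ eq₃ ⟩
         grows (l * a) (args μ₂) (μ₂ n)                  ≡⟨ cong₂ (grows (l * a)) (trans args₂ args₁) (trans eq₂ (cong₂ (grows a) args₁ (update-other μ _ (Z≢n j)))) ⟩
         grows (l * a) (args μ) (grows a (args μ) (μ n)) ≡⟨ grows-+ a (l * a) (args μ) (μ n) ⟨
         grows (suc l * a) (args μ) (μ n)                ∎)
    where open ≡-Reasoning

  loops-executes : ∀ {j C a} (ds : Vec (Word k) n) → (∀ μ → args μ ≡ ds → Executes j C μ a) →
                   ∀ {m} (Xs : Vec ℕ m) → (∀ i → lookup Xs i < n) → ∀ μ → args μ ≡ ds → Executes (suc j) (loops j C Xs) μ (inputSize (Vec.map μ Xs) * a)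
  loops-executes ds body []       <n μ args≡ = μ , last skip→ , (λ _ _ → refl) , refl
  loops-executes {j} {C} {a} ds body (X ∷ Xs) <n μ args≡ =
    let μ₁ , r₁ , fr₁ , eq₁ = set-Z j X μ
        args₁ = map-Frame inputs inputs<n fr₁
        μ₂ , r₂ , fr₂ , eq₂ = loop-executes ds body (length (μ X)) μ₁ (trans args₁ args≡) (cong length (update-same μ (Z j) (μ X)))
        fr = Frame-trans fr₁ fr₂
        args₂ = map-Frame inputs inputs<n fr
        μ₃ , r₃ , fr₃ , eq₃ = loops-executes ds body Xs (<n ∘ Fin.suc) μ₂ (trans args₂ args≡)
    in μ₃ , ⇓-⨾ (⇓-⨾ r₁ r₂) r₃ , Frame-trans fr fr₃ ,
       (begin
         μ₃ n                                                                      ≡⟨ eq₃ ⟩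
         grows (inputSize (Vec.map μ₂ Xs) * a) (args μ₂) (μ₂ n)                    ≡⟨ cong₂ (λ ds → grows (inputSize ds * a) (args μ₂)) (map-Frame Xs (<n ∘ Fin.suc) fr) eq₂ ⟩
         grows (size * a) (args μ₂) (grows (length (μ X) * a) (args μ₁) (μ₁ n))    ≡⟨ cong₂ (grows (size * a)) args₂ (cong₂ (grows (length (μ X) * a)) args₁ eq₁) ⟩
         grows (size * a) (args μ) (grows (length (μ X) * a) (args μ) (μ n))       ≡⟨ grows-+ (length (μ X) * a) (size * a) (args μ) (μ n) ⟨
         grows (length (μ X) * a + size * a) (args μ) (μ n)                        ≡⟨ cong (λ b → grows b (args μ) (μ n)) (*-distribʳ-+ a (length (μ X)) size) ⟨
         grows ((length (μ X) + size) * a) (args μ) (μ n)                          ∎)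
    where
    open ≡-Reasoning
    size = inputSize (Vec.map μ Xs)

  level-executes : ∀ j (ds : Vec (Word k) n) μ → args μ ≡ ds → Executes j (level j) μ ((2 + inputSize ds) ^ j)
  level-executes zero    ds μ args≡ = extend-executes μ
  level-executes (suc j) ds μ args≡ =
    subst (Executes (suc j) (level (suc j)) μ) count
      (seq-executes (inputSize (args μ) * c′) (c′ + c′) (loops-executes ds (level-executes j ds) inputs inputs<n μ args≡) λ μ₁ eq₁ →
       seq-executes c′ c′ (weakened μ₁ (trans eq₁ args≡)) λ μ₂ eq₂ → weakened μ₂ (trans eq₂ (trans eq₁ args≡)))
    where
    c′ = (2 + inputSize ds) ^ j
    weakened : ∀ μ → args μ ≡ ds → Executes (suc j) (level j) μ c′
    weakened μ eq = let μ′ , r , fr , eq′ = level-executes j ds μ eq in μ′ , r , Frame-suc fr , eq′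
    arith : ∀ N c → N * c + (c + c) ≡ (2 + N) * c
    arith = solve-∀
    count : inputSize (args μ) * c′ + (c′ + c′) ≡ (2 + inputSize ds) ^ suc j
    count = trans (cong (λ ds → inputSize ds * c′ + (c′ + c′)) args≡) (arith (inputSize ds) c′)

  program : SeqProgram n
  program = record { body = level (degree output-bound) ; output = n ; inputs = inputs }

  program-terminates : StronglyTerminating (SeqProgram.body program)
  program-terminates μ = ⇓⇒Acc (proj₁ (proj₂ (level-executes (degree output-bound) (args μ) μ refl)))

  program-computes : ∀ ds → Computes program ds (f ds)
  program-computes ds =
    let μ₁ , r , _ , eq = level-executes (degree output-bound) ds μ args≡ in
    μ₁ , r , (begin
      μ₁ n                                       ≡⟨ eq ⟩
      -- Variable `n` is not an input and starts empty, that is, as the prefix of length 0.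
      grows m (args μ) (μ n)                     ≡⟨ cong₂ (grows m) args≡ (initStore-other toℕ n (λ i eq → <⇒≢ (Finₚ.toℕ<n i) eq) ds) ⟩
      grows m ds []                              ≡⟨ grows-take m 0 ds ⟩
      List.take m (f ds)                         ≡⟨ Listₚ.take-all m (f ds) (≤-trans (length-f ds) (Poly-≤ output-bound (inputSize ds))) ⟩
      f ds                                       ∎)
    where
    open ≡-Reasoning
    m = (2 + inputSize ds) ^ degree output-bound
    μ = initStore inputs ds
    args≡ : args μ ≡ ds
    args≡ = trans (sym (Vecₚ.tabulate-∘ μ toℕ)) (tabulate-≡ (initStore-lookup toℕ Finₚ.toℕ-injective ds))

  -- Safety of the program

  nonempty-neutral : Neutral nonempty
  nonempty-neutral = inj₁ λ { ([] ∷ []) → inj₂ refl ; ((_ ∷ _) ∷ []) → inj₁ refl }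

  tail-neutral : Neutral tail
  tail-neutral = inj₂ λ { (d ∷ []) → Fin.zero , List.take 1 d , [] ,
    sym (trans (cong (List.take 1 d ++_) (Listₚ.++-identityʳ (List.drop 1 d))) (Listₚ.take++drop≡id 1 d)) }

  neutral-or-positive : ∀ o → Neutral o ⊎ Positive o
  neutral-or-positive nonempty = inj₁ nonempty-neutral
  neutral-or-positive tail     = inj₁ tail-neutral
  neutral-or-positive grow     = inj₂ (1 , λ { (y ∷ ds) →
    ≤-trans (≤-reflexive (Listₚ.length-take (suc (length y)) (f ds)))
      (≤-trans (m⊓n≤m (suc (length y)) (length (f ds)))
        (≤-trans (s≤s (m≤m⊔n (length y) (maxLen ds))) (≤-reflexive (+-comm 1 (length y ⊔ maxLen ds))))) })

  -- The prefix receives results of the positive operator `grow` and so has tier `𝟘`; all guards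
  -- test counters, which are copied from inputs and only shortened, so these can have tier `𝟙`.
  Γ : ℕ → Tier
  Γ X with X Data.Nat.≟ n
  ... | yes _ = 𝟘
  ... | no _  = 𝟙

  Γ-output : Γ n ≡ 𝟘
  Γ-output with n Data.Nat.≟ n
  ... | yes _  = refl
  ... | no n≢n = ⊥-elim (n≢n refl)

  Γ-other : ∀ {X} → X ≢ n → Γ X ≡ 𝟙
  Γ-other {X} X≢n with X Data.Nat.≟ n
  ... | yes X≡n = ⊥-elim (X≢n X≡n)
  ... | no _    = refl

  data Δ : OpTyping where
    nonempty : Δ nonempty (𝟙 ∷ []) 𝟙
    tail     : Δ tail (𝟙 ∷ []) 𝟙
    grow     : ∀ αs → Δ grow αs 𝟘

  Δ-safe : SafeΔ Δ
  Δ-safe nonempty _ _ nonempty  = 𝟙⪯𝟙 , λ _ ¬neutral → ⊥-elim (¬neutral nonempty-neutral)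
  Δ-safe tail     _ _ tail      = 𝟙⪯𝟙 , λ _ ¬neutral → ⊥-elim (¬neutral tail-neutral)
  Δ-safe grow     _ _ (grow αs) = 𝟘⪯ , λ _ _ → refl

  open Typing Γ Δ

  vars-typed : ∀ {m} (Xs : Vec ℕ m) → ⊢Es Vec.map var Xs ∶ Vec.map Γ Xs
  vars-typed []       = []
  vars-typed (X ∷ Xs) = tvar ∷ vars-typed Xs

  extend-typed : Σ Tier λ α → ⊢C extend ∶ α
  extend-typed = _ , tassign (top (tvar ∷ vars-typed inputs) (grow _)) (subst (_⪯ 𝟘) (sym Γ-output) 𝟘⪯)

  Z-typed : ∀ j → ⊢E var (Z j) ∶ 𝟙
  Z-typed j = subst (⊢E var (Z j) ∶_) (Γ-other (Z≢n j)) tvar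

  ΓZ⪯ : ∀ j {α} → α ≡ 𝟙 → Γ (Z j) ⪯ α
  ΓZ⪯ j refl = subst (_⪯ 𝟙) (sym (Γ-other (Z≢n j))) 𝟙⪯𝟙

  loops-typed : ∀ {j C α m} (Xs : Vec ℕ m) → (∀ i → lookup Xs i < n) → ⊢C C ∶ α → Σ Tier λ β → ⊢C loops j C Xs ∶ β
  loops-typed []       <n c = 𝟘 , tskip
  loops-typed {j} (X ∷ Xs) <n c =
    _ , tseq (tseq (tassign tvar (ΓZ⪯ j (Γ-other (<⇒≢ (<n Fin.zero)))))
                   (twhile (top (Z-typed j ∷ []) nonempty) (tseq (tassign (top (Z-typed j ∷ []) tail) (ΓZ⪯ j refl)) c)))
             (proj₂ (loops-typed Xs (<n ∘ Fin.suc) c))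

  level-typed : ∀ j → Σ Tier λ α → ⊢C level j ∶ α
  level-typed zero    = extend-typed
  level-typed (suc j) =
    let _ , c = level-typed j in _ , tseq (proj₂ (loops-typed inputs inputs<n c)) (tseq c c)

  FPtime⇒computed : ComputedBySafeProgram k 𝐭 𝐟 n f
  FPtime⇒computed = signature , operators-FPtime , neutral-or-positive , program , program-terminates ,
    (Γ , Δ , Δ-safe , level-typed (degree output-bound)) , program-computes

theorem7 : (k : ℕ) (tt ff : Word k) → tt ≢ ff → (n : ℕ) (f : Vec (Word k) n → Word k) →
    (ComputedBySafeProgram k tt ff n f → TM.FPtime k f) × (TM.FPtime k f → ComputedBySafeProgram k tt ff n f)
theorem7 k 𝐭 𝐟 𝐭≢𝐟 n f =
  (λ (Sg , fp , np , M , _ , M-safe , M-computes) → SafeProgram.computed⇒FPtime k 𝐭 𝐟 𝐭≢𝐟 Sg fp np n f M M-safe M-computes) ,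
  GrowProgram.FPtime⇒computed k 𝐭 𝐟 𝐭≢𝐟 n f
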